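{- Let $L=(a_1,\dots,a_n)$ be a pinwheel covering instance with positive integer periods such that $\sum_{j=1}^n \frac{1}{a_j} \geq \sum_{i=0}^{\infty} \frac{1}{2^i+1}$. Then $L$ is schedulable.
   Context: A pinwheel covering (discretized point patrolling) instance is a finite list $(a_1,\dots,a_n)$ of positive integers (periods). A schedule is a map $f:\mathbb{N}\to\{1,\dots,n\}$ assigning each day to exactly one job. It is valid if for every $i$, every block of $a_i$ consecutive days contains at most one day assigned to job $i$. The instance is schedulable if a valid schedule exists. -}

module Defs where

open import Data.Nat using (ℕ; zero; suc; _+_; _^_; _≤_; _<_; NonZero)
open import Data.Fin using (Fin; zero; suc)
open import Data.Integer using (+_)
open import Data.Rational using (ℚ; 0ℚ; _/_)
import Data.Rational as ℚ
open import Relation.Binary.PropositionalEquality using (_≡_)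

-- A pinwheel covering instance with n jobs: periods a : Fin n → ℕ.
-- A schedule assigns each day (ℕ) to exactly one job.
Schedule : ℕ → Set
Schedule n = ℕ → Fin n

Valid : {n : ℕ} → (Fin n → ℕ) → Schedule n → Set
Valid {n} a f = (i : Fin n) (s d d' : ℕ) →
  s ≤ d → d < s + a i → s ≤ d' → d' < s + a i →
  f d ≡ i → f d' ≡ i → d ≡ d'

Schedulable : {n : ℕ} → (Fin n → ℕ) → Set
Schedulable {n} a = Σ (Schedule n) (Valid a)
  where open import Data.Product using (Σ)

density : {n : ℕ} (a : Fin n → ℕ) → ((i : Fin n) → NonZero (a i)) → ℚ
density {zero} a pos = 0ℚ
density {suc n} a pos =
  ((+ 1) / a zero) {{pos zero}} ℚ.+ density (λ i → a (suc i)) (λ i → pos (suc i))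

partialSum : ℕ → ℚ
partialSum zero = 0ℚ
partialSum (suc N) = partialSum N ℚ.+ ((+ 1) / suc (2 ^ N))

{-# OPTIONS --safe #-}
-- Jobs of periods in (1, 2], (2, 4], …, (2 ^ (K - 1), 2 ^ K] leave one slot of period 2 ^ K. Taking such jobs greedily, the
-- chain 2, 3, 5, 9, … being the worst case, we end with jobs of period > 2 ^ (K + 1) that have to fill a slot of period 2 ^ K.
-- Dividing by 2 ^ K leaves periods ≥ 3 whose density is still at least 1.264, and for those there is room to spare.
--
-- They are treated by a finite search over the multiset P of small periods. At a leaf P is known and the other periods are
-- ≥ L. For a cycle of length m place P in it and let r slots be free. Rounding the other jobs to m 2 ^ j, they fill the r slots
-- if their values 2 ^ -j add up to r; rounding to m 2 ^ j or 3 m 2 ^ j, they do so if the values add up to r + 1/6. Were all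
-- these tests to fail, a suitable positive combination of them (found by linear programming) would bound the density by less
-- than 1.264. It suffices to compare the combination with 1 / a for finitely many a, since halving a doubles the values.
module Submission where

open import Defs
open import Data.Bool using (Bool; true; false; if_then_else_; T; _∧_; _∨_; not)
open import Data.Bool.ListAction using (all)
open import Data.Empty using (⊥; ⊥-elim)
open import Data.Fin using (Fin; zero; suc; toℕ; fromℕ<)
open import Data.Fin.Properties using (toℕ-fromℕ<)
import Data.Integer as ℤ
import Data.Integer.Properties as ℤ
import Data.Integer.Tactic.RingSolver as ℤ
open import Data.List using (List; []; _∷_; _++_; replicate; map; tabulate; length; take; drop; zipWith; filterᵇ; null)
open import Data.List.Properties using (++-assoc; ++-identityʳ; map-++; map-∘; map-replicate; map-tabulate; length-replicate; length-tabulate; length-take; take++drop≡id)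
open import Data.List.Relation.Unary.All using (All; []; _∷_)
import Data.List.Relation.Unary.All as All
import Data.List.Relation.Unary.All.Properties as All
open import Data.List.Relation.Binary.Permutation.Propositional using (_↭_; prep; swap; ↭-refl; ↭-reflexive; ↭-sym; ↭-trans) renaming (refl to reflₚ; trans to transₚ)
open import Data.List.Relation.Binary.Permutation.Propositional.Properties using (All-resp-↭; ++⁺ˡ; ++⁺ʳ; ++-comm; map⁺; shift; ↭-length)
open import Data.Nat
open import Data.Nat.Properties
open import Data.Nat.Divisibility using (_∣_; ∣-trans; m∣m*n; n∣m*n)
open import Data.Nat.DivMod
open import Data.Nat.ListAction using (sum)
open import Data.Nat.ListAction.Properties using (sum-++; sum-↭)
open import Data.Nat.Tactic.RingSolver using (solve-∀)
open import Data.Product using (_×_; _,_; proj₁; proj₂; ∃; ∃₂)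
open import Data.Rational using (toℚᵘ)
import Data.Rational as ℚ
import Data.Rational.Properties as ℚ
open import Data.Rational.Unnormalised using (ℚᵘ; mkℚᵘ; *≡*; *≤*) renaming (_≃_ to _≃ᵘ_; _≤_ to _≤ᵘ_; _+_ to _+ᵘ_)
import Data.Rational.Unnormalised.Properties as ℚᵘ
open import Data.Sum as Sum using (_⊎_; inj₁; inj₂)
open import Data.Unit using (⊤; tt)
open import Function using (_∘_; id; const; it)
open import Relation.Binary using (tri<; tri≈; tri>)
open import Relation.Binary.PropositionalEquality using (_≡_; refl; sym; trans; cong; cong₂; subst; subst₂)
open import Relation.Nullary using (yes; no)

-- Covering sets of days

-- A job is treated as a slot that others may share. Its days, numbered in order, form a timeline of
-- their own, and jobs of periods `b` covering that timeline become jobs of periods `p * b` covering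
-- the days of a job of period `p`. Every filling step rests on this, and `⊵` records that some jobs
-- may replace others in any context.
--
-- The value 1.264 = 158/125 lies just below the sum 1.26449... of the theorem. The gap pays for
-- cutting the sum after 12 terms, which for slots of period 1 still gives 1.26401. That case is
-- tight. For a slot of period q the rounded-up quotient of a > 2 q by q is at most 3 a / (2 q + 1),
-- and the factor (2 q + 1) / 3 more than repairs the shorter sum.
--
-- The obstacle in the search is that the remaining periods are unbounded. For large a the values
-- are compared with 1 / (a - 1) instead of 1 / a: halving rounds a up and a - 1 down, so the
-- comparison on one range [T, 2 T) of a - 1 passes on to all larger a. Failure of all tests then
-- contradicts the density by integer arithmetic alone.

DaySet : Set
DaySet = ℕ → Bool

everyDay : DaySet
everyDay _ = true

_∖_ : DaySet → DaySet → DaySet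
(X ∖ S) d = X d ∧ not (S d)

_⊆_ : DaySet → DaySet → Set
X ⊆ Y = ∀ d → X d ≡ true → Y d ≡ true

-- Equivalent to every block of `p` consecutive days meeting `S` at most once, the form used in
-- `Valid`; distances are what adds up along a chain of days.
Spaced : ℕ → DaySet → Set
Spaced p S = ∀ {d d′} → S d ≡ true → S d′ ≡ true → d < d′ → d + p ≤ d′

-- A day may be taken by several jobs.
Covers : List ℕ → DaySet → Set
Covers []      X = ∀ d → X d ≡ false
Covers (p ∷ L) X = ∃ λ S → Spaced p S × Covers L (X ∖ S)

≡true⇒T : ∀ {b} → b ≡ true → T b
≡true⇒T refl = tt

∧-intro : ∀ {x y} → x ≡ true → y ≡ true → x ∧ y ≡ true
∧-intro refl refl = refl

∧-elimˡ : ∀ {x y} → x ∧ y ≡ true → x ≡ true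
∧-elimˡ {true} _ = refl

∧-elimʳ : ∀ {x y} → x ∧ y ≡ true → y ≡ true
∧-elimʳ {true} eq = eq

not-elim : ∀ {x} → not x ≡ true → x ≡ false
not-elim {false} _ = refl

∖-mono : ∀ {X Y S} → X ⊆ Y → (X ∖ S) ⊆ (Y ∖ S)
∖-mono {X} X⊆Y d h = ∧-intro (X⊆Y d (∧-elimˡ h)) (∧-elimʳ {X d} h)

covers-⊆ : ∀ L {X Y} → X ⊆ Y → Covers L Y → Covers L X
covers-⊆ [] {X} X⊆Y c d with X d in eq
... | false = refl
... | true  = trans (sym (X⊆Y d eq)) (c d)
covers-⊆ (p ∷ L) X⊆Y (S , sp , c) = S , sp , covers-⊆ L (∖-mono {S = S} X⊆Y) c

covers-drop : ∀ p {L X} → Covers L X → Covers (p ∷ L) X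
covers-drop p {L} {X} c = const false , (λ ()) , covers-⊆ L (λ d h → ∧-elimˡ h) c

covers-head : ∀ {p q L X} → q ≤ p → Covers (p ∷ L) X → Covers (q ∷ L) X
covers-head q≤p (S , sp , c) = S , (λ s s′ d<d′ → ≤-trans (+-monoʳ-≤ _ q≤p) (sp s s′ d<d′)) , c

covers-tail : ∀ A {T T′} → (∀ X → Covers T X → Covers T′ X) → ∀ {X} → Covers (A ++ T) X → Covers (A ++ T′) X
covers-tail []      f c            = f _ c
covers-tail (p ∷ A) f (S , sp , c) = S , sp , covers-tail A f c

∖-comm : ∀ X S T → ((X ∖ S) ∖ T) ⊆ ((X ∖ T) ∖ S)
∖-comm X S T d h = ∧-intro (∧-intro (∧-elimˡ {X d} (∧-elimˡ h)) (∧-elimʳ {X d ∧ not (S d)} h))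
                           (∧-elimʳ {X d} (∧-elimˡ h))

covers-↭ : ∀ {L L′} → L ↭ L′ → ∀ {X} → Covers L X → Covers L′ X
covers-↭ reflₚ c = c
covers-↭ (prep p π) (S , sp , c) = S , sp , covers-↭ π c
covers-↭ (swap {xs} p q π) {X} (S , sp , T , tp , c) =
  T , tp , S , sp , covers-↭ π (covers-⊆ xs (∖-comm X T S) c)
covers-↭ (transₚ π ρ) c = covers-↭ ρ (covers-↭ π c)

-- Replacing jobs by other jobs

infix 4 _⊵_
-- `A` can stand in for `B`. Quantifying over the companions `L` and the day set `X` makes the
-- relation compatible with `++`, so slots can be filled independently of each other.
_⊵_ : List ℕ → List ℕ → Set
A ⊵ B = ∀ L X → Covers (B ++ L) X → Covers (A ++ L) X

⊵-refl : ∀ {A} → A ⊵ A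
⊵-refl L X c = c

⊵-trans : ∀ {A B C} → A ⊵ B → B ⊵ C → A ⊵ C
⊵-trans f g L X c = f L X (g L X c)

⊵-++ : ∀ {A A′ B B′} → A ⊵ B → A′ ⊵ B′ → (A ++ A′) ⊵ (B ++ B′)
⊵-++ {A} {A′} {B} {B′} f g L X c =
  subst (λ T → Covers T X) (sym (++-assoc A A′ L))
    (covers-tail A (g L) (f (B′ ++ L) X (subst (λ T → Covers T X) (++-assoc B B′ L) c)))

⊵-↭ : ∀ {A B} → A ↭ B → A ⊵ B
⊵-↭ π L X = covers-↭ (++⁺ʳ L (↭-sym π))

⊵-drop : ∀ A → A ⊵ []
⊵-drop []      L X c = c
⊵-drop (p ∷ A) L X c = covers-drop p (⊵-drop A L X c)

⊵-weaken : ∀ A {B C} → A ⊵ C → (A ++ B) ⊵ C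
⊵-weaken A {B} {C} f = subst (λ T → (A ++ B) ⊵ T) (++-identityʳ C) (⊵-++ f (⊵-drop B))

⊵-head : ∀ {p q} → q ≤ p → (q ∷ []) ⊵ (p ∷ [])
⊵-head q≤p L X c = covers-head q≤p c

⊵-covers : ∀ {A B X} → A ⊵ B → Covers B X → Covers A X
⊵-covers {A} {B} {X} f c = subst (λ T → Covers T X) (++-identityʳ A)
  (f [] X (subst (λ T → Covers T X) (sym (++-identityʳ B)) c))

⊵-replicate : ∀ {M A} → All (_≤ M) A → A ⊵ replicate (length A) M
⊵-replicate []         = ⊵-refl
⊵-replicate (a≤M ∷ as) = ⊵-++ (⊵-head a≤M) (⊵-replicate as)

-- Sharing the days of one job

module _ (S : DaySet) where
  -- The number of days of `S` before a given day. On `S` itself this is the order-preserving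
  -- numbering that turns `S` into a timeline of its own.
  rank : ℕ → ℕ
  rank zero    = zero
  rank (suc d) = if S d then suc (rank d) else rank d

  rank-suc : ∀ {d} → S d ≡ true → rank (suc d) ≡ suc (rank d)
  rank-suc eq rewrite eq = refl

  rank-mono : ∀ {d e} → d ≤′ e → rank d ≤ rank e
  rank-mono ≤′-refl = ≤-refl
  rank-mono (≤′-step {e} d≤e) with S e
  ... | true  = m≤n⇒m≤1+n (rank-mono d≤e)
  ... | false = rank-mono d≤e

  rank-< : ∀ {d e} → S d ≡ true → d < e → rank d < rank e
  rank-< s d<e = ≤-trans (≤-reflexive (sym (rank-suc s))) (rank-mono (≤⇒≤′ d<e))

  rank-pred : ∀ e {k} → rank e ≡ suc k → ∃ λ d → d < e × S d ≡ true × rank d ≡ k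
  rank-pred (suc e) eq with S e in s
  ... | true  = e , ≤-refl , s , suc-injective eq
  ... | false with rank-pred e eq
  ...   | d , d<e , s′ , eq′ = d , m≤n⇒m≤1+n d<e , s′ , eq′

  rank-reflects-≤ : ∀ {d e} → S e ≡ true → rank d ≤ rank e → d ≤ e
  rank-reflects-≤ s h = ≮⇒≥ (λ e<d → <-irrefl refl (≤-trans (rank-< s e<d) h))

  -- Going back from `e` through `j` predecessors in `S` costs at least `p` days each time and does
  -- not pass `d`.
  spaced-rank : ∀ {p} → Spaced p S → ∀ j {d e} → S d ≡ true → S e ≡ true → rank d + j ≤ rank e → d + p * j ≤ e
  spaced-rank {p} sp zero {d} {e} s s′ h =
    subst (λ t → d + t ≤ e) (sym (*-zeroʳ p))
      (subst (_≤ e) (sym (+-identityʳ d)) (rank-reflects-≤ s′ (subst (_≤ rank e) (+-identityʳ _) h)))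
  spaced-rank {p} sp (suc j) {d} {e} s s′ h with rank e in eq
  ... | zero = ⊥-elim (n≮0 (≤-trans (≤-reflexive (sym (+-suc (rank d) j))) h))
  ... | suc k with rank-pred e eq
  ...   | c , c<e , s″ , refl = begin
    d + p * suc j   ≡⟨ cong (d +_) (*-suc p j) ⟩
    d + (p + p * j) ≡⟨ cong (d +_) (+-comm p (p * j)) ⟩
    d + (p * j + p) ≡⟨ sym (+-assoc d (p * j) p) ⟩
    (d + p * j) + p ≤⟨ +-monoˡ-≤ p (spaced-rank sp j s s″ (s≤s⁻¹ (subst (_≤ suc (rank c)) (+-suc (rank d) j) h))) ⟩
    c + p           ≤⟨ sp s″ s′ c<e ⟩
    e               ∎
    where open ≤-Reasoning

  -- Generalised for induction on `bs`: `Y` is the set of ranks that `bs` still has to cover, and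
  -- `Z` collects the days left to the other jobs. A job of period `b` on ranks takes the days of
  -- `S` whose rank it holds, and these are `p * b` apart by `spaced-rank`.
  covers-within : ∀ {p} → Spaced p S → ∀ bs {L X Y Z} → Covers bs Y → Covers L Z →
    (∀ d → X d ≡ true → (S d ≡ true × Y (rank d) ≡ true) ⊎ Z d ≡ true) → Covers (map (p *_) bs ++ L) X
  covers-within sp [] {L} {X} {Y} {Z} y z h = covers-⊆ L X⊆Z z
    where
    X⊆Z : X ⊆ Z
    X⊆Z d x with h d x
    ... | inj₂ z′ = z′
    ... | inj₁ (_ , y′) with trans (sym y′) (y (rank d))
    ...   | ()
  covers-within {p} sp (b ∷ bs) {L} {X} {Y} {Z} (T , tp , y) z h =
    (λ d → S d ∧ T (rank d)) , spaced′ , covers-within sp bs y z h′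
    where
    spaced′ : Spaced (p * b) (λ d → S d ∧ T (rank d))
    spaced′ {d} {d′} s s′ d<d′ = spaced-rank sp b (∧-elimˡ s) (∧-elimˡ s′)
      (tp (∧-elimʳ {S d} s) (∧-elimʳ {S d′} s′) (rank-< (∧-elimˡ s) d<d′))
    h′ : ∀ d → (X ∖ (λ d → S d ∧ T (rank d))) d ≡ true → (S d ≡ true × (Y ∖ T) (rank d) ≡ true) ⊎ Z d ≡ true
    h′ d x with h d (∧-elimˡ x)
    ... | inj₂ z′ = inj₂ z′
    ... | inj₁ (s , y′) with X d | S d | T (rank d)
    h′ d () | inj₁ (s , y′) | true | true | true
    ... | true | true | false = inj₁ (refl , ∧-intro y′ refl)

-- The days of the job of period `p` are handed over to `bs` by rank; all other days stay with the
-- companions.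
⊵-compose : ∀ p {bs} → Covers bs everyDay → map (p *_) bs ⊵ (p ∷ [])
⊵-compose p {bs} y L X (S , sp , z) = covers-within S sp bs y z h
  where
  h : ∀ d → X d ≡ true → (S d ≡ true × true ≡ true) ⊎ (X ∖ S) d ≡ true
  h d x with S d
  ... | true  = inj₁ (refl , refl)
  ... | false = inj₂ (∧-intro x refl)

covers-one : Covers (1 ∷ []) everyDay
covers-one = everyDay , (λ {d} _ _ d<d′ → ≤-trans (≤-reflexive (+-comm d 1)) d<d′) , λ _ → refl

-- From coverings to schedules

covers⇒family : ∀ n (a : Fin n → ℕ) {X} → Covers (tabulate a) X →
  ∃ λ (S : Fin n → DaySet) → (∀ i → Spaced (a i) (S i)) × (∀ d → X d ≡ true → ∃ λ i → S i d ≡ true)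
covers⇒family zero a {X} c = (λ ()) , (λ ()) , λ d x → ⊥-elim (absurd (trans (sym x) (c d)))
  where absurd : true ≡ false → ⊥
        absurd ()
covers⇒family (suc n) a {X} (S , sp , c) with covers⇒family n (a ∘ suc) c
... | T , tp , cov = U , up , cov′
  where
  U : Fin (suc n) → DaySet
  U zero    = S
  U (suc i) = T i
  up : ∀ i → Spaced (a i) (U i)
  up zero    = sp
  up (suc i) = tp i
  cov′ : ∀ d → X d ≡ true → ∃ λ i → U i d ≡ true
  cov′ d x with S d in eq
  ... | true  = zero , eq
  ... | false with cov d (∧-intro x (cong not eq))
  ...   | i , t = suc i , t

-- Where several jobs hold a day, one of them is selected. The days on which job `i` is selected
-- form a subset of `S i`, so they inherit its spacing.
covers⇒schedulable : ∀ {n} (a : Fin n → ℕ) → Covers (tabulate a) everyDay → Schedulable a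
covers⇒schedulable {n} a c with covers⇒family n a c
... | S , sp , cov = f , valid
  where
  f : Schedule n
  f d = proj₁ (cov d refl)
  on : ∀ {d i} → f d ≡ i → S i d ≡ true
  on {d} refl = proj₂ (cov d refl)
  apart : ∀ {i s d d′} → s ≤ d → d′ < s + a i → f d ≡ i → f d′ ≡ i → d < d′ → ⊥
  apart {i} s≤d d′< e e′ d<d′ = <-irrefl refl (≤-trans d′< (≤-trans (+-monoˡ-≤ (a i) s≤d) (sp i (on e) (on e′) d<d′)))
  valid : Valid a f
  valid i s d d′ s≤d d< s≤d′ d′< e e′ with <-cmp d d′
  ... | tri< d<d′ _ _ = ⊥-elim (apart s≤d d′< e e′ d<d′)
  ... | tri≈ _ d≡d′ _ = d≡d′
  ... | tri> _ _ d′<d = ⊥-elim (apart s≤d′ d< e′ e d′<d)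

-- The certificate checker

-- Unlike _⊔_ this computes by a single comparison of literals.
max : ℕ → ℕ → ℕ
max x y = if x ≤ᵇ y then y else x

-- 2 ^ (K - j) for the least j with a ≤ m 2 ^ j, and 0 if j > K.
val : ℕ → ℕ → ℕ → ℕ
val zero    m a = if a ≤ᵇ m then 1 else 0
val (suc K) m a = if a ≤ᵇ m then 2 ^ suc K else val K (m * 2) a

-- Marks slots for a job of period p: the first free slot after w slots, then always the first free slot at distance at least p,
-- all among the next lim slots. In the list of occupied slots true means occupied.
walk : ℕ → ℕ → ℕ → List Bool → List Bool
walk p w       lim       []           = []
walk p w       zero      (_ ∷ bs)     = false ∷ walk p w zero bs
walk p w       (suc lim) (true ∷ bs)  = false ∷ walk p (w ∸ 1) lim bs
walk p zero    (suc lim) (false ∷ bs) = true ∷ walk p (p ∸ 1) lim bs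
walk p (suc w) (suc lim) (false ∷ bs) = false ∷ walk p w lim bs

-- The counter `w` is the number of slots that must still pass before a mark is allowed.
gapped : ℕ → ℕ → List Bool → Bool
gapped p w       []           = true
gapped p w       (false ∷ bs) = gapped p (w ∸ 1) bs
gapped p zero    (true ∷ bs)  = gapped p (p ∸ 1) bs
gapped p (suc w) (true ∷ bs)  = false

orIf : Bool → List Bool → List Bool → List Bool
orIf true  os qs = zipWith _∨_ os qs
orIf false os qs = os

-- The number of slots to skip for each job is read off the base-64 digits of c. A placement is discarded unless it is spaced
-- over two rounds of the cycle, so soundness does not depend on c.
place : ℕ → ℕ → List Bool → List ℕ → List Bool
place m c os []      = os
place m c os (p ∷ P) =
  if m <ᵇ p
  then place m c os P
  -- The limit keeps every mark at or before slot `c % 64 + m ∸ p`, while the first is at or after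
  -- slot `c % 64`. So the gap across the end of the round is at least `p` too.
  else (let qs = walk p (c % 64) (suc (c % 64 + m ∸ p)) os in
        place m (c / 64) (orIf (gapped p 0 (qs ++ qs)) os qs) P)

#false : List Bool → ℕ
#false []           = 0
#false (true ∷ bs)  = #false bs
#false (false ∷ bs) = suc (#false bs)

-- A cycle of length m, a code for the placement of the known jobs, and the multipliers of the two tests.
record Strategy : Set where
  constructor on
  field m code α β : ℕ

-- With x = val K m a and y = val K (m * 3) a the two tests are Σ 6 x ≥ 6 r 2 ^ K and Σ 2 max (3 x) y ≥ (6 r + 1) 2 ^ K.
comb : ℕ → ℕ → ℕ → ℕ → ℕ
comb α β x y = α * (6 * x) + β * (2 * max (3 * x) y)

weight : ℕ → Strategy → ℕ → ℕ
weight K (on m _ α β) a = comb α β (val K m a) (val K (m * 3) a)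

total : ℕ → List Strategy → ℕ → ℕ
total K es a = sum (map (λ x → weight K x a) es)

slots : List ℕ → Strategy → ℕ
slots P (on m c _ _) = #false (place m c (replicate m false) P)

require : List ℕ → Strategy → ℕ
require P x@(on m c α β) = let r = slots P x in α * (6 * r) + β * suc (6 * r)

bigger : ℕ → List ℕ → List ℕ
bigger m = filterᵇ (m <ᵇ_)

∑ : {A : Set} → (A → ℕ) → List A → ℕ
∑ f xs = sum (map f xs)

requires : List ℕ → List Strategy → ℕ
requires P = ∑ (require P)

-- One comparison for two conditions: `m` is positive, so that residues modulo `m` make sense, and
-- `α + β` is positive, so that a strict failure of both tests stays strict after they are combined.
usable : Strategy → Bool
usable (on m _ α β) = 1 ≤ᵇ m * (α + β)

allFrom : (ℕ → Bool) → ℕ → ℕ → Bool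
allFrom f a zero    = true
allFrom f a (suc n) = f a ∧ allFrom f (suc a) n

-- In br t u the tree t is for instances without the period L and u for those with it.
data Tree : Set where
  leaf : ℕ → List Strategy → Tree
  br   : Tree → Tree → Tree

-- B / A is the density, N the precision of reciprocals, T the start of the periods to which halving applies, and 2 ^ κ the
-- resolution of values.
module Checker (A B N T κ : ℕ) where

  -- An integer above the exact quotient, so `cost P / N` overestimates the density of `P` and the
  -- density left for the other jobs is never overstated.
  share : ℕ → ℕ
  share zero    = N
  share (suc p) = suc (N / suc p)

  cost : List ℕ → ℕ
  cost = ∑ share

  -- Known jobs with a period above `m` find no place in a cycle of length `m`. They serve as
  -- fillers like the unknown jobs, and their values are credited here.
  supplies : List ℕ → List Strategy → ℕ
  supplies P = ∑ (λ x → ∑ (weight κ x) (bigger (Strategy.m x) P))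

  -- Both compare `Λ` times a reciprocal with the combined value of a job: `headOK` uses 1 / a, and
  -- `tailOK`, for the period b + 1, uses the larger 1 / b. The second form is the one that halving
  -- preserves.
  headOK tailOK : ℕ → List Strategy → ℕ → Bool
  headOK Λ es a = 2 ^ κ * Λ ≤ᵇ a * total κ es a
  tailOK Λ es b = 2 ^ κ * Λ ≤ᵇ b * total κ es (suc b)

  -- The last conjunct, cleared of denominators, says `requires P es - supplies P es / 2 ^ κ ≤ Λ *
  -- (B / A - cost P / N)`. If all tests fail, the unknown jobs have combined value below the left
  -- side, yet by the other conjuncts it is at least `Λ` times their density, hence at least the
  -- right side.
  checkLeaf : ℕ → List Strategy → List ℕ → ℕ → Bool
  checkLeaf Λ es P L =
    not (null es) ∧ all usable es ∧ allFrom (headOK Λ es) L (suc T ∸ L) ∧ allFrom (tailOK Λ es) T T ∧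
    (2 ^ κ * (A * (N * requires P es + Λ * cost P)) ≤ᵇ 2 ^ κ * (B * (N * Λ)) + A * (N * supplies P es))

  check : Tree → List ℕ → ℕ → Bool
  check (leaf Λ es) P L = checkLeaf Λ es P L
  check (br t u)    P L = check t P (suc L) ∧ check u (P ++ L ∷ []) L

-- Placing the known jobs in a cycle

_∩_ : DaySet → DaySet → DaySet
(X ∩ Y) d = X d ∧ Y d

at : Bool → List Bool → ℕ → Bool
at b []       i       = b
at b (x ∷ xs) zero    = x
at b (x ∷ xs) (suc i) = at b xs i

at-++ˡ : ∀ b xs ys {i} → i < length xs → at b (xs ++ ys) i ≡ at b xs i
at-++ˡ b (x ∷ xs) ys {zero}  h       = refl
at-++ˡ b (x ∷ xs) ys {suc i} (s≤s h) = at-++ˡ b xs ys h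

at-++ʳ : ∀ b xs ys i → at b (xs ++ ys) (i + length xs) ≡ at b ys i
at-++ʳ b []       ys i = cong (at b ys) (+-identityʳ i)
at-++ʳ b (x ∷ xs) ys i = trans (cong (at b (x ∷ xs ++ ys)) (+-suc i (length xs))) (at-++ʳ b xs ys i)

at-replicate : ∀ n {i} → i < n → at true (replicate n false) i ≡ false
at-replicate (suc n) {zero}  h       = refl
at-replicate (suc n) {suc i} (s≤s h) = at-replicate n h

at-zipWith : ∀ os qs i → length os ≡ length qs →
  at true os i ≡ false → at false qs i ≡ false → at true (zipWith _∨_ os qs) i ≡ false
at-zipWith (o ∷ os) (q ∷ qs) zero    eq refl refl = refl
at-zipWith (o ∷ os) (q ∷ qs) (suc i) eq h    h′   = at-zipWith os qs i (suc-injective eq) h h′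

gapped⇒≤ : ∀ p w bs {i} → gapped p w bs ≡ true → at false bs i ≡ true → w ≤ i
gapped⇒≤ p w       (false ∷ bs) {suc i} g h = ≤-trans (suc-pred-≤ w) (s≤s (gapped⇒≤ p (w ∸ 1) bs g h))
  where suc-pred-≤ : ∀ w → w ≤ suc (w ∸ 1)
        suc-pred-≤ zero    = z≤n
        suc-pred-≤ (suc w) = ≤-refl
gapped⇒≤ p zero    (true ∷ bs)          g h = z≤n

gapped⇒gap : ∀ p w bs {i j} → gapped p w bs ≡ true →
  at false bs i ≡ true → at false bs j ≡ true → i < j → i + p ≤ j
gapped⇒gap p w    (false ∷ bs) {suc i} {suc j} g h h′ (s≤s i<j) = s≤s (gapped⇒gap p (w ∸ 1) bs g h h′ i<j)
gapped⇒gap p zero (true ∷ bs)  {suc i} {suc j} g h h′ (s≤s i<j) = s≤s (gapped⇒gap p (p ∸ 1) bs g h h′ i<j)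
gapped⇒gap p zero (true ∷ bs)  {zero}  {suc j} g h h′ i<j       =
  ≤-trans (m≤n+m∸n p 1) (s≤s (gapped⇒≤ p (p ∸ 1) bs g h′))

length-walk : ∀ p w lim bs → length (walk p w lim bs) ≡ length bs
length-walk p w       lim       []           = refl
length-walk p w       zero      (b ∷ bs)     = cong suc (length-walk p w zero bs)
length-walk p w       (suc lim) (true ∷ bs)  = cong suc (length-walk p (w ∸ 1) lim bs)
length-walk p zero    (suc lim) (false ∷ bs) = cong suc (length-walk p (p ∸ 1) lim bs)
length-walk p (suc w) (suc lim) (false ∷ bs) = cong suc (length-walk p w lim bs)

length-zipWith-≡ : ∀ (os qs : List Bool) → length os ≡ length qs → length (zipWith _∨_ os qs) ≡ length os
length-zipWith-≡ []       []       eq = refl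
length-zipWith-≡ (o ∷ os) (q ∷ qs) eq = cong suc (length-zipWith-≡ os qs (suc-injective eq))

module Cycle (m : ℕ) {{_ : NonZero m}} where

  -- The defaults passed to `at` are on the safe side: past the end of a list a slot counts as not
  -- marked, or as occupied. The latter makes the empty list leave no free days.
  marked unmarked : List Bool → DaySet
  marked   qs d = at false qs (d % m)
  unmarked os d = not (at true os (d % m))

  at-twice : ∀ qs {i} → length qs ≡ m → i < m + m → at false (qs ++ qs) i ≡ at false qs (i % m)
  at-twice qs {i} refl i<2m with i <? m
  ... | yes i<m = trans (at-++ˡ false qs qs i<m) (cong (at false qs) (sym (m<n⇒m%n≡m i<m)))
  ... | no i≮m with m≤n⇒∃[o]m+o≡n (≮⇒≥ i≮m)
  ...   | k , refl rewrite +-comm m k =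
    trans (at-++ʳ false qs qs k) (cong (at false qs) (sym (trans ([m+n]%n≡m%n k m) (m<n⇒m%n≡m (+-cancelʳ-< m k m i<2m)))))

  -- Two marked days closer than `p ≤ m` lie within two consecutive rounds, counted from the start
  -- of the round of the earlier one. So checking `qs ++ qs` is enough.
  marked-spaced : ∀ p qs → p ≤ m → length qs ≡ m → gapped p 0 (qs ++ qs) ≡ true → Spaced p (marked qs)
  marked-spaced p qs p≤m len g {d} {d′} h h′ d<d′ with d + p ≤? d′
  ... | yes le = le
  ... | no nle with m≤n⇒∃[o]m+o≡n (<⇒≤ d<d′)
  ...   | k , refl = +-monoʳ-≤ d (+-cancelˡ-≤ x p k (gapped⇒gap p 0 (qs ++ qs) g
            (trans (at-twice qs len (≤-trans x<m (m≤m+n m m))) (trans (cong (at false qs) (m%n%n≡m%n d m)) h))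
            (trans (at-twice qs len (+-mono-< x<m k<m)) (trans (cong (at false qs) same-residue) h′))
            (m<m+n x 0<k)))
    where
    x : ℕ
    x = d % m
    x<m : x < m
    x<m = m%n<n d m
    k<m : k < m
    k<m = ≤-trans (+-cancelˡ-< d k p (≰⇒> nle)) p≤m
    0<k : 0 < k
    0<k = +-cancelˡ-< d 0 k (subst (_< d + k) (sym (+-identityʳ d)) d<d′)
    same-residue : (x + k) % m ≡ (d + k) % m
    same-residue = trans (%-distribˡ-+ x k m) (trans (cong (λ t → (t + k % m) % m) (m%n%n≡m%n d m)) (sym (%-distribˡ-+ d k m)))

  residue-spaced : ∀ o → Spaced m (λ d → d % m ≡ᵇ o)
  residue-spaced o {d} {d′} h h′ d<d′ = begin
    d + m                           ≡⟨ cong (_+ m) (m≡m%n+[m/n]*n d m) ⟩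
    d % m + d / m * m + m           ≡⟨ +-assoc (d % m) _ m ⟩
    d % m + (d / m * m + m)         ≡⟨ cong₂ _+_ same (+-comm _ m) ⟩
    d′ % m + suc (d / m) * m        ≤⟨ +-monoʳ-≤ (d′ % m) (*-monoˡ-≤ m quotient-<) ⟩
    d′ % m + d′ / m * m             ≡⟨ sym (m≡m%n+[m/n]*n d′ m) ⟩
    d′                              ∎
    where
    open ≤-Reasoning
    same : d % m ≡ d′ % m
    same = trans (≡ᵇ⇒≡ _ o (subst T (sym h) tt)) (sym (≡ᵇ⇒≡ _ o (subst T (sym h′) tt)))
    quotient-< : d / m < d′ / m
    quotient-< = ≰⇒> (λ le → <⇒≱ d<d′ (begin
      d′                   ≡⟨ m≡m%n+[m/n]*n d′ m ⟩
      d′ % m + d′ / m * m  ≤⟨ +-mono-≤ (≤-reflexive (sym same)) (*-monoˡ-≤ m le) ⟩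
      d % m + d / m * m    ≡⟨ sym (m≡m%n+[m/n]*n d m) ⟩
      d                    ∎))

  -- The free days at residue `o` or later, with `bs` describing the slots from `o` on; this is what
  -- allows induction along the list.
  unmarkedFrom : ℕ → List Bool → DaySet
  unmarkedFrom o bs d = (o ≤ᵇ d % m) ∧ not (at true bs (d % m ∸ o))

  from-step : ∀ o b bs {d} → unmarkedFrom o (b ∷ bs) d ≡ true → (d % m ≡ᵇ o) ≡ false → unmarkedFrom (suc o) bs d ≡ true
  from-step o b bs {d} h h′ with m≤n⇒∃[o]m+o≡n (≤ᵇ⇒≤ o (d % m) (subst T (sym (∧-elimˡ h)) tt))
  ... | zero , eq with trans (sym h′) (trans (cong (_≡ᵇ o) (trans (sym eq) (+-identityʳ o))) (≡ᵇ-refl o))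
    where ≡ᵇ-refl : ∀ n → (n ≡ᵇ n) ≡ true
          ≡ᵇ-refl zero    = refl
          ≡ᵇ-refl (suc n) = ≡ᵇ-refl n
  ...   | ()
  from-step o b bs {d} h h′ | suc k , eq = ∧-intro le (trans (cong (not ∘ at true bs) ∸k) (trans (cong (not ∘ at true (b ∷ bs)) (sym ∸sk)) (∧-elimʳ {o ≤ᵇ d % m} h)))
    where
    T⇒≡ : ∀ {b} → T b → b ≡ true
    T⇒≡ {true} _ = refl
    le : (suc o ≤ᵇ d % m) ≡ true
    le = T⇒≡ (≤⇒≤ᵇ (subst (suc o ≤_) eq (subst (_≤ o + suc k) (+-comm o 1) (+-monoʳ-≤ o (s≤s z≤n)))))
    ∸sk : d % m ∸ o ≡ suc k
    ∸sk = trans (cong (_∸ o) (sym eq)) (m+n∸m≡n o (suc k))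
    ∸k : d % m ∸ suc o ≡ k
    ∸k = trans (cong (_∸ suc o) (trans (sym eq) (+-suc o k))) (m+n∸m≡n (suc o) k)

  -- Each free slot is a residue class modulo `m`, which suits one job of period `m`.
  covers-from : ∀ o bs → Covers (replicate (#false bs) m) (unmarkedFrom o bs)
  covers-from o []           d with o ≤ᵇ d % m
  ... | true  = refl
  ... | false = refl
  covers-from o (true ∷ bs)  = covers-⊆ _ step (covers-from (suc o) bs)
    where
    step : unmarkedFrom o (true ∷ bs) ⊆ unmarkedFrom (suc o) bs
    step d h with d % m ≡ᵇ o in eq
    ... | false = from-step o true bs {d} h eq
    ... | true rewrite ≡ᵇ⇒≡ (d % m) o (subst T (sym eq) tt) | n∸n≡0 o with ∧-elimʳ {o ≤ᵇ o} h
    ...   | ()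
  covers-from o (false ∷ bs) = (λ d → d % m ≡ᵇ o) , residue-spaced o , covers-⊆ _ step (covers-from (suc o) bs)
    where
    step : (unmarkedFrom o (false ∷ bs) ∖ (λ d → d % m ≡ᵇ o)) ⊆ unmarkedFrom (suc o) bs
    step d h = from-step o false bs {d} (∧-elimˡ h) (not-elim (∧-elimʳ {unmarkedFrom o (false ∷ bs) d} h))

  covers-unmarked : ∀ os → Covers (replicate (#false os) m) (unmarked os)
  covers-unmarked os = covers-⊆ _ (λ d h → h) (covers-from 0 os)

  #false-replicate : ∀ n → #false (replicate n false) ≡ n
  #false-replicate zero    = refl
  #false-replicate (suc n) = cong suc (#false-replicate n)

  unmarked-initial : everyDay ⊆ unmarked (replicate m false)
  unmarked-initial d _ = cong not (at-replicate m (m%n<n d m))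

  covers-residues : Covers (replicate m m) everyDay
  covers-residues = covers-⊆ (replicate m m) unmarked-initial
    (subst (λ n → Covers (replicate n m) (unmarked (replicate m false))) (#false-replicate m) (covers-unmarked (replicate m false)))

  -- Jobs above `m` may stand anywhere in `P`, and the days they take are known only from the
  -- hypothesis. The set `X` records what such jobs at earlier positions have left. A placement that
  -- fails the spacing test is handled by letting the job take no days.
  place-sound : ∀ c os P J X → length os ≡ m →
    Covers (bigger m P ++ J) (X ∩ unmarked (place m c os P)) → Covers (P ++ J) (X ∩ unmarked os)
  place-sound c os []      J X len cov = cov
  place-sound c os (p ∷ P) J X len cov with m <ᵇ p in m<p
  place-sound c os (p ∷ P) J X len (S , sp , cov) | true = S , sp ,
    covers-⊆ (P ++ J) (λ d → exchange {X d})
      (place-sound c os P J (X ∖ S) len (covers-⊆ (bigger m P ++ J) (λ d → exchange′ {X d}) cov))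
    where
    exchange : ∀ {x u s} → (x ∧ u) ∧ s ≡ true → (x ∧ s) ∧ u ≡ true
    exchange {true} {true} h = ∧-intro h refl
    exchange′ : ∀ {x u s} → (x ∧ s) ∧ u ≡ true → (x ∧ u) ∧ s ≡ true
    exchange′ {true} {u} {true} h = ∧-intro h refl
  ... | false with gapped p 0 (walk p (c % 64) (suc (c % 64 + m ∸ p)) os ++ walk p (c % 64) (suc (c % 64 + m ∸ p)) os) in g
  ...   | false = covers-drop p (place-sound (c / 64) os P J X len cov)
  ...   | true  = marked qs , marked-spaced p qs p≤m len′ g ,
                  covers-⊆ (P ++ J) step (place-sound (c / 64) (zipWith _∨_ os qs) P J X len″ cov)
    where
    qs : List Bool
    qs = walk p (c % 64) (suc (c % 64 + m ∸ p)) os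
    p≤m : p ≤ m
    p≤m = ≮⇒≥ (λ lt → subst T m<p (<⇒<ᵇ lt))
    len-qs : length qs ≡ length os
    len-qs = length-walk p (c % 64) _ os
    len′ : length qs ≡ m
    len′ = trans len-qs len
    len″ : length (zipWith _∨_ os qs) ≡ m
    len″ = trans (length-zipWith-≡ os qs (sym len-qs)) len
    step : ((X ∩ unmarked os) ∖ marked qs) ⊆ (X ∩ unmarked (zipWith _∨_ os qs))
    step d h = ∧-intro (∧-elimˡ {X d} (∧-elimˡ h)) (cong not (at-zipWith os qs (d % m) (sym len-qs)
      (not-elim (∧-elimʳ {X d} (∧-elimˡ h))) (not-elim (∧-elimʳ {X d ∧ unmarked os d} h))))

  place-fill : ∀ c P R → (bigger m P ++ R) ⊵ replicate (#false (place m c (replicate m false) P)) m → Covers (P ++ R) everyDay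
  place-fill c P R f = covers-⊆ (P ++ R) unmarked-initial
    (place-sound c (replicate m false) P R everyDay (length-replicate m)
      (⊵-covers f (covers-unmarked (place m c (replicate m false) P))))

-- Filling slots with rounded jobs

∑-++ : ∀ {A : Set} (f : A → ℕ) xs ys → ∑ f (xs ++ ys) ≡ ∑ f xs + ∑ f ys
∑-++ f xs ys = trans (cong sum (map-++ f xs ys)) (sum-++ (map f xs) (map f ys))

∑-↭ : ∀ {A : Set} (f : A → ℕ) {xs ys} → xs ↭ ys → ∑ f xs ≡ ∑ f ys
∑-↭ f π = sum-↭ (map⁺ f π)

∑-cong : ∀ {A : Set} {f g : A → ℕ} {xs} → All (λ x → f x ≡ g x) xs → ∑ f xs ≡ ∑ g xs
∑-cong []         = refl
∑-cong (eq ∷ eqs) = cong₂ _+_ eq (∑-cong eqs)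

∑-mono : ∀ {A : Set} {f g : A → ℕ} {xs} → All (λ x → f x ≤ g x) xs → ∑ f xs ≤ ∑ g xs
∑-mono []       = z≤n
∑-mono (h ∷ hs) = +-mono-≤ h (∑-mono hs)

∑-+ : ∀ {A : Set} (f g : A → ℕ) xs → ∑ (λ x → f x + g x) xs ≡ ∑ f xs + ∑ g xs
∑-+ f g []       = refl
∑-+ f g (x ∷ xs) = trans (cong (f x + g x +_) (∑-+ f g xs)) (interchange (f x) (g x) (∑ f xs) (∑ g xs))
  where interchange : ∀ a b c d → a + b + (c + d) ≡ a + c + (b + d)
        interchange = solve-∀

∑-* : ∀ {A : Set} k (f : A → ℕ) xs → ∑ (λ x → k * f x) xs ≡ k * ∑ f xs
∑-* k f []       = sym (*-zeroʳ k)
∑-* k f (x ∷ xs) = trans (cong (k * f x +_) (∑-* k f xs)) (sym (*-distribˡ-+ k (f x) (∑ f xs)))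

∑-const : ∀ {A : Set} {f : A → ℕ} {c xs} → All (λ x → f x ≡ c) xs → ∑ f xs ≡ length xs * c
∑-const []         = refl
∑-const (eq ∷ eqs) = cong₂ _+_ eq (∑-const eqs)

separate : ∀ {A : Set} {P Q : A → Set} {xs} → All (λ x → P x ⊎ Q x) xs →
  ∃₂ λ ys zs → xs ↭ ys ++ zs × All P ys × All Q zs
separate [] = [] , [] , ↭-refl , [] , []
separate (inj₁ p ∷ pqs) with separate pqs
... | ys , zs , π , ps , qs = _ ∷ ys , zs , prep _ π , p ∷ ps , qs
separate (inj₂ q ∷ pqs) with separate pqs
... | ys , zs , π , ps , qs = ys , _ ∷ zs , ↭-trans (prep _ π) (↭-sym (shift _ ys zs)) , ps , q ∷ qs

replicate-+ : ∀ {A : Set} k l {x : A} → replicate (k + l) x ≡ replicate k x ++ replicate l x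
replicate-+ zero    l = refl
replicate-+ (suc k) l = cong (_ ∷_) (replicate-+ k l)

-- A slot of period `M` is shared in turn by `k` jobs of period `M * k`, one for each residue of the
-- rank modulo `k`.
⊵-split : ∀ k {{_ : NonZero k}} N M → replicate (N * k) (M * k) ⊵ replicate N M
⊵-split k zero    M = ⊵-refl
⊵-split k (suc N) M = subst (_⊵ replicate (suc N) M) (sym (replicate-+ k (N * k)))
  (⊵-++ (subst (_⊵ (M ∷ [])) (map-replicate (M *_) k k) (⊵-compose M (Cycle.covers-residues k))) (⊵-split k N M))

val-≤ : ∀ K m {a} → a ≤ m → val K m a ≡ 2 ^ K
val-≤ zero    m {a} a≤m with a ≤ᵇ m in eq
... | true  = refl
... | false = ⊥-elim (subst T eq (≤⇒≤ᵇ a≤m))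
val-≤ (suc K) m {a} a≤m with a ≤ᵇ m in eq
... | true  = refl
... | false = ⊥-elim (subst T eq (≤⇒≤ᵇ a≤m))

val-> : ∀ K m {a} → m < a → val (suc K) m a ≡ val K (m * 2) a
val-> K m {a} m<a with a ≤ᵇ m in eq
... | false = refl
... | true  = ⊥-elim (<⇒≱ m<a (≤ᵇ⇒≤ a m (subst T (sym eq) tt)))

val-zero : ∀ m {a} → m < a → val 0 m a ≡ 0
val-zero m {a} m<a with a ≤ᵇ m in eq
... | false = refl
... | true  = ⊥-elim (<⇒≱ m<a (≤ᵇ⇒≤ a m (subst T (sym eq) tt)))

smallOrLarge : ∀ M J → ∃₂ λ Sm Lg → J ↭ Sm ++ Lg × All (_≤ M) Sm × All (M <_) Lg
smallOrLarge M J = separate (All.universal (λ a → ≤-<-connex a M) J)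

∑-val-split : ∀ K M {J} Sm Lg → J ↭ Sm ++ Lg → All (_≤ M) Sm → All (M <_) Lg →
  ∑ (val (suc K) M) J ≡ length Sm * 2 ^ suc K + ∑ (val K (M * 2)) Lg
∑-val-split K M Sm Lg π sm lg = trans (∑-↭ (val (suc K) M) π) (trans (∑-++ (val (suc K) M) Sm Lg)
  (cong₂ _+_ (∑-const (All.map (val-≤ (suc K) M) sm)) (∑-cong (All.map (val-> K M) lg))))

-- Jobs are taken in order of decreasing value. The values are powers of two, each dividing the
-- previous one, so the running sum cannot jump over `N * 2 ^ K`: it hits it exactly, and no value
-- is wasted. That exactness is what the bookkeeping of leftovers in the mixed filling needs.
fill-exact : ∀ K N M J → N * 2 ^ K ≤ ∑ (val K M) J →
  ∃₂ λ J₁ J₂ → J ↭ J₁ ++ J₂ × J₁ ⊵ replicate N M × ∑ (val K M) J ≡ N * 2 ^ K + ∑ (val K M) J₂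
fill-exact K N M J h with smallOrLarge M J
... | Sm , Lg , π , sm , lg with N ≤? length Sm
...   | yes N≤n = take N Sm , drop N Sm ++ Lg , ρ ,
          subst (λ n → take N Sm ⊵ replicate n M) len (⊵-replicate (All.take⁺ N sm)) ,
          trans (∑-↭ (val K M) ρ) (trans (∑-++ (val K M) (take N Sm) _)
            (cong (_+ ∑ (val K M) (drop N Sm ++ Lg))
              (trans (∑-const (All.map (val-≤ K M) (All.take⁺ N sm))) (cong (_* 2 ^ K) len))))
  where
  len : length (take N Sm) ≡ N
  len = trans (length-take N Sm) (m≤n⇒m⊓n≡m N≤n)
  ρ : J ↭ take N Sm ++ (drop N Sm ++ Lg)
  ρ = ↭-trans π (↭-reflexive (trans (cong (_++ Lg) (sym (take++drop≡id N Sm))) (++-assoc (take N Sm) _ _)))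
...   | no N≰n with m≤n⇒∃[o]m+o≡n (≰⇒≥ N≰n)
fill-exact zero .(length Sm + N′) M J h | Sm , Lg , π , sm , lg | no N≰n | N′ , refl = ⊥-elim (N≰n (begin
    length Sm + N′                        ≡⟨ sym (*-identityʳ _) ⟩
    (length Sm + N′) * 1                  ≤⟨ h ⟩
    ∑ (val 0 M) J                         ≡⟨ ∑-↭ (val 0 M) π ⟩
    ∑ (val 0 M) (Sm ++ Lg)                ≡⟨ ∑-++ (val 0 M) Sm Lg ⟩
    ∑ (val 0 M) Sm + ∑ (val 0 M) Lg       ≡⟨ cong₂ _+_ (∑-const (All.map (val-≤ 0 M) sm)) (∑-const (All.map (val-zero M) lg)) ⟩
    length Sm * 1 + length Lg * 0         ≡⟨ simplify (length Sm) (length Lg) ⟩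
    length Sm                             ∎))
  where
  open ≤-Reasoning
  simplify : ∀ n l → n * 1 + l * 0 ≡ n
  simplify = solve-∀
fill-exact (suc K) .(length Sm + N′) M J h | Sm , Lg , π , sm , lg | no N≰n | N′ , refl
  -- The `N′` slots without a job are each split into two slots of period `M * 2`. The remaining
  -- jobs exceed `M`, so their values are the same when computed from `M * 2` with resolution `K`.
  with fill-exact K (N′ * 2) (M * 2) Lg
         (+-cancelˡ-≤ (length Sm * (2 * 2 ^ K)) _ _ (subst₂ _≤_ (regroup (length Sm) N′ (2 ^ K)) (∑-val-split K M Sm Lg π sm lg) h))
  where
  regroup : ∀ n N k → (n + N) * (2 * k) ≡ n * (2 * k) + N * 2 * k
  regroup = solve-∀
... | J₁ , J₂ , ρ , f , eq = Sm ++ J₁ , J₂ ,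
  ↭-trans π (↭-trans (++⁺ˡ Sm ρ) (↭-reflexive (sym (++-assoc Sm J₁ J₂)))) ,
  subst (Sm ++ J₁ ⊵_) (sym (replicate-+ (length Sm) N′)) (⊵-++ (⊵-replicate sm) (⊵-trans f (⊵-split 2 N′ M))) ,
  (begin-equality
    ∑ (val (suc K) M) J                                                       ≡⟨ trans (∑-val-split K M Sm Lg π sm lg) (cong (length Sm * (2 * 2 ^ K) +_) eq) ⟩
    length Sm * (2 * 2 ^ K) + (N′ * 2 * 2 ^ K + ∑ (val K (M * 2)) J₂)          ≡⟨ cong (λ t → length Sm * (2 * 2 ^ K) + (N′ * 2 * 2 ^ K + t)) (sym (∑-cong (All.map (val-> K M) lg₂))) ⟩
    length Sm * (2 * 2 ^ K) + (N′ * 2 * 2 ^ K + ∑ (val (suc K) M) J₂)          ≡⟨ regroup (length Sm) N′ (2 ^ K) _ ⟩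
    (length Sm + N′) * (2 * 2 ^ K) + ∑ (val (suc K) M) J₂                      ∎)
  where
  open ≤-Reasoning
  lg₂ : All (M <_) J₂
  lg₂ = All.++⁻ʳ J₁ (All-resp-↭ ρ lg)
  regroup : ∀ n N k s → n * (2 * k) + (N * 2 * k + s) ≡ (n + N) * (2 * k) + s
  regroup = solve-∀

fill : ∀ K N M J → N * 2 ^ K ≤ ∑ (val K M) J → J ⊵ replicate N M
fill K N M J h with fill-exact K N M J h
... | J₁ , J₂ , π , f , _ = ⊵-trans (⊵-↭ π) (⊵-weaken J₁ f)

max-≤ : ∀ {x y} → x ≤ y → max x y ≡ y
max-≤ {x} {y} h with x ≤ᵇ y in eq
... | true  = refl
... | false = ⊥-elim (subst T eq (≤⇒≤ᵇ h))

max-≥ : ∀ {x y} → y ≤ x → max x y ≡ x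
max-≥ {x} {y} h with x ≤ᵇ y in eq
... | true  = ≤-antisym h (≤ᵇ⇒≤ x y (subst T (sym eq) tt))
... | false = refl

mixedVal : ℕ → ℕ → ℕ → ℕ
mixedVal K m a = 2 * max (3 * val K m a) (val K (m * 3) a)

-- Rounding a up to m 2^j or to 3 m 2^j: either the former is the better choice or the latter gains a factor 4/3.
Dyadic Ternary : ℕ → ℕ → ℕ → Set
Dyadic  K m a = val K (m * 3) a ≡ 2 * val K m a
Ternary K m a = val K (m * 3) a ≡ 4 * val K m a

*-swap : ∀ m k l → m * k * l ≡ m * l * k
*-swap = solve-∀

-- Let a lie between m 2^j and m 2^(j+1). The ternary grid has a point strictly inside this range
-- only for j ≥ 1, namely 3 m 2^(j-1). Up to that point the value relative to `m * 3` is four times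
-- the one relative to `m`, and otherwise twice. The bound `a ≤ m * 2 ^ K` keeps both values from
-- being cut off to 0.
dyadicOrTernary : ∀ K m {a} → m < a → a ≤ m * 2 ^ K → Dyadic K m a ⊎ Ternary K m a
dyadicOrTernary zero    m m<a a≤ = ⊥-elim (<⇒≱ m<a (≤-trans a≤ (≤-reflexive (*-identityʳ m))))
dyadicOrTernary (suc K) m {a} m<a a≤ rewrite val-> K m m<a with ≤-<-connex a (m * 2)
... | inj₁ a≤2m rewrite val-≤ K (m * 2) a≤2m = inj₁ (val-≤ (suc K) (m * 3) (≤-trans a≤2m (*-monoʳ-≤ m (s≤s (s≤s z≤n)))))
... | inj₂ 2m<a with ≤-<-connex a (m * 3)
...   | inj₂ 3m<a rewrite val-> K (m * 3) 3m<a | *-swap m 3 2 = dyadicOrTernary K (m * 2) 2m<a (subst (a ≤_) (sym (*-assoc m 2 (2 ^ K))) a≤)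
dyadicOrTernary (suc zero) m {a} m<a a≤ | inj₂ 2m<a | inj₁ a≤3m = ⊥-elim (<⇒≱ 2m<a a≤)
dyadicOrTernary (suc (suc K)) m {a} m<a a≤ | inj₂ 2m<a | inj₁ a≤3m = inj₂
  (trans (val-≤ (2 + K) (m * 3) a≤3m) (trans (quadruple (2 ^ K)) (cong (4 *_) (sym (trans (val-> K (m * 2) 2m<a)
    (val-≤ K (m * 2 * 2) (≤-trans a≤3m (≤-trans (*-monoʳ-≤ m (s≤s (s≤s (s≤s z≤n)))) (≤-reflexive (four m))))))))))
  where quadruple : ∀ k → 2 * (2 * k) ≡ 4 * k
        quadruple = solve-∀
        four : ∀ m → m * 4 ≡ m * 2 * 2
        four = solve-∀

mixedVal-dyadic : ∀ K m {a} → Dyadic K m a → mixedVal K m a ≡ 6 * val K m a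
mixedVal-dyadic K m {a} eq rewrite eq = trans (cong (2 *_) (max-≥ (*-monoˡ-≤ (val K m a) {2} {3} (s≤s (s≤s z≤n))))) (six (val K m a))
  where six : ∀ v → 2 * (3 * v) ≡ 6 * v
        six = solve-∀

mixedVal-ternary : ∀ K m {a} → Ternary K m a → mixedVal K m a ≡ 2 * val K (m * 3) a
mixedVal-ternary K m {a} eq rewrite eq = cong (2 *_) (max-≤ (*-monoˡ-≤ (val K m a) {3} {4} (s≤s (s≤s (s≤s z≤n)))))

mixedVal-≤ : ∀ K m {a} → a ≤ m → mixedVal K m a ≡ 6 * 2 ^ K
mixedVal-≤ K m {a} a≤m rewrite val-≤ K m a≤m | val-≤ K (m * 3) {a} (≤-trans a≤m (m≤m*n m 3)) =
  trans (cong (2 *_) (max-≥ (m≤n*m (2 ^ K) 3))) (six (2 ^ K))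
  where six : ∀ v → 2 * (3 * v) ≡ 6 * v
        six = solve-∀

fill-length : ∀ {M A} N → N ≤ length A → All (_≤ M) A → A ⊵ replicate N M
fill-length {M} {A} N N≤ all = subst (_⊵ replicate N M) (take++drop≡id N A)
  (⊵-weaken (take N A) (subst (λ n → take N A ⊵ replicate n M) (trans (length-take N A) (m≤n⇒m⊓n≡m N≤)) (⊵-replicate (All.take⁺ N all))))

-- With ε = 3 y T + e (T = 2 ^ K) the ternary jobs fill y slots and leave e < 3 T: if e ≤ 2 T the rest is used dyadically
-- (losing e / 4), otherwise dyadic jobs complete one more ternary slot (losing a third of what they contribute).
fill-large : ∀ K r m D E y e → All (Dyadic K m) D → All (Ternary K m) E →
  ∑ (val K (m * 3)) E ≡ e + y * (3 * 2 ^ K) → e ≤ 3 * 2 ^ K →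
  suc (6 * r) * 2 ^ K ≤ 6 * ∑ (val K m) D + 2 * ∑ (val K (m * 3)) E → (D ++ E) ⊵ replicate r m
fill-large K r m D E y e′ ds es ε≡ e′≤3U h = cases (r ≤? y)
  where
  U = 2 ^ K
  d = ∑ (val K m) D
  ε = ∑ (val K (m * 3)) E
  cases : _ → (D ++ E) ⊵ replicate r m
  cases (yes r≤y) = ⊵-++ (⊵-drop D) (⊵-trans (fill K (r * 3) (m * 3) E (begin
      r * 3 * U       ≡⟨ *-assoc r 3 U ⟩
      r * (3 * U)     ≤⟨ *-monoˡ-≤ (3 * U) r≤y ⟩
      y * (3 * U)     ≤⟨ m≤n+m _ e′ ⟩
      e′ + y * (3 * U) ≡⟨ sym ε≡ ⟩
      ε ∎)) (⊵-split 3 r m))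
    where open ≤-Reasoning
  cases (no r≰y) with m≤n⇒∃[o]m+o≡n (≰⇒> r≰y)
  ... | r₀ , refl with ≤-<-connex e′ (2 * U)
  ...   | inj₁ e′≤2U with fill-exact K (y * 3) (m * 3) E (≤-trans (≤-reflexive (*-assoc y 3 U)) (≤-trans (m≤n+m _ e′) (≤-reflexive (sym ε≡))))
  ...     | E₁ , E₂ , π , f , eq = ⊵-trans (⊵-trans (⊵-++ (⊵-refl {D}) (⊵-↭ (↭-trans π (++-comm E₁ E₂)))) (⊵-↭ (↭-reflexive (sym (++-assoc D E₂ E₁)))))
            (subst ((D ++ E₂) ++ E₁ ⊵_) (trans (sym (replicate-+ (suc r₀) y)) (cong (λ n → replicate n m) (slots≡ r₀ y)))
              (⊵-++ (fill K (suc r₀) m (D ++ E₂) enough) (⊵-trans f (⊵-split 3 y m))))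
    where
    slots≡ : ∀ r₀ y → suc r₀ + y ≡ suc y + r₀
    slots≡ = solve-∀
    z = ∑ (val K m) E₂
    rest : ∑ (val K (m * 3)) E₂ ≡ 4 * z
    rest = trans (∑-cong (All.++⁻ʳ E₁ (All-resp-↭ π es))) (∑-* 4 (val K m) E₂)
    e′≡4z : e′ ≡ 4 * z
    e′≡4z = +-cancelʳ-≡ (y * (3 * U)) _ _ (trans (sym ε≡) (trans eq (trans (cong₂ _+_ (*-assoc y 3 U) rest) (+-comm (y * (3 * U)) (4 * z)))))
    open ≤-Reasoning
    key : 6 * (suc r₀ * U) + U ≤ 6 * (d + z) + 2 * z
    key = +-cancelˡ-≤ (6 * y * U) _ _ (begin
      6 * y * U + (6 * (suc r₀ * U) + U)        ≡⟨ left y r₀ U ⟩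
      suc (6 * (suc y + r₀)) * U                ≤⟨ h ⟩
      6 * d + 2 * ε                             ≡⟨ cong (λ t → 6 * d + 2 * t) (trans ε≡ (cong (_+ y * (3 * U)) e′≡4z)) ⟩
      6 * d + 2 * (4 * z + y * (3 * U))         ≡⟨ right d z y U ⟩
      6 * y * U + (6 * (d + z) + 2 * z)         ∎)
      where
      left : ∀ y r₀ U → 6 * y * U + (6 * (suc r₀ * U) + U) ≡ suc (6 * (suc y + r₀)) * U
      left = solve-∀
      right : ∀ d z y U → 6 * d + 2 * (4 * z + y * (3 * U)) ≡ 6 * y * U + (6 * (d + z) + 2 * z)
      right = solve-∀
    -- The rest `E₂` counts for `8 * z` in the hypothesis but for only `6 * z` when it is used
    -- dyadically. The loss `2 * z` is at most `U`, that is one sixth of a slot, which is exactly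
    -- the surplus demanded beyond `r` slots.
    2z≤U : 2 * z ≤ U
    2z≤U = *-cancelˡ-≤ 2 (≤-trans (≤-reflexive (trans (sym (*-assoc 2 2 z)) (sym e′≡4z))) e′≤2U)
    enough : suc r₀ * U ≤ ∑ (val K m) (D ++ E₂)
    enough = ≤-trans (*-cancelˡ-≤ 6 (+-cancelʳ-≤ U _ _ (≤-trans key (+-monoʳ-≤ (6 * (d + z)) 2z≤U)))) (≤-reflexive (sym (∑-++ (val K m) D E₂)))
  cases (no r≰y) | r₀ , refl | inj₂ 2U<e′ with fill-exact K r₀ m D (*-cancelˡ-≤ 6 (+-cancelʳ-≤ (6 * suc y * U) _ _ (begin
        6 * (r₀ * U) + 6 * suc y * U     ≡⟨ left r₀ y U ⟩
        6 * (suc y + r₀) * U             ≤⟨ *-monoˡ-≤ U (n≤1+n (6 * (suc y + r₀))) ⟩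
        suc (6 * (suc y + r₀)) * U       ≤⟨ h ⟩
        6 * d + 2 * ε                    ≤⟨ +-monoʳ-≤ (6 * d) (*-monoʳ-≤ 2 (≤-trans (≤-reflexive ε≡) (+-monoˡ-≤ (y * (3 * U)) e′≤3U))) ⟩
        6 * d + 2 * (3 * U + y * (3 * U)) ≡⟨ right d y U ⟩
        6 * d + 6 * suc y * U            ∎)))
    where
    open ≤-Reasoning
    left : ∀ r₀ y U → 6 * (r₀ * U) + 6 * suc y * U ≡ 6 * (suc y + r₀) * U
    left = solve-∀
    right : ∀ d y U → 6 * d + 2 * (3 * U + y * (3 * U)) ≡ 6 * d + 6 * suc y * U
    right = solve-∀
  ... | D₁ , D₂ , π , f , eq = ⊵-trans (⊵-trans (⊵-++ (⊵-↭ π) (⊵-refl {E})) (⊵-↭ (↭-reflexive (++-assoc D₁ D₂ E))))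
          (subst ((D₁ ++ D₂ ++ E) ⊵_) (trans (sym (replicate-+ r₀ (suc y))) (cong (λ n → replicate n m) (+-comm r₀ (suc y))))
            (⊵-++ f (⊵-trans (fill K (suc y * 3) (m * 3) (D₂ ++ E) enough) (⊵-split 3 (suc y) m))))
    where
    open ≤-Reasoning
    z = ∑ (val K m) D₂
    rest : ∑ (val K (m * 3)) (D₂ ++ E) ≡ 2 * z + ε
    rest = trans (∑-++ (val K (m * 3)) D₂ E) (cong (_+ ε) (trans (∑-cong (All.++⁻ʳ D₁ (All-resp-↭ π ds))) (∑-* 2 (val K m) D₂)))
    -- After removing `r₀` slots the hypothesis leaves `6 * z + 2 * ε ≥ (6 * y + 7) * U`, and this
    -- case supplies `ε ≥ (3 * y + 2) * U`. They add up to `3 * (2 * z + ε) ≥ 9 * (y + 1) * U` since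
    -- 7 + 2 = 9, so the threshold `2 * U` between the two cases serves both exactly.
    enough : suc y * 3 * U ≤ ∑ (val K (m * 3)) (D₂ ++ E)
    enough = ≤-trans (*-cancelˡ-≤ 3 (+-cancelˡ-≤ (6 * r₀ * U) _ _ (begin
      6 * r₀ * U + 3 * (suc y * 3 * U)                     ≡⟨ left r₀ y U ⟩
      suc (6 * (suc y + r₀)) * U + (2 * U + y * (3 * U))   ≤⟨ +-mono-≤ h (+-monoˡ-≤ (y * (3 * U)) (<⇒≤ 2U<e′)) ⟩
      6 * d + 2 * ε + (e′ + y * (3 * U))                   ≡⟨ cong₂ (λ s t → 6 * s + 2 * ε + t) eq (sym ε≡) ⟩
      6 * (r₀ * U + z) + 2 * ε + ε                         ≡⟨ right r₀ U z ε ⟩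
      6 * r₀ * U + 3 * (2 * z + ε)                         ∎)))
      (≤-reflexive (sym rest))
      where
      left : ∀ r₀ y U → 6 * r₀ * U + 3 * (suc y * 3 * U) ≡ suc (6 * (suc y + r₀)) * U + (2 * U + y * (3 * U))
      left = solve-∀
      right : ∀ r₀ U z ε → 6 * (r₀ * U + z) + 2 * ε + ε ≡ 6 * r₀ * U + 3 * (2 * z + ε)
      right = solve-∀

-- A job of period at most `m` fills a slot alone and accounts for exactly one slot in the sum. The
-- others are dyadic or ternary, and dividing the value of the ternary ones by `3 * 2 ^ K` gives the
-- number of slots they fill by themselves.
fill-mixed : ∀ K r m J → All (_≤ m * 2 ^ K) J → suc (6 * r) * 2 ^ K ≤ ∑ (mixedVal K m) J → J ⊵ replicate r m
fill-mixed K r m J bounds h with smallOrLarge m J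
... | Sm , Lg , π , sm , lg with r ≤? length Sm
...   | yes r≤n = ⊵-trans (⊵-↭ π) (⊵-weaken Sm (fill-length r r≤n sm))
...   | no r≰n with m≤n⇒∃[o]m+o≡n (≰⇒≥ r≰n)
...     | r₀ , refl with separate (All.zipWith (λ { (m<a , a≤) → dyadicOrTernary K m m<a a≤ }) (lg , All.++⁻ʳ Sm (All-resp-↭ π bounds)))
...       | D , E , ρ , ds , es = ⊵-trans (⊵-↭ π) (subst (Sm ++ Lg ⊵_) (sym (replicate-+ (length Sm) r₀))
              (⊵-++ (⊵-replicate sm) (⊵-trans (⊵-↭ ρ) (fill-large K r₀ m D E (ε / (3 * 2 ^ K)) (ε % (3 * 2 ^ K)) ds es
                (m≡m%n+[m/n]*n ε (3 * 2 ^ K)) (m%n≤n ε (3 * 2 ^ K)) enough))))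
  where
  instance
    3*2^K≢0 : NonZero (3 * 2 ^ K)
    3*2^K≢0 = m*n≢0 3 (2 ^ K) {{_}} {{m^n≢0 2 K}}
  ε : ℕ
  ε = ∑ (val K (m * 3)) E
  open ≤-Reasoning
  regroup : ∀ n r U → n * (6 * U) + suc (6 * r) * U ≡ suc (6 * (n + r)) * U
  regroup = solve-∀
  enough : suc (6 * r₀) * 2 ^ K ≤ 6 * ∑ (val K m) D + 2 * ∑ (val K (m * 3)) E
  enough = +-cancelˡ-≤ (length Sm * (6 * 2 ^ K)) _ _ (begin
    length Sm * (6 * 2 ^ K) + suc (6 * r₀) * 2 ^ K          ≡⟨ regroup (length Sm) r₀ (2 ^ K) ⟩
    suc (6 * (length Sm + r₀)) * 2 ^ K                      ≤⟨ h ⟩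
    ∑ (mixedVal K m) J                                      ≡⟨ trans (∑-↭ (mixedVal K m) π) (∑-++ (mixedVal K m) Sm Lg) ⟩
    ∑ (mixedVal K m) Sm + ∑ (mixedVal K m) Lg               ≡⟨ cong₂ _+_ (∑-const (All.map (mixedVal-≤ K m) sm)) (trans (∑-↭ (mixedVal K m) ρ) (∑-++ (mixedVal K m) D E)) ⟩
    length Sm * (6 * 2 ^ K) + (∑ (mixedVal K m) D + ∑ (mixedVal K m) E)
      ≡⟨ cong (length Sm * (6 * 2 ^ K) +_) (cong₂ _+_
           (trans (∑-cong (All.map (mixedVal-dyadic K m) ds)) (∑-* 6 (val K m) D))
           (trans (∑-cong (All.map (mixedVal-ternary K m) es)) (∑-* 2 (val K (m * 3)) E))) ⟩
    length Sm * (6 * 2 ^ K) + (6 * ∑ (val K m) D + 2 * ∑ (val K (m * 3)) E) ∎)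

-- Soundness of the checker

max≡⊔ : ∀ x y → max x y ≡ x ⊔ y
max≡⊔ x y with ≤-total x y
... | inj₁ x≤y = trans (max-≤ x≤y) (sym (m≤n⇒m⊔n≡n x≤y))
... | inj₂ y≤x = trans (max-≥ y≤x) (sym (m≥n⇒m⊔n≡m y≤x))

comb-mono : ∀ α β {x x′ y y′} → x ≤ x′ → y ≤ y′ → comb α β x y ≤ comb α β x′ y′
comb-mono α β {x} {x′} {y} {y′} h h′ = +-mono-≤ (*-monoʳ-≤ α (*-monoʳ-≤ 6 h)) (*-monoʳ-≤ β (*-monoʳ-≤ 2
  (subst₂ _≤_ (sym (max≡⊔ (3 * x) y)) (sym (max≡⊔ (3 * x′) y′)) (⊔-mono-≤ (*-monoʳ-≤ 3 h) h′))))

comb-double : ∀ α β x y → comb α β (2 * x) (2 * y) ≡ 2 * comb α β x y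
comb-double α β x y = trans (cong (λ t → α * (6 * (2 * x)) + β * (2 * t)) max-double) (factor α β x (max (3 * x) y))
  where
  triple : ∀ x → 3 * (2 * x) ≡ 2 * (3 * x)
  triple = solve-∀
  factor : ∀ α β x z → α * (6 * (2 * x)) + β * (2 * (2 * z)) ≡ 2 * (α * (6 * x) + β * (2 * z))
  factor = solve-∀
  max-double : max (3 * (2 * x)) (2 * y) ≡ 2 * max (3 * x) y
  max-double = trans (max≡⊔ (3 * (2 * x)) (2 * y)) (trans (cong (_⊔ 2 * y) (triple x))
    (trans (sym (*-distribˡ-⊔ 2 (3 * x) y)) (cong (2 *_) (sym (max≡⊔ (3 * x) y)))))

-- The two sides differ only at the cut-off: a period just beyond `m * 2 ^ K` has value 0 at the
-- coarser resolution and may have value 1 at the finer one.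
val-double : ∀ K m a → 2 * val K m a ≤ val (suc K) m a
val-double K m a with ≤-<-connex a m
... | inj₁ a≤m rewrite val-≤ K m a≤m | val-≤ (suc K) m a≤m = ≤-refl
val-double zero    m a | inj₂ m<a rewrite val-zero m m<a = z≤n
val-double (suc K) m a | inj₂ m<a rewrite val-> K m m<a | val-> (suc K) m m<a = val-double K (m * 2) a

n≤1+2*⌊n/2⌋ : ∀ n → n ≤ suc (⌊ n /2⌋ * 2)
n≤1+2*⌊n/2⌋ zero          = z≤n
n≤1+2*⌊n/2⌋ (suc zero)    = ≤-refl
n≤1+2*⌊n/2⌋ (suc (suc n)) = s≤s (s≤s (n≤1+2*⌊n/2⌋ n))

⌊n/2⌋*2≤n : ∀ n → ⌊ n /2⌋ * 2 ≤ n
⌊n/2⌋*2≤n zero          = z≤n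
⌊n/2⌋*2≤n (suc zero)    = z≤n
⌊n/2⌋*2≤n (suc (suc n)) = s≤s (s≤s (⌊n/2⌋*2≤n n))

val-≤-2^ : ∀ K m a → val K m a ≤ 2 ^ K
val-≤-2^ K m a with ≤-<-connex a m
... | inj₁ a≤m = ≤-reflexive (val-≤ K m a≤m)
val-≤-2^ zero    m a | inj₂ m<a rewrite val-zero m m<a = z≤n
val-≤-2^ (suc K) m a | inj₂ m<a rewrite val-> K m m<a = ≤-trans (val-≤-2^ K (m * 2) a) (m≤m+n (2 ^ K) _)

-- For a = b + 1 the argument on the left is a / 2 rounded up. It is at most m 2^j exactly when a is
-- at most m 2^(j+1), so halving the period costs one step of resolution.
val-half : ∀ K m b → val K m (suc ⌊ b /2⌋) ≤ val (suc K) m (suc b)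
val-half K m b with ≤-<-connex (suc b) m
... | inj₁ b<m = ≤-trans (val-≤-2^ K m _) (≤-trans (m≤m+n (2 ^ K) _) (≤-reflexive (sym (val-≤ (suc K) m b<m))))
... | inj₂ m<sb rewrite val-> K m m<sb with ≤-<-connex (suc ⌊ b /2⌋) m
...   | inj₁ h = ≤-trans (val-≤-2^ K m _) (≤-reflexive (sym (val-≤ K (m * 2)
                   (≤-trans (s≤s (n≤1+2*⌊n/2⌋ b)) (*-monoˡ-≤ 2 h)))))
val-half zero    m b | inj₂ m<sb | inj₂ h rewrite val-zero m h = z≤n
val-half (suc K) m b | inj₂ m<sb | inj₂ h rewrite val-> K m h = val-half K (m * 2) b

weight-double : ∀ K x a → 2 * weight K x a ≤ weight (suc K) x a
weight-double K (on m _ α β) a = ≤-trans (≤-reflexive (sym (comb-double α β (val K m a) (val K (m * 3) a))))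
  (comb-mono α β (val-double K m a) (val-double K (m * 3) a))

weight-half : ∀ K x b → weight K x (suc ⌊ b /2⌋) ≤ weight (suc K) x (suc b)
weight-half K (on m _ α β) b = comb-mono α β (val-half K m b) (val-half K (m * 3) b)

weight-scale : ∀ κ k x a → 2 ^ k * weight κ x a ≤ weight (k + κ) x a
weight-scale κ zero    x a = ≤-reflexive (+-identityʳ _)
weight-scale κ (suc k) x a = ≤-trans (≤-reflexive (*-assoc 2 (2 ^ k) _)) (≤-trans (*-monoʳ-≤ 2 (weight-scale κ k x a)) (weight-double (k + κ) x a))

total-double : ∀ K es a → 2 * total K es a ≤ total (suc K) es a
total-double K es a = ≤-trans (≤-reflexive (sym (∑-* 2 (λ x → weight K x a) es))) (∑-mono (All.universal (λ x → weight-double K x a) es))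

total-half : ∀ K es b → total K es (suc ⌊ b /2⌋) ≤ total (suc K) es (suc b)
total-half K es b = ∑-mono (All.universal (λ x → weight-half K x b) es)

total-scale : ∀ κ k es a → 2 ^ k * total κ es a ≤ total (k + κ) es a
total-scale κ k es a = ≤-trans (≤-reflexive (sym (∑-* (2 ^ k) (λ x → weight κ x a) es))) (∑-mono (All.universal (λ x → weight-scale κ k x a) es))

allFrom-sound : ∀ (f : ℕ → Bool) a n → allFrom f a n ≡ true → ∀ {i} → a ≤ i → i < a + n → f i ≡ true
allFrom-sound f a zero    h {i} a≤i i<a = ⊥-elim (<⇒≱ i<a (≤-trans (≤-reflexive (+-identityʳ a)) a≤i))
allFrom-sound f a (suc n) h {i} a≤i i<a with m≤n⇒m<n∨m≡n a≤i
... | inj₁ a<i  = allFrom-sound f (suc a) n (∧-elimʳ {f a} h) a<i (subst (i <_) (+-suc a n) i<a)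
... | inj₂ refl = ∧-elimˡ h

-- Past the range that is checked explicitly the bound for 1 / (a - 1) is carried along by halving a - 1.
tail-bound : ∀ κ T Λ es → (∀ b → T ≤ b → b < T * 2 → 2 ^ κ * Λ ≤ b * total κ es (suc b)) →
  ∀ k b → T ≤ b → b < T * 2 * 2 ^ k → 2 ^ (k + κ) * Λ ≤ b * total (k + κ) es (suc b)
tail-bound κ T Λ es h zero    b T≤b b< = h b T≤b (subst (b <_) (*-identityʳ (T * 2)) b<)
tail-bound κ T Λ es h (suc k) b T≤b b< with b <? T * 2
... | yes b<2T = begin
    2 * 2 ^ (k + κ) * Λ                   ≡⟨ *-assoc 2 (2 ^ (k + κ)) Λ ⟩
    2 * (2 ^ (k + κ) * Λ)                 ≤⟨ *-monoʳ-≤ 2 (tail-bound κ T Λ es h k b T≤b (≤-trans b<2T (m≤m*n (T * 2) (2 ^ k) {{m^n≢0 2 k}}))) ⟩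
    2 * (b * total (k + κ) es (suc b))    ≡⟨ swap₁ b (total (k + κ) es (suc b)) ⟩
    b * (2 * total (k + κ) es (suc b))    ≤⟨ *-monoʳ-≤ b (total-double (k + κ) es (suc b)) ⟩
    b * total (suc k + κ) es (suc b)      ∎
    where
    open ≤-Reasoning
    swap₁ : ∀ b t → 2 * (b * t) ≡ b * (2 * t)
    swap₁ = solve-∀
... | no b≮2T = begin
    2 * 2 ^ (k + κ) * Λ                                ≡⟨ *-assoc 2 (2 ^ (k + κ)) Λ ⟩
    2 * (2 ^ (k + κ) * Λ)                              ≤⟨ *-monoʳ-≤ 2 (tail-bound κ T Λ es h k ⌊ b /2⌋ half≥ half<) ⟩
    2 * (⌊ b /2⌋ * total (k + κ) es (suc ⌊ b /2⌋))      ≡⟨ swap₁ ⌊ b /2⌋ (total (k + κ) es (suc ⌊ b /2⌋)) ⟩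
    ⌊ b /2⌋ * 2 * total (k + κ) es (suc ⌊ b /2⌋)        ≤⟨ *-mono-≤ (⌊n/2⌋*2≤n b) (total-half (k + κ) es b) ⟩
    b * total (suc k + κ) es (suc b)                   ∎
    where
    open ≤-Reasoning
    swap₁ : ∀ b t → 2 * (b * t) ≡ b * 2 * t
    swap₁ = solve-∀
    double : ∀ c t → c * (2 * t) ≡ c * t * 2
    double = solve-∀
    half≥ : T ≤ ⌊ b /2⌋
    half≥ = s≤s⁻¹ (*-cancelʳ-< 2 _ _ (s≤s (≤-trans (≮⇒≥ b≮2T) (n≤1+2*⌊n/2⌋ b))))
    half< : ⌊ b /2⌋ < T * 2 * 2 ^ k
    half< = *-cancelʳ-< 2 _ _ (≤-<-trans (⌊n/2⌋*2≤n b) (subst (b <_) (double (T * 2) (2 ^ k)) b<))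

-- Up to `T` the explicit check is rescaled to the finer resolution. Beyond `T` the bound for 1 / (a
-- - 1) implies the one for 1 / a, and `a ≤ 2 ^ k` ensures that `k` halvings are enough to reach the
-- checked range.
job-bound : ∀ κ T L Λ es → 0 < T → (∀ a → L ≤ a → a ≤ T → 2 ^ κ * Λ ≤ a * total κ es a) →
  (∀ b → T ≤ b → b < T * 2 → 2 ^ κ * Λ ≤ b * total κ es (suc b)) →
  ∀ k a → L ≤ a → a ≤ 2 ^ k → 2 ^ (k + κ) * Λ ≤ a * total (k + κ) es a
job-bound κ T L Λ es 0<T small large k a L≤a a≤ with a ≤? T
... | yes a≤T = begin
    2 ^ (k + κ) * Λ              ≡⟨ cong (_* Λ) (^-distribˡ-+-* 2 k κ) ⟩
    2 ^ k * 2 ^ κ * Λ            ≡⟨ *-assoc (2 ^ k) (2 ^ κ) Λ ⟩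
    2 ^ k * (2 ^ κ * Λ)          ≤⟨ *-monoʳ-≤ (2 ^ k) (small a L≤a a≤T) ⟩
    2 ^ k * (a * total κ es a)   ≡⟨ swap₁ (2 ^ k) a (total κ es a) ⟩
    a * (2 ^ k * total κ es a)   ≤⟨ *-monoʳ-≤ a (total-scale κ k es a) ⟩
    a * total (k + κ) es a       ∎
    where
    open ≤-Reasoning
    swap₁ : ∀ t a s → t * (a * s) ≡ a * (t * s)
    swap₁ = solve-∀
job-bound κ T L Λ es 0<T small large k zero    L≤a a≤ | no T≰a = ⊥-elim (T≰a z≤n)
job-bound κ T@(suc _) L Λ es 0<T small large k (suc b) L≤a a≤ | no T≰a = ≤-trans
  (tail-bound κ T Λ es large k b (s≤s⁻¹ (≰⇒> T≰a)) (≤-trans a≤ (m≤n*m (2 ^ k) (T * 2))))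
  (*-monoˡ-≤ (total (k + κ) es (suc b)) (n≤1+n b))

filterᵇ⁺ : ∀ {A : Set} {P : A → Set} (f : A → Bool) {xs} → All P xs → All P (filterᵇ f xs)
filterᵇ⁺ f []               = []
filterᵇ⁺ f (_∷_ {x} px pxs) with f x
... | true  = px ∷ filterᵇ⁺ f pxs
... | false = filterᵇ⁺ f pxs

-- If either test succeeds, its filling lemma supplies the free slots left by the placement of `P`.
-- Otherwise both inequalities fail strictly, and their combination with `α` and `β` leaves a gap of
-- at least 1.
entry-sound : ∀ K P R x → usable x ≡ true → All (_≤ 2 ^ K) P → All (_≤ 2 ^ K) R →
  Covers (P ++ R) everyDay ⊎ suc (∑ (weight K x) (bigger (Strategy.m x) P ++ R)) ≤ require P x * 2 ^ K
entry-sound K P R x@(on zero c α β) () ps rs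
entry-sound K P R x@(on m@(suc _) c α β) ok ps rs = cases (r * 2 ^ K ≤? ∑ (val K m) J) (suc (6 * r) * 2 ^ K ≤? ∑ (mixedVal K m) J)
  where
  J : List ℕ
  J = bigger m P ++ R
  r : ℕ
  r = slots P x
  bounds : All (_≤ m * 2 ^ K) J
  bounds = All.map (λ h → ≤-trans h (m≤n*m (2 ^ K) m)) (All.++⁺ (filterᵇ⁺ (m <ᵇ_) ps) rs)
  0<α+β : 0 < α + β
  0<α+β = *-cancelˡ-< m 0 (α + β) (subst (_< m * (α + β)) (sym (*-zeroʳ m)) (≤ᵇ⇒≤ 1 (m * (α + β)) (≡true⇒T ok)))
  open ≤-Reasoning
  -- Raising `A` and `B` to their successors adds `6 * α + β`, and this is at least `α + β ≥ 1`.
  combine : ∀ A B {R₁ R₂} → A < R₁ → B < R₂ → suc (α * (6 * A) + β * B) ≤ α * (6 * R₁) + β * R₂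
  combine A B {R₁} {R₂} h h′ = begin
    1 + (α * (6 * A) + β * B)                      ≤⟨ +-monoˡ-≤ _ 0<α+β ⟩
    α + β + (α * (6 * A) + β * B)                  ≤⟨ m≤m+n _ (5 * α) ⟩
    α + β + (α * (6 * A) + β * B) + 5 * α          ≡⟨ regroup α β A B ⟩
    α * (6 * suc A) + β * suc B                    ≤⟨ +-mono-≤ (*-monoʳ-≤ α (*-monoʳ-≤ 6 h)) (*-monoʳ-≤ β h′) ⟩
    α * (6 * R₁) + β * R₂                          ∎
    where
    regroup : ∀ α β A B → α + β + (α * (6 * A) + β * B) + 5 * α ≡ α * (6 * suc A) + β * suc B
    regroup = solve-∀
  ∑-weight : ∑ (weight K x) J ≡ α * (6 * ∑ (val K m) J) + β * ∑ (mixedVal K m) J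
  ∑-weight = trans (∑-+ (λ a → α * (6 * val K m a)) (λ a → β * mixedVal K m a) J)
    (cong₂ _+_ (trans (∑-* α (λ a → 6 * val K m a) J) (cong (α *_) (∑-* 6 (val K m) J))) (∑-* β (mixedVal K m) J))
  factor : ∀ α β r t → α * (6 * (r * t)) + β * (suc (6 * r) * t) ≡ (α * (6 * r) + β * suc (6 * r)) * t
  factor = solve-∀
  cases : _ → _ → Covers (P ++ R) everyDay ⊎ suc (∑ (weight K x) J) ≤ require P x * 2 ^ K
  cases (yes h) _       = inj₁ (Cycle.place-fill m c P R (fill K r m J h))
  cases (no _)  (yes h) = inj₁ (Cycle.place-fill m c P R (fill-mixed K r m J bounds h))
  cases (no h)  (no h′) = inj₂ (subst₂ (λ s t → suc s ≤ t) (sym ∑-weight) (factor α β r (2 ^ K)) (combine _ _ (≰⇒> h) (≰⇒> h′)))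

entries-sound : ∀ K P R es → all usable es ≡ true → All (_≤ 2 ^ K) P → All (_≤ 2 ^ K) R →
  Covers (P ++ R) everyDay ⊎ ∑ (λ x → suc (∑ (weight K x) (bigger (Strategy.m x) P ++ R))) es ≤ requires P es * 2 ^ K
entries-sound K P R []       ok ps rs = inj₂ z≤n
entries-sound K P R (x ∷ es) ok ps rs with entry-sound K P R x (∧-elimˡ ok) ps rs | entries-sound K P R es (∧-elimʳ {usable x} ok) ps rs
... | inj₁ c | _      = inj₁ c
... | inj₂ _ | inj₁ c = inj₁ c
... | inj₂ h | inj₂ t = inj₂ (≤-trans (+-mono-≤ h t) (≤-reflexive (sym (*-distribʳ-+ (2 ^ K) (require P x) (requires P es)))))

∑-swap : ∀ {A B : Set} (f : A → B → ℕ) xs ys → ∑ (λ x → ∑ (f x) ys) xs ≡ ∑ (λ y → ∑ (λ x → f x y) xs) ys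
∑-swap f []       ys = sym (trans (∑-* 0 (const 0) ys) refl)
∑-swap f (x ∷ xs) ys = trans (cong (∑ (f x) ys +_) (∑-swap f xs ys)) (sym (∑-+ (f x) (λ y → ∑ (λ x → f x y) xs) ys))

-- Supplies a resolution at which no period of the instance exceeds the cut-off of the values; it
-- depends on the instance, whereas the certificate is checked at the fixed resolution `κ`.
bounded : ∀ L → ∃ λ k → All (_≤ 2 ^ k) L
bounded []      = 0 , []
bounded (a ∷ L) with bounded L
... | k , h = a + k , ≤-trans (<⇒≤ (n<2^n a)) (^-monoʳ-≤ 2 (m≤m+n a k)) ∷ All.map (λ le → ≤-trans le (^-monoʳ-≤ 2 (m≤n+m k a))) h
  where
  n<2^n : ∀ n → n < 2 ^ n
  n<2^n zero    = s≤s z≤n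
  n<2^n (suc n) = ≤-trans (+-mono-≤ (≤-trans (s≤s z≤n) (n<2^n n)) (n<2^n n)) (≤-reflexive (cong (2 ^ n +_) (sym (+-identityʳ _))))

-- x / Q is a lower bound for the reciprocal of a.
Weighted : ℕ → List (ℕ × ℕ) → Set
Weighted Q = All (λ (a , x) → a * x ≤ Q)

-- The chain behind a leaf, with `U = 2 ^ k` and `W = 2 ^ κ`: failure gives t / (U W) < q - s / W;
-- `bound` gives t / (U W) ≥ Λ X / Q; `dense` gives X / Q ≥ B / A - c / N; `certified` gives q - s /
-- W ≤ Λ (B / A - c / N). To avoid division and subtraction everything is multiplied by
-- `A * (N * Q)` and a common term is added to both sides. Strictness comes from `n`, the number of
-- strategies.
contradictory : ∀ A B W N Q {{_ : NonZero A}} {{_ : NonZero N}} {{_ : NonZero Q}} Λ q s c X t U n → 0 < n →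
  n + (U * s + t) ≤ q * (U * W) →
  W * (A * (N * q + Λ * c)) ≤ W * (B * (N * Λ)) + A * (N * s) →
  B * (N * Q) ≤ A * (N * X + Q * c) →
  Λ * (U * W) * X ≤ Q * t → ⊥
contradictory A B W N Q Λ q s c X t U n 0<n fails certified dense bound = <-irrefl refl (begin-strict
  A * (N * Q) * (U * s + t)        <⟨ *-monoʳ-< (A * (N * Q)) {{m*n≢0 A (N * Q) {{it}} {{m*n≢0 N Q}}}} (m<n+m (U * s + t) 0<n) ⟩
  A * (N * Q) * (n + (U * s + t))  ≤⟨ *-monoʳ-≤ (A * (N * Q)) fails ⟩
  A * (N * Q) * (q * (U * W))     ≤⟨ +-cancelʳ-≤ (B * (N * Q) * (Λ * (U * W)) + A * (Λ * c * Q) * (U * W)) _ _ combined ⟩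
  A * (N * Q) * (U * s + t)        ∎)
  where
  open ≤-Reasoning
  e₁ : ∀ A B W N Q Λ q c U → A * (N * Q) * (q * (U * W)) + (B * (N * Q) * (Λ * (U * W)) + A * (Λ * c * Q) * (U * W))
       ≡ Q * U * (W * (A * (N * q + Λ * c))) + Λ * (U * W) * (B * (N * Q))
  e₁ = solve-∀
  e₂ : ∀ A B W N Q Λ s c X U → Q * U * (W * (B * (N * Λ)) + A * (N * s)) + Λ * (U * W) * (A * (N * X + Q * c))
       ≡ Q * U * (W * (B * (N * Λ)) + A * (N * s)) + A * Λ * (U * W) * Q * c + A * N * (Λ * (U * W) * X)
  e₂ = solve-∀
  e₃ : ∀ A B W N Q Λ s c t U → Q * U * (W * (B * (N * Λ)) + A * (N * s)) + A * Λ * (U * W) * Q * c + A * N * (Q * t)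
       ≡ A * (N * Q) * (U * s + t) + (B * (N * Q) * (Λ * (U * W)) + A * (Λ * c * Q) * (U * W))
  e₃ = solve-∀
  combined : A * (N * Q) * (q * (U * W)) + (B * (N * Q) * (Λ * (U * W)) + A * (Λ * c * Q) * (U * W))
           ≤ A * (N * Q) * (U * s + t) + (B * (N * Q) * (Λ * (U * W)) + A * (Λ * c * Q) * (U * W))
  combined = begin
    _ ≡⟨ e₁ A B W N Q Λ q c U ⟩
    Q * U * (W * (A * (N * q + Λ * c))) + Λ * (U * W) * (B * (N * Q))
      ≤⟨ +-mono-≤ (*-monoʳ-≤ (Q * U) certified) (*-monoʳ-≤ (Λ * (U * W)) dense) ⟩
    Q * U * (W * (B * (N * Λ)) + A * (N * s)) + Λ * (U * W) * (A * (N * X + Q * c))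
      ≡⟨ e₂ A B W N Q Λ s c X U ⟩
    Q * U * (W * (B * (N * Λ)) + A * (N * s)) + A * Λ * (U * W) * Q * c + A * N * (Λ * (U * W) * X)
      ≤⟨ +-monoʳ-≤ _ (*-monoʳ-≤ (A * N) bound) ⟩
    Q * U * (W * (B * (N * Λ)) + A * (N * s)) + A * Λ * (U * W) * Q * c + A * N * (Q * t)
      ≡⟨ e₃ A B W N Q Λ s c t U ⟩
    _ ∎

m<[1+m/n]*n : ∀ m n {{_ : NonZero n}} → m < suc (m / n) * n
m<[1+m/n]*n m n = ≤-trans (s≤s (≤-reflexive (m≡m%n+[m/n]*n m n))) (+-monoˡ-≤ (m / n * n) (m%n<n m n))

extract : ∀ {P : ℕ × ℕ → Set} {Q : ℕ × ℕ → Set} {R} → All (λ ax → P ax ⊎ Q ax) R →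
  (∃₂ λ ax R′ → P ax × R ↭ ax ∷ R′) ⊎ All Q R
extract []            = inj₂ []
extract (inj₁ p ∷ ps) = inj₁ (_ , _ , p , ↭-refl)
extract (inj₂ q ∷ ps) with extract ps
... | inj₁ (ax , R′ , p , π) = inj₁ (ax , _ ∷ R′ , p , ↭-trans (prep _ π) (swap _ _ ↭-refl))
... | inj₂ qs                = inj₂ (q ∷ qs)

module CheckerSound (A B N T κ : ℕ) {{_ : NonZero A}} {{_ : NonZero N}} (0<T : 0 < T) where

  open Checker A B N T κ

  -- Rearranges the failed tests from a sum over strategies into a strict surplus of 1 per strategy,
  -- the credit of known jobs lifted from resolution `κ`, and a sum over the unknown jobs, for which
  -- `job-bound` holds one by one.
  entries-split : ∀ k P R es →
    length es + (2 ^ k * supplies P es + ∑ (total (k + κ) es) R) ≤ ∑ (λ x → suc (∑ (weight (k + κ) x) (bigger (Strategy.m x) P ++ R))) es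
  entries-split k P R es = begin
    length es + (2 ^ k * supplies P es + ∑ (total K es) R)
      ≡⟨ cong₂ _+_ (sym (trans (∑-const {f = const 1} (All.universal (λ _ → refl) es)) (*-identityʳ (length es))))
           (cong₂ _+_ (sym (∑-* (2 ^ k) (λ x → ∑ (weight κ x) (bigger (Strategy.m x) P)) es)) (sym (∑-swap (weight K) es R))) ⟩
    ∑ (const 1) es + (∑ (λ x → 2 ^ k * ∑ (weight κ x) (bigger (Strategy.m x) P)) es + ∑ (λ x → ∑ (weight K x) R) es)
      ≤⟨ +-monoʳ-≤ (∑ (const 1) es) (+-monoˡ-≤ _ (∑-mono (All.universal (λ x → scale x (bigger (Strategy.m x) P)) es))) ⟩
    ∑ (const 1) es + (∑ (λ x → ∑ (weight K x) (bigger (Strategy.m x) P)) es + ∑ (λ x → ∑ (weight K x) R) es)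
      ≡⟨ cong (∑ (const 1) es +_) (trans (sym (∑-+ (λ x → ∑ (weight K x) (bigger (Strategy.m x) P)) (λ x → ∑ (weight K x) R) es))
           (∑-cong (All.universal (λ x → sym (∑-++ (weight K x) (bigger (Strategy.m x) P) R)) es))) ⟩
    ∑ (const 1) es + ∑ (λ x → ∑ (weight K x) (bigger (Strategy.m x) P ++ R)) es
      ≡⟨ sym (∑-+ (const 1) (λ x → ∑ (weight K x) (bigger (Strategy.m x) P ++ R)) es) ⟩
    ∑ (λ x → suc (∑ (weight K x) (bigger (Strategy.m x) P ++ R))) es ∎
    where
    open ≤-Reasoning
    K : ℕ
    K = k + κ
    scale : ∀ x B → 2 ^ k * ∑ (weight κ x) B ≤ ∑ (weight K x) B
    scale x B = ≤-trans (≤-reflexive (sym (∑-* (2 ^ k) (weight κ x) B))) (∑-mono (All.universal (weight-scale κ k x) B))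

  -- Either some strategy covers all days, or all of them fail and `contradictory` applies. Its
  -- premise on the unknown jobs comes from multiplying `job-bound` by `x` and using `a * x ≤ Q` for
  -- each job.
  leaf-sound : ∀ Λ es P L R Q {{_ : NonZero Q}} → checkLeaf Λ es P L ≡ true → All (λ (a , _) → L ≤ a) R → Weighted Q R →
    B * (N * Q) ≤ A * (N * ∑ proj₂ R + Q * cost P) → Covers (P ++ map proj₁ R) everyDay
  leaf-sound Λ []          P L R Q () L≤ wt dense
  leaf-sound Λ es@(_ ∷ _)  P L R Q ok L≤ wt dense with bounded (P ++ map proj₁ R)
  ... | k , bd with entries-sound (k + κ) P (map proj₁ R) es (∧-elimˡ ok) (All.++⁻ˡ P bd′) (All.++⁻ʳ P bd′)
    where
    bd′ : All (_≤ 2 ^ (k + κ)) (P ++ map proj₁ R)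
    bd′ = All.map (λ le → ≤-trans le (^-monoʳ-≤ 2 (m≤m+n k κ))) bd
  ...   | inj₁ c = c
  ...   | inj₂ h = ⊥-elim (contradictory A B (2 ^ κ) N Q Λ (requires P es) (supplies P es) (cost P) (∑ proj₂ R) (∑ (total (k + κ) es) (map proj₁ R)) (2 ^ k)
            (length es) (s≤s z≤n)
            (≤-trans (entries-split k P (map proj₁ R) es) (≤-trans h (≤-reflexive (cong (requires P es *_) (^-distribˡ-+-* 2 k κ)))))
            (≤ᵇ⇒≤ _ _ (≡true⇒T ok₄)) dense bound)
    where
    ok₂ : allFrom (headOK Λ es) L (suc T ∸ L) ∧ (allFrom (tailOK Λ es) T T ∧
      (2 ^ κ * (A * (N * requires P es + Λ * cost P)) ≤ᵇ 2 ^ κ * (B * (N * Λ)) + A * (N * supplies P es))) ≡ true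
    ok₂ = ∧-elimʳ {all usable es} ok
    ok₃ : allFrom (tailOK Λ es) T T ∧
      (2 ^ κ * (A * (N * requires P es + Λ * cost P)) ≤ᵇ 2 ^ κ * (B * (N * Λ)) + A * (N * supplies P es)) ≡ true
    ok₃ = ∧-elimʳ {allFrom (headOK Λ es) L (suc T ∸ L)} ok₂
    ok₄ : (2 ^ κ * (A * (N * requires P es + Λ * cost P)) ≤ᵇ 2 ^ κ * (B * (N * Λ)) + A * (N * supplies P es)) ≡ true
    ok₄ = ∧-elimʳ {allFrom (tailOK Λ es) T T} ok₃
    small : ∀ a → L ≤ a → a ≤ T → 2 ^ κ * Λ ≤ a * total κ es a
    small a L≤a a≤T = ≤ᵇ⇒≤ _ _ (≡true⇒T (allFrom-sound (headOK Λ es) L (suc T ∸ L) (∧-elimˡ ok₂) L≤a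
      (subst (a <_) (sym (m+[n∸m]≡n (≤-trans L≤a (m≤n⇒m≤1+n a≤T)))) (s≤s a≤T))))
    large : ∀ b → T ≤ b → b < T * 2 → 2 ^ κ * Λ ≤ b * total κ es (suc b)
    large b T≤b b<2T = ≤ᵇ⇒≤ _ _ (≡true⇒T (allFrom-sound (tailOK Λ es) T T (∧-elimˡ ok₃) T≤b (subst (b <_) (twice T) b<2T)))
      where twice : ∀ t → t * 2 ≡ t + t
            twice = solve-∀
    open ≤-Reasoning
    each : ∀ {ax} → L ≤ proj₁ ax × proj₁ ax * proj₂ ax ≤ Q × proj₁ ax ≤ 2 ^ k → Λ * (2 ^ k * 2 ^ κ) * proj₂ ax ≤ Q * total (k + κ) es (proj₁ ax)
    each {a , x} (L≤a , ax≤Q , a≤) = begin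
      Λ * (2 ^ k * 2 ^ κ) * x         ≡⟨ cong (_* x) (trans (*-comm Λ (2 ^ k * 2 ^ κ)) (cong (_* Λ) (sym (^-distribˡ-+-* 2 k κ)))) ⟩
      2 ^ (k + κ) * Λ * x             ≤⟨ *-monoˡ-≤ x (job-bound κ T L Λ es 0<T small large k a L≤a a≤) ⟩
      a * total (k + κ) es a * x      ≡⟨ *-swap a _ x ⟩
      a * x * total (k + κ) es a      ≤⟨ *-monoˡ-≤ _ ax≤Q ⟩
      Q * total (k + κ) es a          ∎
    bound : Λ * (2 ^ k * 2 ^ κ) * ∑ proj₂ R ≤ Q * ∑ (total (k + κ) es) (map proj₁ R)
    bound = begin
      Λ * (2 ^ k * 2 ^ κ) * ∑ proj₂ R                       ≡⟨ sym (∑-* (Λ * (2 ^ k * 2 ^ κ)) proj₂ R) ⟩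
      ∑ (λ ax → Λ * (2 ^ k * 2 ^ κ) * proj₂ ax) R           ≤⟨ ∑-mono (All.map each (All.zip (L≤ , All.zip (wt , All.map⁻ (All.++⁻ʳ P bd))))) ⟩
      ∑ (λ ax → Q * total (k + κ) es (proj₁ ax)) R          ≡⟨ ∑-* Q (λ ax → total (k + κ) es (proj₁ ax)) R ⟩
      Q * ∑ (λ ax → total (k + κ) es (proj₁ ax)) R          ≡⟨ cong (λ l → Q * sum l) (map-∘ R) ⟩
      Q * ∑ (total (k + κ) es) (map proj₁ R)                ∎

  ≤share* : ∀ p → 0 < p → N ≤ share p * p
  ≤share* (suc p) _ = <⇒≤ (m<[1+m/n]*n N (suc p))

  -- If a job of period `L` occurs, one copy moves from `R` to `P`; `L` stays the lower bound
  -- because there may be further copies. Its contribution `x / Q ≤ 1 / L` is replaced by the larger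
  -- `share L / N`, so the density hypothesis survives.
  tree-sound : ∀ t P L R Q {{_ : NonZero Q}} → 0 < L → check t P L ≡ true → All (λ ax → L ≤ proj₁ ax) R → Weighted Q R →
    B * (N * Q) ≤ A * (N * ∑ proj₂ R + Q * cost P) → Covers (P ++ map proj₁ R) everyDay
  tree-sound (leaf Λ es) P L R Q 0<L ok L≤ wt dense = leaf-sound Λ es P L R Q ok L≤ wt dense
  tree-sound (br t u) P L R Q 0<L ok L≤ wt dense with extract {P = λ ax → L ≡ proj₁ ax} {Q = λ ax → L < proj₁ ax} (All.map (λ le → Sum.swap (m≤n⇒m<n∨m≡n le)) L≤)
  ... | inj₂ L< = tree-sound t P (suc L) R Q (s≤s z≤n) (∧-elimˡ ok) L< wt dense
  ... | inj₁ ((.L , x) , R′ , refl , π) = covers-↭ (++⁺ˡ P (map⁺ proj₁ (↭-sym π)))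
      (subst (λ l → Covers l everyDay) (++-assoc P (L ∷ []) (map proj₁ R′))
        (tree-sound u (P ++ L ∷ []) L R′ Q 0<L (∧-elimʳ {check t P (suc L)} ok) (All.tail (All-resp-↭ π L≤)) (All.tail wt′) dense′))
      where
      open ≤-Reasoning
      wt′ = All-resp-↭ π wt
      regroup : ∀ N x c Q S → N * (x + S) + Q * c ≡ N * S + Q * c + N * x
      regroup = solve-∀
      spread : ∀ N s c Q S → N * S + Q * c + Q * s ≡ N * S + Q * (c + (s + 0))
      spread = solve-∀
      assoc : ∀ s L x → s * L * x ≡ s * (L * x)
      assoc = solve-∀
      dense′ : B * (N * Q) ≤ A * (N * ∑ proj₂ R′ + Q * cost (P ++ L ∷ []))
      dense′ = ≤-trans dense (*-monoʳ-≤ A (begin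
        N * ∑ proj₂ R + Q * cost P                       ≡⟨ cong (λ t → N * t + Q * cost P) (∑-↭ proj₂ π) ⟩
        N * (x + ∑ proj₂ R′) + Q * cost P                ≡⟨ regroup N x (cost P) Q (∑ proj₂ R′) ⟩
        N * ∑ proj₂ R′ + Q * cost P + N * x           ≤⟨ +-monoʳ-≤ (N * ∑ proj₂ R′ + Q * cost P) (*-monoˡ-≤ x (≤share* L 0<L)) ⟩
        N * ∑ proj₂ R′ + Q * cost P + share L * L * x    ≡⟨ cong (N * ∑ proj₂ R′ + Q * cost P +_) (assoc (share L) L x) ⟩
        N * ∑ proj₂ R′ + Q * cost P + share L * (L * x)  ≤⟨ +-monoʳ-≤ (N * ∑ proj₂ R′ + Q * cost P) (≤-trans (*-monoʳ-≤ (share L) (All.head wt′)) (≤-reflexive (*-comm (share L) Q))) ⟩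
        N * ∑ proj₂ R′ + Q * cost P + Q * share L        ≡⟨ spread N (share L) (cost P) Q (∑ proj₂ R′) ⟩
        N * ∑ proj₂ R′ + Q * (cost P + (share L + 0))    ≡⟨ cong (λ t → N * ∑ proj₂ R′ + Q * t) (sym (∑-++ share P (L ∷ []))) ⟩
        N * ∑ proj₂ R′ + Q * cost (P ++ L ∷ [])          ∎))

-- The multipliers `Λ`, `α` and `β` are the dual solutions at the leaves; they carry no proof
-- obligation beyond the evaluation of `check` in `core`. The placement codes are mostly of one
-- kind: 64 has the digits 0, 1 and 8256 = 64 + 2 * 64 ^ 2 the digits 0, 1, 2, so successive jobs
-- look for a free slot from slots 0, 1, 2 on.
certificate : Tree
certificate =
 (br
 (br
 (br
 (br
 (br
 (br
 (br
 (leaf 16489 (on 4 0 0 122 ∷ on 5 0 0 117 ∷ on 6 0 0 58 ∷ on 7 0 0 79 ∷ on 9 0 0 9 ∷ on 10 0 0 11 ∷ on 11 0 0 36 ∷ on 13 0 0 33 ∷ on 15 0 0 4 ∷ on 17 0 0 18 ∷ on 18 0 0 2 ∷ []))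
 (br
 (br
 (br
 (leaf 230772 (on 3 0 0 1473 ∷ on 4 0 0 1738 ∷ on 5 0 0 1205 ∷ on 7 0 0 1099 ∷ on 9 0 0 602 ∷ on 11 0 0 108 ∷ on 13 0 0 423 ∷ on 15 0 0 113 ∷ on 17 0 0 153 ∷ on 19 0 0 136 ∷ on 22 0 0 148 ∷ []))
 (br
 (br
 (br
 (leaf 5976 (on 3 0 0 14 ∷ on 4 0 0 44 ∷ on 5 0 0 26 ∷ on 7 0 0 29 ∷ on 9 0 0 25 ∷ on 11 64 0 13 ∷ on 13 64 0 4 ∷ on 15 64 0 4 ∷ on 19 64 0 8 ∷ on 23 64 0 2 ∷ []))
 (br
 (leaf 45495 (on 3 0 0 271 ∷ on 4 0 0 334 ∷ on 5 0 0 253 ∷ on 7 0 0 217 ∷ on 9 0 0 93 ∷ on 11 64 0 97 ∷ on 13 8256 0 4 ∷ on 15 8256 0 22 ∷ on 17 8256 0 41 ∷ on 19 8256 0 28 ∷ on 27 8256 0 33 ∷ []))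
 (leaf 1170561 (on 3 0 0 8837 ∷ on 4 0 0 9114 ∷ on 5 0 0 9111 ∷ on 7 0 0 5575 ∷ on 9 0 0 2142 ∷ on 13 794688 0 2144 ∷ on 15 794688 0 23 ∷ on 17 794688 0 966 ∷ on 22 794688 0 985 ∷ on 29 794688 0 243 ∷ []))))
 (leaf 153773 (on 3 0 0 1246 ∷ on 4 0 0 1282 ∷ on 5 0 0 987 ∷ on 7 0 0 733 ∷ on 9 0 0 324 ∷ on 13 8256 0 282 ∷ on 15 8256 0 25 ∷ on 17 8256 0 105 ∷ on 19 8256 0 46 ∷ on 22 8256 0 105 ∷ on 29 8256 0 24 ∷ [])))
 (br
 (br
 (br
 (leaf 7321 (on 3 0 0 46 ∷ on 4 0 0 54 ∷ on 5 0 0 43 ∷ on 7 0 0 35 ∷ on 9 0 0 21 ∷ on 11 8256 0 16 ∷ on 13 8256 0 2 ∷ on 15 8256 0 3 ∷ on 17 8256 0 4 ∷ on 19 8256 0 3 ∷ on 25 8256 0 5 ∷ []))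
 (br
 (br
 (leaf 45495 (on 3 0 0 333 ∷ on 4 0 0 358 ∷ on 5 0 0 357 ∷ on 7 0 0 161 ∷ on 9 0 0 130 ∷ on 11 8256 0 40 ∷ on 13 794688 0 43 ∷ on 17 794688 0 23 ∷ on 22 794688 0 26 ∷ on 27 794688 0 30 ∷ on 29 794688 0 3 ∷ []))
 (leaf 55734 (on 3 0 0 401 ∷ on 4 0 0 445 ∷ on 5 0 0 430 ∷ on 7 0 0 266 ∷ on 9 0 0 123 ∷ on 11 8256 0 5 ∷ on 13 794688 0 95 ∷ on 17 67903552 0 40 ∷ on 22 67903552 0 45 ∷ on 29 67903552 0 13 ∷ [])))
 (leaf 2463858 (on 3 0 0 18186 ∷ on 4 0 0 18770 ∷ on 5 0 0 19314 ∷ on 7 0 0 11733 ∷ on 9 0 0 4717 ∷ on 11 8256 0 35 ∷ on 13 67903552 0 4513 ∷ on 15 67903552 0 95 ∷ on 17 67903552 0 1929 ∷ on 22 67903552 0 2177 ∷ on 29 67903552 0 471 ∷ []))))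
 (leaf 59635 (on 3 0 0 629 ∷ on 4 0 0 466 ∷ on 5 0 0 535 ∷ on 7 0 0 251 ∷ on 13 794688 0 110 ∷ on 17 794688 0 37 ∷ on 18 794688 0 22 ∷ on 22 794688 0 41 ∷ on 25 794688 0 22 ∷ on 27 794688 0 8 ∷ [])))
 (br
 (br
 (br
 (leaf 8382 (on 3 0 0 36 ∷ on 4 0 0 66 ∷ on 5 0 0 67 ∷ on 7 0 0 40 ∷ on 9 0 0 27 ∷ on 11 794688 0 19 ∷ on 13 794688 0 1 ∷ on 17 794688 0 3 ∷ on 23 794688 0 3 ∷ on 25 794688 0 6 ∷ []))
 (br
 (leaf 48680 (on 3 0 0 357 ∷ on 4 0 0 382 ∷ on 5 0 0 414 ∷ on 7 0 0 217 ∷ on 11 794688 0 97 ∷ on 17 67903552 0 41 ∷ on 18 67903552 0 30 ∷ on 22 67903552 0 4 ∷ on 27 67903552 0 55 ∷ []))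
 (leaf 13460 (on 3 0 0 105 ∷ on 4 0 0 99 ∷ on 5 0 0 116 ∷ on 7 0 0 63 ∷ on 9 0 0 20 ∷ on 13 5436612672 0 32 ∷ on 17 5436612672 0 7 ∷ on 22 5436612672 0 15 ∷ []))))
 (leaf 20200 (on 3 0 0 118 ∷ on 4 0 0 188 ∷ on 5 0 0 147 ∷ on 7 0 0 88 ∷ on 9 0 0 57 ∷ on 13 67903552 0 39 ∷ on 17 67903552 0 9 ∷ on 22 67903552 0 24 ∷ [])))
 (leaf 11757 (on 3 0 0 68 ∷ on 4 0 0 110 ∷ on 5 0 0 74 ∷ on 7 0 0 56 ∷ on 11 67903552 0 37 ∷ on 13 67903552 1 21 ∷ on 17 67903552 0 9 ∷ on 18 67903552 0 9 ∷ on 22 67903552 0 1 ∷ []))))))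
 (br
 (br
 (br
 (br
 (leaf 15411 (on 3 0 0 43 ∷ on 4 0 0 114 ∷ on 5 0 0 129 ∷ on 7 0 0 73 ∷ on 9 0 0 24 ∷ on 10 64 0 6 ∷ on 11 64 0 34 ∷ on 17 64 0 13 ∷ on 18 64 0 7 ∷ on 23 64 0 6 ∷ on 25 64 0 8 ∷ on 30 64 0 3 ∷ []))
 (br
 (leaf 48680 (on 3 0 0 182 ∷ on 4 0 0 358 ∷ on 5 0 0 484 ∷ on 7 0 0 193 ∷ on 9 0 0 93 ∷ on 11 64 0 102 ∷ on 13 8256 0 15 ∷ on 17 8256 0 49 ∷ on 18 8256 0 7 ∷ on 22 8256 0 2 ∷ on 23 8256 0 5 ∷ on 27 8256 0 16 ∷ on 30 8256 0 19 ∷ []))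
 (br
 (leaf 34708 (on 3 0 0 151 ∷ on 4 0 0 263 ∷ on 5 0 0 340 ∷ on 7 0 0 137 ∷ on 9 0 0 76 ∷ on 11 64 0 60 ∷ on 13 794688 0 14 ∷ on 17 794688 0 32 ∷ on 22 794688 0 8 ∷ on 27 794688 0 13 ∷ on 30 794688 0 13 ∷ []))
 (leaf 21614 (on 3 0 0 238 ∷ on 4 0 0 159 ∷ on 5 0 0 223 ∷ on 7 0 0 82 ∷ on 13 67903552 0 40 ∷ on 17 67903552 0 23 ∷ on 22 67903552 0 7 ∷ on 27 67903552 0 6 ∷ on 29 67903552 0 5 ∷ on 31 67903552 0 2 ∷ [])))))
 (br
 (br
 (leaf 20200 (on 3 0 0 132 ∷ on 4 0 0 149 ∷ on 5 0 0 169 ∷ on 7 0 0 97 ∷ on 9 0 0 36 ∷ on 11 64 0 44 ∷ on 13 8256 0 5 ∷ on 17 8256 0 15 ∷ on 18 8256 0 1 ∷ on 25 8256 2 15 ∷ on 30 8256 0 2 ∷ []))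
 (leaf 73056 (on 3 0 0 772 ∷ on 4 0 0 609 ∷ on 5 0 0 718 ∷ on 7 0 0 258 ∷ on 13 794688 0 134 ∷ on 17 794688 0 80 ∷ on 18 794688 0 7 ∷ on 22 794688 0 27 ∷ on 27 794688 0 23 ∷ on 29 794688 0 17 ∷ [])))
 (leaf 11757 (on 3 0 0 170 ∷ on 4 0 0 107 ∷ on 5 0 0 92 ∷ on 7 0 0 35 ∷ on 13 794688 0 38 ∷ on 14 794688 0 5 ∷ on 18 794688 0 10 ∷ on 21 794688 0 3 ∷ []))))
 (br
 (br
 (br
 (leaf 14402 (on 3 0 0 56 ∷ on 4 0 0 106 ∷ on 5 0 0 121 ∷ on 7 0 0 68 ∷ on 9 0 0 44 ∷ on 11 8256 0 32 ∷ on 17 8256 0 6 ∷ on 23 8256 0 7 ∷ on 25 8256 0 11 ∷ []))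
 (br
 (br
 (leaf 89497 (on 3 0 0 582 ∷ on 4 0 0 659 ∷ on 5 0 0 746 ∷ on 7 0 0 316 ∷ on 9 0 0 251 ∷ on 11 8256 0 57 ∷ on 13 794688 0 125 ∷ on 17 794688 0 53 ∷ on 22 794688 0 69 ∷ on 27 794688 0 27 ∷ on 30 794688 0 14 ∷ []))
 (leaf 10987 (on 3 0 0 26 ∷ on 4 0 0 81 ∷ on 5 0 0 115 ∷ on 7 0 0 48 ∷ on 9 0 0 29 ∷ on 11 8256 0 20 ∷ on 17 67903552 0 9 ∷ on 22 67903552 0 2 ∷ on 23 67903552 0 2 ∷ on 27 67903552 0 3 ∷ on 30 67903552 0 5 ∷ [])))
 (leaf 215674 (on 3 0 0 1682 ∷ on 4 0 0 1585 ∷ on 5 0 0 2330 ∷ on 7 0 0 761 ∷ on 9 0 0 18 ∷ on 11 8256 0 180 ∷ on 13 67903552 119 277 ∷ on 17 67903552 0 216 ∷ on 22 67903552 0 144 ∷ on 27 67903552 0 77 ∷ []))))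
 (leaf 32437 (on 3 0 0 461 ∷ on 4 0 0 250 ∷ on 5 0 0 309 ∷ on 7 0 0 130 ∷ on 13 794688 0 60 ∷ on 17 794688 0 2 ∷ on 18 794688 0 12 ∷ on 22 794688 0 8 ∷ on 25 794688 0 21 ∷ on 27 794688 0 6 ∷ [])))
 (br
 (br
 (br
 (leaf 6395 (on 3 0 0 28 ∷ on 4 0 0 48 ∷ on 5 0 0 52 ∷ on 7 0 0 31 ∷ on 9 0 0 20 ∷ on 11 794688 0 14 ∷ on 17 794688 0 2 ∷ on 23 794688 0 3 ∷ on 25 794688 0 5 ∷ []))
 (leaf 95762 (on 3 0 0 747 ∷ on 4 0 0 705 ∷ on 5 0 0 1035 ∷ on 7 0 0 338 ∷ on 9 0 0 9 ∷ on 11 794688 0 80 ∷ on 13 67903552 53 123 ∷ on 17 67903552 0 95 ∷ on 22 67903552 0 64 ∷ on 27 67903552 0 34 ∷ [])))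
 (leaf 282705 (on 3 0 0 2293 ∷ on 4 0 0 2079 ∷ on 5 0 0 2692 ∷ on 7 0 0 1178 ∷ on 9 0 0 240 ∷ on 11 794688 0 67 ∷ on 13 67903552 202 504 ∷ on 17 67903552 0 100 ∷ on 18 67903552 0 68 ∷ on 22 67903552 0 303 ∷ [])))
 (leaf 16489 (on 3 0 0 52 ∷ on 4 0 0 122 ∷ on 5 0 0 265 ∷ on 7 0 0 15 ∷ on 11 67903552 0 42 ∷ on 13 67903552 26 11 ∷ on 22 67903552 0 13 ∷ on 23 67903552 0 9 ∷ [])))))
 (br
 (br
 (leaf 164537 (on 3 0 0 900 ∷ on 4 0 0 1210 ∷ on 5 0 0 2719 ∷ on 7 0 0 110 ∷ on 11 8256 0 198 ∷ on 13 8256 141 161 ∷ on 21 8256 0 151 ∷ on 22 8256 0 80 ∷ on 27 8256 0 18 ∷ on 30 8256 0 47 ∷ []))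
 (leaf 18879 (on 3 0 0 104 ∷ on 4 0 0 139 ∷ on 5 0 0 304 ∷ on 7 0 0 17 ∷ on 11 794688 0 48 ∷ on 13 794688 26 9 ∷ on 21 794688 0 10 ∷ on 23 794688 0 6 ∷ on 25 794688 0 2 ∷ on 27 794688 0 4 ∷ [])))
 (leaf 785 (on 3 0 0 1 ∷ on 4 0 0 7 ∷ on 5 0 0 14 ∷ on 11 794688 0 2 ∷ on 12 794688 0 1 ∷ on 13 794688 1 0 ∷ on 21 794688 0 1 ∷ [])))))
 (br
 (br
 (leaf 1340175 (on 3 0 0 7851 ∷ on 4 0 0 12232 ∷ on 5 0 0 8457 ∷ on 7 0 0 6382 ∷ on 9 64 0 1320 ∷ on 11 64 0 2901 ∷ on 13 64 0 2455 ∷ on 15 64 0 55 ∷ on 18 64 0 1672 ∷ on 19 64 0 513 ∷ []))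
 (br
 (br
 (br
 (br
 (leaf 5976 (on 3 0 0 44 ∷ on 5 0 0 66 ∷ on 9 64 0 38 ∷ on 11 8256 0 13 ∷ on 13 8256 0 1 ∷ on 14 8256 0 6 ∷ on 18 8256 0 1 ∷ on 21 8256 0 4 ∷ on 23 8256 0 5 ∷ []))
 (leaf 14402 (on 3 0 0 127 ∷ on 4 0 0 106 ∷ on 5 0 0 144 ∷ on 7 0 0 39 ∷ on 11 8256 0 18 ∷ on 13 794688 9 18 ∷ on 14 794688 0 6 ∷ on 18 794688 0 19 ∷ on 22 794688 0 5 ∷ on 27 794688 0 4 ∷ [])))
 (leaf 117312 (on 3 0 0 1394 ∷ on 4 0 0 546 ∷ on 5 0 0 978 ∷ on 7 0 0 194 ∷ on 9 64 0 361 ∷ on 13 794688 52 163 ∷ on 14 794688 0 121 ∷ on 18 794688 0 59 ∷ on 21 794688 0 31 ∷ on 22 794688 0 106 ∷ [])))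
 (leaf 32437 (on 3 0 0 252 ∷ on 4 0 0 239 ∷ on 5 0 0 313 ∷ on 7 0 0 105 ∷ on 11 794688 0 70 ∷ on 13 794688 20 40 ∷ on 14 794688 0 10 ∷ on 18 794688 0 45 ∷ on 22 794688 0 1 ∷ on 27 794688 0 7 ∷ [])))
 (leaf 2653 (on 3 0 0 37 ∷ on 5 0 0 45 ∷ on 9 64 0 1 ∷ on 11 794688 0 6 ∷ on 13 794688 6 0 ∷ on 18 794688 0 1 ∷ on 21 794688 0 3 ∷ []))))
 (leaf 2653 (on 3 0 0 49 ∷ on 5 0 0 24 ∷ on 7 0 0 5 ∷ on 9 8256 0 10 ∷ on 11 8256 0 5 ∷ on 13 8256 0 4 ∷ on 14 8256 0 3 ∷ on 18 8256 0 1 ∷ [])))))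
 (br
 (br
 (br
 (br
 (leaf 13460 (on 3 0 0 97 ∷ on 4 0 0 77 ∷ on 5 0 0 67 ∷ on 7 0 0 62 ∷ on 8 0 0 32 ∷ on 9 0 0 20 ∷ on 11 0 0 22 ∷ on 13 0 0 25 ∷ on 17 0 0 14 ∷ on 19 0 0 8 ∷ []))
 (br
 (br
 (br
 (leaf 52088 (on 3 0 0 203 ∷ on 4 0 0 522 ∷ on 5 0 0 296 ∷ on 7 0 0 249 ∷ on 9 0 0 104 ∷ on 11 64 0 113 ∷ on 13 64 0 76 ∷ on 17 64 0 47 ∷ on 19 64 0 33 ∷ on 23 64 0 7 ∷ []))
 (br
 (leaf 5220 (on 3 0 0 30 ∷ on 4 0 0 50 ∷ on 5 0 0 33 ∷ on 7 0 0 25 ∷ on 9 0 0 5 ∷ on 11 64 0 11 ∷ on 13 8256 0 1 ∷ on 17 8256 0 5 ∷ on 18 8256 0 2 ∷ on 19 8256 0 2 ∷ on 25 8256 0 2 ∷ on 26 8256 0 2 ∷ []))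
 (leaf 63810 (on 3 0 0 497 ∷ on 4 0 0 641 ∷ on 5 0 0 499 ∷ on 7 0 0 281 ∷ on 9 0 0 62 ∷ on 11 64 0 22 ∷ on 13 794688 0 102 ∷ on 17 794688 0 70 ∷ on 22 794688 0 37 ∷ on 26 1056832 0 13 ∷ on 27 794688 0 5 ∷ []))))
 (leaf 20200 (on 3 0 0 129 ∷ on 4 0 0 212 ∷ on 5 0 0 111 ∷ on 7 0 0 94 ∷ on 9 0 0 29 ∷ on 11 64 0 32 ∷ on 13 8256 0 38 ∷ on 17 8256 0 22 ∷ on 19 8256 0 9 ∷ on 24 8256 0 2 ∷ [])))
 (br
 (leaf 246926 (on 3 0 0 1926 ∷ on 4 0 0 2583 ∷ on 5 0 0 1828 ∷ on 7 0 0 1101 ∷ on 9 0 0 256 ∷ on 11 8256 0 85 ∷ on 13 8256 0 388 ∷ on 17 8256 0 264 ∷ on 22 8256 0 147 ∷ on 25 8256 0 70 ∷ []))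
 (leaf 26479 (on 3 0 0 201 ∷ on 4 0 0 268 ∷ on 5 0 0 196 ∷ on 7 0 0 116 ∷ on 9 0 0 30 ∷ on 11 794688 0 46 ∷ on 13 794688 0 44 ∷ on 17 794688 0 28 ∷ on 25 794688 0 6 ∷ [])))))
 (br
 (br
 (br
 (br
 (leaf 7321 (on 3 0 0 36 ∷ on 4 0 0 69 ∷ on 5 0 0 46 ∷ on 7 0 0 35 ∷ on 9 0 0 14 ∷ on 10 64 0 6 ∷ on 11 64 0 16 ∷ on 13 64 0 1 ∷ on 17 64 0 7 ∷ on 23 64 0 1 ∷ on 25 64 0 5 ∷ []))
 (br
 (leaf 28332 (on 3 0 0 177 ∷ on 4 0 0 222 ∷ on 5 0 0 224 ∷ on 7 0 0 135 ∷ on 9 0 0 42 ∷ on 11 64 0 40 ∷ on 13 8256 0 11 ∷ on 17 8256 0 30 ∷ on 18 8256 0 1 ∷ on 22 8256 0 11 ∷ on 25 8256 0 17 ∷ on 26 8256 0 4 ∷ on 30 8256 0 2 ∷ []))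
 (br
 (leaf 4878 (on 3 0 0 35 ∷ on 4 0 0 39 ∷ on 5 0 0 42 ∷ on 7 0 0 22 ∷ on 9 0 0 1 ∷ on 11 64 0 9 ∷ on 17 794688 0 5 ∷ on 18 794688 0 2 ∷ on 22 794688 0 1 ∷ on 26 1056832 0 5 ∷ []))
 (leaf 7321 (on 3 0 0 81 ∷ on 4 0 0 66 ∷ on 5 0 0 67 ∷ on 7 0 0 26 ∷ on 13 67903552 0 14 ∷ on 17 67903552 0 8 ∷ on 26 84942912 0 4 ∷ on 27 67903552 0 3 ∷ [])))))
 (leaf 14402 (on 3 0 0 110 ∷ on 4 0 0 143 ∷ on 5 0 0 115 ∷ on 7 0 0 69 ∷ on 9 0 0 11 ∷ on 11 64 0 6 ∷ on 13 8256 0 22 ∷ on 17 8256 0 16 ∷ on 22 8256 0 7 ∷ on 24 8256 0 1 ∷ on 25 8256 0 4 ∷ [])))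
 (br
 (br
 (br
 (leaf 6842 (on 3 0 0 44 ∷ on 4 0 0 61 ∷ on 5 0 0 55 ∷ on 7 0 0 29 ∷ on 9 0 0 10 ∷ on 11 8256 0 15 ∷ on 13 8256 0 3 ∷ on 17 8256 0 8 ∷ on 22 8256 0 1 ∷ on 25 8256 0 4 ∷ []))
 (br
 (leaf 24746 (on 3 0 0 176 ∷ on 4 0 0 200 ∷ on 5 0 0 214 ∷ on 7 0 0 106 ∷ on 9 0 0 3 ∷ on 11 8256 0 45 ∷ on 17 794688 0 21 ∷ on 18 794688 0 15 ∷ on 22 794688 0 5 ∷ on 25 794688 2 11 ∷ on 26 1056832 0 12 ∷ on 27 794688 0 2 ∷ []))
 (leaf 28332 (on 3 0 0 287 ∷ on 4 0 0 280 ∷ on 5 0 0 253 ∷ on 7 0 0 101 ∷ on 11 8256 0 2 ∷ on 13 67903552 0 49 ∷ on 17 67903552 0 30 ∷ on 18 67903552 0 4 ∷ on 22 67903552 0 13 ∷ on 26 84942912 0 6 ∷ on 27 67903552 0 8 ∷ []))))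
 (leaf 13460 (on 3 0 0 104 ∷ on 4 0 0 133 ∷ on 5 0 0 125 ∷ on 7 0 0 65 ∷ on 11 8256 0 6 ∷ on 13 794688 0 18 ∷ on 17 794688 0 15 ∷ on 18 794688 0 1 ∷ on 22 794688 0 6 ∷ on 24 794688 0 1 ∷ on 25 794688 0 5 ∷ [])))
 (leaf 323669 (on 3 0 0 2256 ∷ on 4 0 0 2649 ∷ on 5 0 0 2726 ∷ on 7 0 0 1541 ∷ on 11 794688 0 692 ∷ on 13 794688 0 544 ∷ on 17 794688 0 346 ∷ on 18 794688 0 119 ∷ on 22 794688 0 5 ∷ on 25 794688 0 73 ∷ []))))
 (br
 (br
 (br
 (br
 (leaf 7834 (on 3 0 0 34 ∷ on 4 0 0 70 ∷ on 5 0 0 113 ∷ on 7 0 0 8 ∷ on 11 8256 0 17 ∷ on 17 8256 0 7 ∷ on 21 8256 0 6 ∷ on 25 8256 1 3 ∷ on 27 8256 0 3 ∷ on 30 8256 0 1 ∷ []))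
 (leaf 125524 (on 3 0 0 808 ∷ on 4 0 0 940 ∷ on 5 0 0 1458 ∷ on 7 0 0 543 ∷ on 11 8256 0 97 ∷ on 13 794688 0 177 ∷ on 17 794688 0 136 ∷ on 22 794688 0 73 ∷ on 27 794688 0 14 ∷ on 30 794688 0 34 ∷ [])))
 (leaf 8969 (on 3 0 0 69 ∷ on 4 0 0 88 ∷ on 5 0 0 85 ∷ on 7 0 0 43 ∷ on 11 8256 0 5 ∷ on 13 794688 0 12 ∷ on 17 794688 0 10 ∷ on 22 794688 0 4 ∷ on 24 794688 0 1 ∷ on 25 794688 0 3 ∷ [])))
 (leaf 32437 (on 3 0 0 227 ∷ on 4 0 0 266 ∷ on 5 0 0 321 ∷ on 7 0 0 154 ∷ on 11 794688 0 70 ∷ on 13 794688 0 47 ∷ on 17 794688 0 35 ∷ on 25 794688 0 11 ∷ [])))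
 (leaf 1892 (on 4 0 0 25 ∷ on 5 0 0 32 ∷ on 10 794688 0 1 ∷ on 11 794688 0 5 ∷ on 13 794688 0 3 ∷ on 21 794688 0 2 ∷ [])))))
 (br
 (br
 (br
 (br
 (br
 (leaf 8969 (on 3 0 0 23 ∷ on 4 0 0 83 ∷ on 5 0 0 30 ∷ on 7 0 0 43 ∷ on 9 64 0 37 ∷ on 10 64 0 2 ∷ on 11 64 0 20 ∷ on 13 64 0 7 ∷ on 15 64 0 4 ∷ on 19 64 0 13 ∷ on 23 64 0 1 ∷ []))
 (br
 (leaf 2317 (on 3 0 0 9 ∷ on 4 0 0 27 ∷ on 5 0 0 12 ∷ on 7 0 0 8 ∷ on 9 64 0 10 ∷ on 11 64 0 3 ∷ on 19 8256 0 3 ∷ on 22 8256 0 1 ∷ on 27 8256 0 1 ∷ []))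
 (br
 (leaf 12580 (on 3 0 0 55 ∷ on 4 0 0 136 ∷ on 5 0 0 86 ∷ on 7 0 0 44 ∷ on 9 64 0 33 ∷ on 11 64 0 19 ∷ on 14 794688 0 1 ∷ on 17 794688 0 9 ∷ on 19 794688 0 10 ∷ on 22 794688 0 2 ∷ on 27 794688 0 8 ∷ on 29 794688 0 1 ∷ []))
 (leaf 78170 (on 3 0 0 635 ∷ on 4 0 0 720 ∷ on 5 0 0 603 ∷ on 7 0 0 275 ∷ on 9 64 0 374 ∷ on 13 67903552 0 143 ∷ on 27 67903552 0 25 ∷ on 29 67903552 0 23 ∷ [])))))
 (leaf 188378 (on 3 0 0 2554 ∷ on 4 0 0 1933 ∷ on 5 0 0 959 ∷ on 7 0 0 687 ∷ on 9 64 0 426 ∷ on 13 8256 0 346 ∷ on 17 8256 0 115 ∷ on 19 8256 0 118 ∷ on 27 8256 0 52 ∷ [])))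
 (br
 (br
 (br
 (leaf 9597 (on 3 0 0 47 ∷ on 4 0 0 109 ∷ on 5 0 0 55 ∷ on 7 0 0 32 ∷ on 9 64 0 25 ∷ on 11 8256 0 15 ∷ on 14 8256 0 3 ∷ on 17 8256 0 7 ∷ on 19 8256 0 8 ∷ on 22 8256 0 2 ∷ on 25 8256 0 5 ∷ on 27 8256 0 1 ∷ []))
 (br
 (leaf 8382 (on 3 0 0 39 ∷ on 4 0 0 97 ∷ on 5 0 0 50 ∷ on 7 0 0 25 ∷ on 9 64 0 22 ∷ on 11 8256 0 13 ∷ on 14 794688 0 3 ∷ on 17 794688 0 6 ∷ on 19 794688 0 7 ∷ on 22 794688 0 1 ∷ on 27 794688 0 6 ∷ []))
 (br
 (leaf 8382 (on 3 0 0 64 ∷ on 4 0 0 76 ∷ on 5 0 0 77 ∷ on 7 0 0 29 ∷ on 11 8256 0 15 ∷ on 17 67903552 0 8 ∷ on 18 67903552 0 5 ∷ on 19 67903552 0 1 ∷ on 26 84942912 1 0 ∷ on 27 67903552 0 8 ∷ []))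
 (leaf 4261 (on 3 0 0 62 ∷ on 4 0 0 38 ∷ on 5 0 0 38 ∷ on 7 0 0 13 ∷ on 13 5436612672 0 8 ∷ on 14 5436612672 0 1 ∷ on 17 5436612672 0 4 ∷ on 27 6510354496 0 3 ∷ [])))))
 (leaf 26479 (on 3 0 0 407 ∷ on 4 0 0 265 ∷ on 5 0 0 208 ∷ on 7 0 0 79 ∷ on 13 794688 0 48 ∷ on 14 794688 0 7 ∷ on 18 794688 0 21 ∷ on 25 794688 0 18 ∷ on 27 794688 0 3 ∷ [])))
 (br
 (br
 (br
 (leaf 8969 (on 3 0 0 42 ∷ on 4 0 0 94 ∷ on 5 0 0 69 ∷ on 7 0 0 32 ∷ on 9 64 0 14 ∷ on 11 794688 0 20 ∷ on 17 794688 0 8 ∷ on 18 794688 0 2 ∷ on 19 794688 0 4 ∷ on 25 794688 0 5 ∷ on 27 794688 0 2 ∷ []))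
 (br
 (leaf 4878 (on 3 0 0 31 ∷ on 4 0 0 43 ∷ on 5 0 0 46 ∷ on 7 0 0 17 ∷ on 9 64 0 2 ∷ on 11 794688 0 9 ∷ on 17 67903552 0 4 ∷ on 18 67903552 0 3 ∷ on 22 67903552 0 1 ∷ on 27 67903552 0 5 ∷ []))
 (leaf 125524 (on 3 0 0 1473 ∷ on 4 0 0 1191 ∷ on 5 0 0 1088 ∷ on 7 0 0 443 ∷ on 13 5436612672 0 230 ∷ on 17 5436612672 0 136 ∷ on 22 5436612672 0 41 ∷ on 27 5436612672 0 75 ∷ []))))
 (leaf 2653 (on 3 0 0 41 ∷ on 4 0 0 43 ∷ on 5 0 0 21 ∷ on 9 64 0 1 ∷ on 13 67903552 0 4 ∷ on 14 67903552 0 1 ∷ on 18 67903552 0 2 ∷ on 25 67903552 0 2 ∷ [])))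
 (br
 (br
 (br
 (leaf 2653 (on 3 0 0 12 ∷ on 4 0 0 45 ∷ on 5 0 0 23 ∷ on 9 64 0 9 ∷ on 11 67903552 0 5 ∷ on 22 67903552 0 2 ∷ on 25 67903552 0 2 ∷ []))
 (br
 (leaf 6395 (on 3 0 0 49 ∷ on 4 0 0 102 ∷ on 5 0 0 60 ∷ on 11 67903552 0 12 ∷ on 17 5436612672 0 6 ∷ on 18 5436612672 0 4 ∷ on 25 5436612672 0 2 ∷ on 26 5436612672 2 0 ∷ on 27 5436612672 0 3 ∷ []))
 (leaf 3982 (on 3 0 0 61 ∷ on 4 0 0 62 ∷ on 5 0 0 39 ∷ on 13 417753473088 0 8 ∷ on 17 417753473088 0 2 ∷ on 26 417753473088 0 1 ∷ on 27 417753473088 0 2 ∷ []))))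
 (leaf 3038 (on 3 0 0 48 ∷ on 4 0 0 77 ∷ on 9 64 0 6 ∷ on 13 5436612672 1 9 ∷ on 22 5436612672 0 1 ∷ [])))
 (leaf 4261 (on 3 0 0 38 ∷ on 4 0 0 108 ∷ on 9 64 0 12 ∷ on 11 5436612672 0 2 ∷ on 13 5436612672 1 8 ∷ on 22 5436612672 0 6 ∷ []))))))
 (br
 (br
 (br
 (br
 (leaf 9597 (on 3 0 0 34 ∷ on 4 0 0 112 ∷ on 5 0 0 90 ∷ on 7 0 0 17 ∷ on 9 64 0 15 ∷ on 11 8256 0 21 ∷ on 14 8256 0 2 ∷ on 17 8256 0 8 ∷ on 18 8256 0 4 ∷ on 21 8256 0 4 ∷ on 25 8256 0 5 ∷ on 27 8256 0 2 ∷ []))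
 (br
 (leaf 11757 (on 3 0 0 40 ∷ on 4 0 0 111 ∷ on 5 0 0 125 ∷ on 7 0 0 30 ∷ on 9 64 0 24 ∷ on 11 8256 0 21 ∷ on 17 794688 0 10 ∷ on 18 794688 0 2 ∷ on 21 794688 0 3 ∷ on 22 794688 0 2 ∷ on 27 794688 0 7 ∷ on 30 794688 0 3 ∷ []))
 (br
 (leaf 9597 (on 3 0 0 69 ∷ on 4 0 0 79 ∷ on 5 0 0 96 ∷ on 7 0 0 34 ∷ on 9 64 0 2 ∷ on 11 8256 0 18 ∷ on 17 67903552 0 9 ∷ on 18 67903552 0 6 ∷ on 26 84942912 1 0 ∷ on 27 67903552 0 8 ∷ on 29 67903552 0 1 ∷ []))
 (leaf 4261 (on 3 0 0 62 ∷ on 4 0 0 36 ∷ on 5 0 0 48 ∷ on 7 0 0 11 ∷ on 13 5436612672 0 8 ∷ on 17 5436612672 0 2 ∷ on 27 6510354496 0 3 ∷ on 28 5436612672 0 1 ∷ [])))))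
 (leaf 89497 (on 3 0 0 1322 ∷ on 4 0 0 810 ∷ on 5 0 0 780 ∷ on 7 0 0 259 ∷ on 13 794688 0 164 ∷ on 14 794688 0 25 ∷ on 17 794688 0 39 ∷ on 18 794688 0 37 ∷ on 21 794688 0 2 ∷ on 25 794688 0 42 ∷ on 27 794688 0 27 ∷ [])))
 (br
 (br
 (br
 (leaf 9597 (on 3 0 0 60 ∷ on 4 0 0 87 ∷ on 5 0 0 92 ∷ on 7 0 0 32 ∷ on 9 64 0 16 ∷ on 11 794688 0 18 ∷ on 17 794688 0 8 ∷ on 18 794688 0 1 ∷ on 22 794688 0 2 ∷ on 25 794688 1 6 ∷ on 27 794688 0 2 ∷ []))
 (br
 (leaf 10987 (on 3 0 0 65 ∷ on 4 0 0 102 ∷ on 5 0 0 110 ∷ on 7 0 0 33 ∷ on 9 64 0 4 ∷ on 11 794688 0 20 ∷ on 17 67903552 0 9 ∷ on 18 67903552 0 7 ∷ on 22 67903552 0 3 ∷ on 25 67903552 2 0 ∷ on 27 67903552 0 9 ∷ []))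
 (leaf 52088 (on 3 0 0 807 ∷ on 4 0 0 435 ∷ on 5 0 0 638 ∷ on 7 0 0 122 ∷ on 13 5436612672 3 93 ∷ on 17 5436612672 0 2 ∷ on 26 5436612672 5 0 ∷ on 27 5436612672 0 34 ∷ on 28 5436612672 0 15 ∷ []))))
 (leaf 12580 (on 3 0 0 196 ∷ on 4 0 0 193 ∷ on 5 0 0 124 ∷ on 13 67903552 1 23 ∷ on 18 67903552 0 4 ∷ on 25 67903552 0 9 ∷ on 27 67903552 0 3 ∷ [])))
 (br
 (br
 (br
 (leaf 4559 (on 3 0 0 17 ∷ on 4 0 0 53 ∷ on 5 0 0 62 ∷ on 9 64 0 1 ∷ on 11 67903552 0 17 ∷ on 17 67903552 0 4 ∷ on 22 67903552 0 1 ∷ on 25 67903552 0 3 ∷ on 27 67903552 0 1 ∷ []))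
 (br
 (leaf 840 (on 3 0 0 6 ∷ on 4 0 0 8 ∷ on 5 0 0 14 ∷ on 11 67903552 0 1 ∷ on 22 5436612672 0 1 ∷ on 27 5436612672 0 1 ∷ []))
 (leaf 1892 (on 3 0 0 30 ∷ on 4 0 0 25 ∷ on 5 0 0 22 ∷ on 13 417753473088 0 4 ∷ on 26 417753473088 0 1 ∷ on 27 417753473088 0 1 ∷ []))))
 (leaf 12580 (on 3 0 0 109 ∷ on 4 0 0 230 ∷ on 5 0 0 88 ∷ on 9 64 0 18 ∷ on 13 5436612672 4 26 ∷ on 17 5436612672 0 8 ∷ on 18 5436612672 0 3 ∷ on 22 5436612672 0 10 ∷ [])))
 (leaf 2653 (on 3 0 0 7 ∷ on 4 0 0 34 ∷ on 5 0 0 33 ∷ on 11 5436612672 0 9 ∷ on 13 5436612672 0 5 ∷ on 22 5436612672 0 4 ∷ [])))))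
 (leaf 10987 (on 3 0 0 65 ∷ on 4 0 0 101 ∷ on 5 0 0 175 ∷ on 11 794688 0 24 ∷ on 13 794688 10 11 ∷ on 21 794688 0 10 ∷ on 25 794688 0 1 ∷ on 27 794688 0 3 ∷ []))))
 (br
 (br
 (br
 (leaf 63810 (on 3 0 0 861 ∷ on 4 0 0 659 ∷ on 5 0 0 315 ∷ on 7 0 0 232 ∷ on 9 8256 0 154 ∷ on 13 8256 0 117 ∷ on 18 8256 0 37 ∷ on 19 8256 0 40 ∷ on 21 8256 0 2 ∷ on 27 8256 0 16 ∷ []))
 (br
 (br
 (br
 (leaf 1443 (on 3 0 0 22 ∷ on 5 0 0 8 ∷ on 7 0 0 3 ∷ on 9 8256 0 9 ∷ on 11 794688 0 4 ∷ on 14 794688 0 1 ∷ on 19 794688 0 2 ∷ []))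
 (leaf 5976 (on 3 0 0 82 ∷ on 4 0 0 62 ∷ on 5 0 0 45 ∷ on 7 0 0 16 ∷ on 9 8256 0 19 ∷ on 13 67903552 0 11 ∷ on 18 67903552 0 1 ∷ on 27 67903552 0 2 ∷ on 28 67903552 0 1 ∷ [])))
 (leaf 2653 (on 3 0 0 44 ∷ on 4 0 0 44 ∷ on 5 0 0 7 ∷ on 9 8256 0 11 ∷ on 13 67903552 0 5 ∷ on 19 67903552 0 3 ∷ [])))
 (leaf 48680 (on 3 0 0 464 ∷ on 4 0 0 843 ∷ on 5 0 0 363 ∷ on 9 8256 0 126 ∷ on 11 67903552 0 10 ∷ on 13 67903552 0 90 ∷ on 18 67903552 0 24 ∷ on 22 67903552 0 20 ∷ on 27 67903552 0 14 ∷ []))))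
 (br
 (br
 (leaf 346326 (on 3 0 0 4530 ∷ on 4 0 0 2770 ∷ on 5 0 0 3471 ∷ on 9 8256 0 425 ∷ on 13 794688 447 189 ∷ on 14 794688 0 305 ∷ on 18 794688 0 305 ∷ on 21 794688 0 153 ∷ on 22 794688 0 119 ∷ on 27 794688 0 106 ∷ []))
 (leaf 26479 (on 3 0 0 353 ∷ on 4 0 0 221 ∷ on 5 0 0 339 ∷ on 11 67903552 0 28 ∷ on 13 67903552 49 0 ∷ on 14 67903552 0 12 ∷ on 18 67903552 0 19 ∷ on 22 67903552 0 3 ∷ on 27 67903552 0 9 ∷ on 28 67903552 0 7 ∷ [])))
 (leaf 1260 (on 3 0 0 20 ∷ on 5 0 0 27 ∷ on 9 8256 0 1 ∷ on 11 67903552 0 3 ∷ on 18 67903552 0 1 ∷ on 21 67903552 0 1 ∷ []))))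
 (leaf 154 (on 3 0 0 5 ∷ on 5 0 0 2 ∷ on 9 794688 0 1 ∷ [])))))
 (br
 (br
 (br
 (br
 (leaf 9597 (on 3 0 0 59 ∷ on 4 0 0 64 ∷ on 5 0 0 40 ∷ on 7 0 0 44 ∷ on 8 64 0 22 ∷ on 9 64 0 17 ∷ on 11 64 0 13 ∷ on 13 64 0 17 ∷ on 17 64 0 11 ∷ on 19 64 0 8 ∷ []))
 (br
 (br
 (br
 (leaf 17644 (on 4 0 0 374 ∷ on 5 0 0 72 ∷ on 9 64 0 49 ∷ on 11 8256 0 35 ∷ on 13 8256 0 22 ∷ on 17 8256 0 16 ∷ on 19 8256 0 20 ∷ on 24 8256 0 4 ∷ []))
 (br
 (leaf 1768 (on 3 0 0 13 ∷ on 4 0 0 31 ∷ on 5 0 0 11 ∷ on 9 64 0 3 ∷ on 11 8256 0 3 ∷ on 14 794688 0 1 ∷ on 17 794688 0 2 ∷ on 19 794688 0 1 ∷ on 26 1318976 0 1 ∷ []))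
 (leaf 10269 (on 3 0 0 106 ∷ on 4 0 0 174 ∷ on 5 0 0 90 ∷ on 9 64 0 4 ∷ on 13 67903552 0 18 ∷ on 17 67903552 0 12 ∷ on 26 101982272 0 6 ∷ on 27 84942912 0 3 ∷ []))))
 (leaf 1029 (on 3 0 0 5 ∷ on 4 0 0 20 ∷ on 5 0 0 8 ∷ on 9 64 0 2 ∷ on 13 794688 0 2 ∷ on 17 794688 0 1 ∷ on 24 794688 0 1 ∷ [])))
 (leaf 9597 (on 3 0 0 60 ∷ on 4 0 0 189 ∷ on 5 0 0 53 ∷ on 9 64 0 15 ∷ on 11 794688 0 16 ∷ on 13 794688 0 18 ∷ on 17 794688 0 10 ∷ on 19 794688 0 4 ∷ on 24 794688 0 1 ∷ []))))
 (br
 (br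
 (br
 (br
 (leaf 15411 (on 4 0 0 194 ∷ on 5 0 0 58 ∷ on 9 64 0 46 ∷ on 10 8256 0 57 ∷ on 11 8256 0 30 ∷ on 14 8256 0 14 ∷ on 16 8256 0 10 ∷ on 17 8256 0 13 ∷ on 21 8256 2 10 ∷ on 24 8256 0 1 ∷ []))
 (br
 (leaf 3478 (on 3 0 0 8 ∷ on 4 0 0 48 ∷ on 5 0 0 33 ∷ on 9 64 0 9 ∷ on 11 8256 0 5 ∷ on 16 794688 0 2 ∷ on 17 794688 0 4 ∷ on 21 794688 1 2 ∷ on 25 794688 0 2 ∷ []))
 (leaf 9597 (on 3 0 0 113 ∷ on 4 0 0 179 ∷ on 5 0 0 95 ∷ on 13 67903552 0 6 ∷ on 17 67903552 0 17 ∷ on 26 101982272 0 2 ∷ on 27 84942912 0 3 ∷ []))))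
 (leaf 840 (on 4 0 0 17 ∷ on 5 0 0 8 ∷ on 9 64 0 2 ∷ on 13 794688 0 1 ∷ on 17 794688 0 1 ∷ on 24 794688 0 1 ∷ [])))
 (leaf 7321 (on 3 0 0 16 ∷ on 4 0 0 153 ∷ on 5 0 0 65 ∷ on 9 64 0 12 ∷ on 11 794688 0 11 ∷ on 13 794688 0 8 ∷ on 17 794688 0 8 ∷ on 24 794688 0 4 ∷ [])))
 (leaf 8382 (on 4 0 0 164 ∷ on 5 0 0 99 ∷ on 9 64 0 10 ∷ on 11 794688 0 16 ∷ on 13 794688 0 7 ∷ on 17 794688 0 8 ∷ on 21 794688 0 2 ∷ on 24 794688 0 4 ∷ []))))
 (br
 (br
 (br
 (br
 (br
 (leaf 3721 (on 4 0 0 58 ∷ on 5 0 0 8 ∷ on 9 8256 0 20 ∷ on 10 8256 0 6 ∷ on 11 8256 0 7 ∷ on 14 8256 0 2 ∷ on 16 8256 0 2 ∷ on 19 8256 0 5 ∷ on 21 8256 1 1 ∷ []))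
 (br
 (leaf 5220 (on 4 0 0 80 ∷ on 5 0 0 22 ∷ on 9 8256 0 28 ∷ on 11 8256 0 9 ∷ on 13 794688 0 3 ∷ on 16 794688 0 4 ∷ on 19 794688 0 7 ∷ on 21 794688 2 2 ∷ []))
 (leaf 8382 (on 4 0 0 154 ∷ on 5 0 0 51 ∷ on 9 8256 0 59 ∷ on 13 67903552 0 15 ∷ on 19 67903552 0 3 ∷ on 27 84942912 0 3 ∷ on 28 67903552 0 2 ∷ []))))
 (leaf 2839 (on 3 0 0 32 ∷ on 4 0 0 57 ∷ on 5 0 0 9 ∷ on 9 8256 0 9 ∷ on 13 794688 0 6 ∷ on 17 794688 0 1 ∷ on 19 794688 0 3 ∷ [])))
 (leaf 153773 (on 3 0 0 2304 ∷ on 4 0 0 2823 ∷ on 5 0 0 816 ∷ on 9 8256 0 486 ∷ on 13 794688 0 282 ∷ on 17 794688 0 3 ∷ on 25 794688 0 82 ∷ [])))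
 (br
 (br
 (br
 (br
 (leaf 733 (on 4 0 0 12 ∷ on 5 0 0 4 ∷ on 9 8256 0 4 ∷ on 10 794688 0 2 ∷ on 11 794688 0 1 ∷ on 21 794688 0 1 ∷ []))
 (leaf 15411 (on 3 0 0 175 ∷ on 4 0 0 284 ∷ on 5 0 0 155 ∷ on 9 8256 0 12 ∷ on 13 67903552 0 9 ∷ on 17 67903552 0 24 ∷ on 22 67903552 0 1 ∷ on 27 67903552 0 5 ∷ on 28 67903552 0 1 ∷ [])))
 (leaf 598 (on 3 0 0 2 ∷ on 4 0 0 12 ∷ on 5 0 0 7 ∷ on 9 8256 0 2 ∷ on 24 101457984 0 1 ∷ [])))
 (leaf 4261 (on 3 0 0 10 ∷ on 4 0 0 88 ∷ on 5 0 0 39 ∷ on 9 8256 0 9 ∷ on 11 67903552 0 5 ∷ on 13 67903552 0 4 ∷ on 17 67903552 0 4 ∷ on 22 67903552 0 1 ∷ on 24 67903552 0 2 ∷ [])))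
 (leaf 1029 (on 4 0 0 15 ∷ on 5 0 0 18 ∷ on 9 8256 0 2 ∷ on 11 67903552 0 3 ∷ on 21 67903552 0 1 ∷ []))))
 (leaf 1260 (on 3 0 0 14 ∷ on 4 0 0 28 ∷ on 5 0 0 9 ∷ on 9 794688 0 4 ∷ on 18 794688 0 1 ∷ on 19 794688 0 1 ∷ []))))
 (leaf 1349 (on 3 0 0 10 ∷ on 4 0 0 25 ∷ on 5 0 0 12 ∷ on 9 8256 0 2 ∷ on 10 8256 0 2 ∷ on 11 8256 0 1 ∷ on 16 8256 0 1 ∷ on 17 8256 0 2 ∷ [])))))
 (br
 (br
 (br
 (br
 (br
 (leaf 12580 (on 4 0 0 105 ∷ on 5 0 0 74 ∷ on 7 0 0 100 ∷ on 9 0 0 28 ∷ on 12 0 0 9 ∷ on 13 0 0 6 ∷ on 15 0 0 8 ∷ on 17 0 0 14 ∷ on 19 0 0 4 ∷ on 22 0 0 9 ∷ on 23 0 0 2 ∷ []))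
 (br
 (leaf 15411 (on 3 0 0 51 ∷ on 4 0 0 129 ∷ on 5 0 0 110 ∷ on 7 0 0 106 ∷ on 9 0 0 32 ∷ on 11 64 0 6 ∷ on 13 64 0 14 ∷ on 15 64 0 9 ∷ on 17 64 0 14 ∷ on 22 64 0 12 ∷ on 23 64 0 2 ∷ []))
 (br
 (leaf 17644 (on 3 0 0 64 ∷ on 4 0 0 139 ∷ on 5 0 0 83 ∷ on 7 0 0 157 ∷ on 9 0 0 32 ∷ on 11 8256 0 11 ∷ on 15 8256 0 22 ∷ on 17 8256 0 16 ∷ on 22 8256 0 14 ∷ on 23 8256 0 4 ∷ []))
 (leaf 8382 (on 3 0 0 46 ∷ on 4 0 0 62 ∷ on 5 0 0 7 ∷ on 7 0 0 86 ∷ on 9 0 0 5 ∷ on 11 794688 0 22 ∷ on 15 794688 0 10 ∷ on 17 794688 2 5 ∷ on 22 1056832 0 8 ∷ on 23 794688 0 1 ∷ [])))))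
 (br
 (br
 (leaf 34708 (on 3 0 0 116 ∷ on 4 0 0 286 ∷ on 5 0 0 257 ∷ on 7 0 0 235 ∷ on 9 0 0 72 ∷ on 11 64 0 13 ∷ on 13 64 0 30 ∷ on 15 64 0 19 ∷ on 17 64 0 31 ∷ on 22 64 0 27 ∷ on 23 64 0 6 ∷ []))
 (br
 (leaf 42519 (on 3 0 0 139 ∷ on 4 0 0 355 ∷ on 5 0 0 315 ∷ on 7 0 0 293 ∷ on 9 0 0 85 ∷ on 11 8256 0 20 ∷ on 13 8256 0 34 ∷ on 15 8256 0 22 ∷ on 17 8256 0 38 ∷ on 22 8256 0 31 ∷ on 23 8256 0 9 ∷ []))
 (leaf 30315 (on 3 0 0 40 ∷ on 4 0 0 301 ∷ on 5 0 0 174 ∷ on 7 0 0 336 ∷ on 11 794688 0 76 ∷ on 17 794688 0 13 ∷ on 22 1056832 0 7 ∷ on 23 794688 0 27 ∷ []))))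
 (br
 (br
 (leaf 45495 (on 3 0 0 12 ∷ on 4 0 0 356 ∷ on 5 0 0 343 ∷ on 7 0 0 488 ∷ on 10 8256 0 41 ∷ on 11 8256 0 50 ∷ on 12 8256 0 29 ∷ on 15 8256 0 3 ∷ on 17 8256 0 27 ∷ on 22 8256 0 24 ∷ on 23 8256 0 24 ∷ []))
 (br
 (leaf 11757 (on 3 0 0 3 ∷ on 4 0 0 93 ∷ on 5 0 0 110 ∷ on 7 0 0 127 ∷ on 11 794688 0 17 ∷ on 12 794688 0 5 ∷ on 17 794688 0 7 ∷ on 22 1056832 0 5 ∷ on 23 794688 0 7 ∷ []))
 (leaf 2166 (on 3 0 0 2 ∷ on 4 0 0 18 ∷ on 5 0 0 17 ∷ on 7 0 0 26 ∷ on 11 67903552 0 6 ∷ on 23 67903552 0 2 ∷ []))))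
 (leaf 15411 (on 4 0 0 145 ∷ on 5 0 0 222 ∷ on 7 0 0 123 ∷ on 11 794688 0 34 ∷ on 13 794688 0 5 ∷ on 23 794688 0 11 ∷ [])))))
 (br
 (br
 (br
 (leaf 28332 (on 3 0 0 128 ∷ on 4 0 0 237 ∷ on 5 0 0 166 ∷ on 7 0 0 161 ∷ on 9 64 0 103 ∷ on 13 64 0 33 ∷ on 15 64 0 18 ∷ on 17 64 0 5 ∷ on 19 64 0 14 ∷ on 22 64 0 26 ∷ []))
 (br
 (br
 (br
 (leaf 10269 (on 4 0 0 81 ∷ on 5 0 0 64 ∷ on 7 0 0 72 ∷ on 9 64 0 41 ∷ on 11 8256 0 11 ∷ on 15 8256 0 7 ∷ on 19 8256 0 7 ∷ on 22 8256 0 6 ∷ on 23 8256 0 5 ∷ []))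
 (leaf 370569 (on 3 0 0 2077 ∷ on 4 0 0 2943 ∷ on 5 0 0 2492 ∷ on 7 0 0 2091 ∷ on 9 64 0 1098 ∷ on 11 8256 0 28 ∷ on 13 794688 0 485 ∷ on 15 794688 0 150 ∷ on 17 794688 0 127 ∷ on 19 794688 0 83 ∷ on 22 794688 0 373 ∷ on 29 794688 0 13 ∷ [])))
 (leaf 102465 (on 3 0 0 578 ∷ on 4 0 0 848 ∷ on 5 0 0 638 ∷ on 7 0 0 564 ∷ on 9 64 0 316 ∷ on 13 794688 0 126 ∷ on 15 794688 0 57 ∷ on 17 794688 0 29 ∷ on 19 794688 0 43 ∷ on 22 794688 0 98 ∷ [])))
 (br
 (br
 (br
 (leaf 63810 (on 4 0 0 500 ∷ on 5 0 0 458 ∷ on 7 0 0 523 ∷ on 9 64 0 180 ∷ on 11 794688 0 87 ∷ on 15 794688 0 28 ∷ on 17 794688 0 28 ∷ on 22 1056832 0 34 ∷ on 23 794688 0 44 ∷ []))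
 (br
 (leaf 134311 (on 3 0 0 759 ∷ on 4 0 0 1051 ∷ on 5 0 0 776 ∷ on 7 0 0 832 ∷ on 9 64 0 218 ∷ on 11 794688 0 193 ∷ on 15 67903552 0 47 ∷ on 17 67903552 0 120 ∷ on 18 67903552 0 11 ∷ on 22 51388480 0 89 ∷ on 23 67903552 0 6 ∷ on 25 67903552 0 68 ∷ on 26 67903552 0 4 ∷ on 29 67903552 0 18 ∷ []))
 (leaf 164537 (on 3 0 0 1107 ∷ on 4 0 0 1287 ∷ on 5 0 0 1146 ∷ on 7 0 0 1124 ∷ on 9 64 0 184 ∷ on 11 794688 0 81 ∷ on 13 5436612672 0 188 ∷ on 15 5436612672 0 25 ∷ on 17 5436612672 0 137 ∷ on 22 5420097600 0 137 ∷ on 29 5436612672 0 40 ∷ []))))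
 (leaf 230772 (on 3 0 0 1500 ∷ on 4 0 0 1996 ∷ on 5 0 0 1862 ∷ on 7 0 0 1014 ∷ on 9 64 0 503 ∷ on 13 67903552 0 369 ∷ on 14 67903552 0 43 ∷ on 17 67903552 0 135 ∷ on 22 51388480 0 250 ∷ on 25 67903552 0 34 ∷ [])))
 (br
 (leaf 201565 (on 3 0 0 1275 ∷ on 4 0 0 1577 ∷ on 5 0 0 1283 ∷ on 7 0 0 1296 ∷ on 9 64 0 415 ∷ on 11 67903552 0 52 ∷ on 13 67903552 0 257 ∷ on 15 67903552 0 51 ∷ on 22 84942912 0 336 ∷ on 29 67903552 0 25 ∷ []))
 (leaf 733 (on 3 0 0 7 ∷ on 4 0 0 9 ∷ on 7 0 0 7 ∷ on 11 5436612672 0 3 ∷ on 22 6527393856 0 1 ∷ []))))))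
 (br
 (br
 (br
 (br
 (leaf 23127 (on 4 0 0 181 ∷ on 5 0 0 69 ∷ on 7 0 0 85 ∷ on 9 64 0 104 ∷ on 10 8256 0 82 ∷ on 11 8256 0 13 ∷ on 14 8256 0 9 ∷ on 15 8256 0 19 ∷ on 21 8256 0 9 ∷ on 22 8256 0 18 ∷ on 23 8256 0 11 ∷ []))
 (br
 (leaf 59635 (on 3 0 0 214 ∷ on 4 0 0 381 ∷ on 5 0 0 497 ∷ on 7 0 0 422 ∷ on 9 64 0 181 ∷ on 11 8256 0 78 ∷ on 17 794688 0 26 ∷ on 21 794688 0 7 ∷ on 22 794688 0 26 ∷ on 23 794688 0 9 ∷ on 30 794688 0 23 ∷ on 31 794688 0 6 ∷ []))
 (br
 (leaf 59635 (on 3 0 0 282 ∷ on 4 0 0 381 ∷ on 5 0 0 497 ∷ on 7 0 0 388 ∷ on 9 64 0 181 ∷ on 11 8256 0 78 ∷ on 17 67903552 0 26 ∷ on 21 67903552 0 7 ∷ on 22 67903552 0 26 ∷ on 26 67903552 0 9 ∷ on 30 67903552 0 23 ∷ on 31 67903552 0 6 ∷ []))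
 (leaf 48680 (on 3 0 0 380 ∷ on 4 0 0 299 ∷ on 5 0 0 410 ∷ on 7 0 0 411 ∷ on 11 8256 0 29 ∷ on 13 5436612672 0 29 ∷ on 17 5436612672 0 50 ∷ on 18 5436612672 0 6 ∷ on 22 5436612672 0 25 ∷ on 29 5436612672 0 7 ∷ on 31 5436612672 0 13 ∷ [])))))
 (br
 (br
 (leaf 24746 (on 3 0 0 176 ∷ on 4 0 0 182 ∷ on 5 0 0 207 ∷ on 7 0 0 84 ∷ on 9 64 0 77 ∷ on 11 8256 0 26 ∷ on 14 794688 0 18 ∷ on 17 794688 0 9 ∷ on 22 794688 0 15 ∷ on 25 794688 2 17 ∷ on 30 794688 0 1 ∷ []))
 (leaf 302495 (on 3 0 0 1732 ∷ on 4 0 0 2476 ∷ on 5 0 0 2387 ∷ on 7 0 0 3006 ∷ on 13 67903552 0 13 ∷ on 17 67903552 0 270 ∷ on 18 67903552 0 16 ∷ on 22 67903552 0 220 ∷ on 29 67903552 0 62 ∷ on 31 67903552 0 5 ∷ on 33 67903552 0 32 ∷ on 36 67899520 0 55 ∷ [])))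
 (leaf 1443 (on 3 0 0 22 ∷ on 4 0 0 13 ∷ on 5 0 0 13 ∷ on 7 0 0 5 ∷ on 14 67903552 0 3 ∷ on 17 67903552 0 1 ∷ on 25 67903552 0 1 ∷ []))))
 (br
 (br
 (br
 (leaf 4878 (on 3 0 0 13 ∷ on 4 0 0 36 ∷ on 5 0 0 42 ∷ on 7 0 0 24 ∷ on 9 64 0 16 ∷ on 11 794688 0 9 ∷ on 17 794688 0 2 ∷ on 22 1056832 0 1 ∷ on 23 794688 0 3 ∷ on 25 794688 0 3 ∷ []))
 (br
 (leaf 48680 (on 3 0 0 74 ∷ on 4 0 0 358 ∷ on 5 0 0 417 ∷ on 7 0 0 336 ∷ on 9 64 0 171 ∷ on 17 67903552 0 9 ∷ on 22 51388480 0 53 ∷ on 23 67903552 0 21 ∷ on 25 67903552 0 5 ∷ on 30 67903552 0 2 ∷ on 31 67903552 0 2 ∷ on 33 51388480 0 13 ∷ []))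
 (leaf 39737 (on 3 0 0 236 ∷ on 4 0 0 293 ∷ on 5 0 0 337 ∷ on 7 0 0 405 ∷ on 17 5436612672 0 23 ∷ on 18 5436612672 0 4 ∷ on 22 5420097600 0 33 ∷ on 26 5436612672 0 4 ∷ on 29 5436612672 0 6 ∷ on 31 5436612672 0 2 ∷ on 33 5420097600 0 6 ∷ on 34 5436612672 0 5 ∷ []))))
 (leaf 68277 (on 3 0 0 382 ∷ on 4 0 0 534 ∷ on 5 0 0 608 ∷ on 7 0 0 666 ∷ on 17 67903552 0 37 ∷ on 22 51388480 0 68 ∷ on 25 67903552 2 16 ∷ on 33 51388480 0 7 ∷ on 36 101453952 0 13 ∷ [])))
 (br
 (br
 (br
 (leaf 3721 (on 3 0 0 4 ∷ on 4 0 0 30 ∷ on 5 0 0 30 ∷ on 7 0 0 18 ∷ on 9 64 0 12 ∷ on 11 67903552 0 7 ∷ on 22 84942912 0 3 ∷ on 23 67903552 0 3 ∷ on 25 67903552 1 1 ∷ []))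
 (leaf 16489 (on 3 0 0 50 ∷ on 4 0 0 121 ∷ on 5 0 0 147 ∷ on 7 0 0 165 ∷ on 9 64 0 18 ∷ on 22 3306168384 0 23 ∷ on 23 5436612672 0 5 ∷ on 33 3306168384 0 3 ∷ on 34 5436612672 0 2 ∷ [])))
 (leaf 3250 (on 3 0 0 27 ∷ on 4 0 0 26 ∷ on 5 0 0 29 ∷ on 7 0 0 27 ∷ on 11 67903552 0 5 ∷ on 13 5436612672 0 1 ∷ on 22 3306168384 0 2 ∷ on 25 5436612672 0 2 ∷ [])))
 (leaf 2166 (on 3 0 0 9 ∷ on 4 0 0 17 ∷ on 5 0 0 13 ∷ on 7 0 0 24 ∷ on 11 5436612672 0 6 ∷ on 22 6527393856 0 2 ∷ on 23 5436612672 0 1 ∷ [])))))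
 (br
 (br
 (leaf 125524 (on 3 0 0 681 ∷ on 4 0 0 923 ∷ on 5 0 0 2425 ∷ on 11 794688 0 23 ∷ on 14 794688 0 201 ∷ on 21 794688 0 50 ∷ on 22 794688 0 125 ∷ on 25 794688 35 0 ∷ on 30 794688 0 32 ∷ on 31 794688 0 4 ∷ []))
 (br
 (leaf 6842 (on 3 0 0 37 ∷ on 4 0 0 51 ∷ on 5 0 0 127 ∷ on 14 67903552 0 12 ∷ on 22 67903552 0 10 ∷ on 23 67903552 0 2 ∷ on 25 67903552 3 0 ∷ []))
 (leaf 9597 (on 4 0 0 113 ∷ on 5 0 0 161 ∷ on 7 0 11 0 ∷ on 11 5436612672 0 25 ∷ on 13 5436612672 0 8 ∷ on 22 5436612672 0 12 ∷ on 23 5436612672 0 4 ∷ []))))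
 (leaf 1029 (on 4 0 0 14 ∷ on 5 0 0 21 ∷ on 11 67903552 0 2 ∷ on 21 67903552 0 2 ∷ [])))))
 (br
 (br
 (br
 (leaf 20200 (on 3 0 0 125 ∷ on 4 0 0 149 ∷ on 5 0 0 139 ∷ on 7 0 0 97 ∷ on 9 8256 0 66 ∷ on 13 8256 0 33 ∷ on 15 8256 0 10 ∷ on 18 8256 0 6 ∷ on 19 8256 0 5 ∷ on 22 8256 0 20 ∷ []))
 (br
 (leaf 14402 (on 3 0 0 94 ∷ on 4 0 0 106 ∷ on 5 0 0 104 ∷ on 7 0 0 59 ∷ on 9 8256 0 45 ∷ on 14 794688 0 27 ∷ on 15 794688 0 5 ∷ on 18 794688 0 6 ∷ on 19 794688 0 3 ∷ on 22 1056832 0 15 ∷ []))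
 (br
 (leaf 39737 (on 3 0 0 267 ∷ on 4 0 0 293 ∷ on 5 0 0 318 ∷ on 7 0 0 124 ∷ on 9 8256 0 123 ∷ on 13 67903552 0 62 ∷ on 14 67903552 0 33 ∷ on 15 67903552 0 3 ∷ on 18 67903552 0 18 ∷ on 22 84942912 0 44 ∷ on 23 67903552 0 3 ∷ []))
 (br
 (leaf 3250 (on 3 0 0 18 ∷ on 4 0 0 32 ∷ on 5 0 0 23 ∷ on 7 0 0 15 ∷ on 9 8256 0 11 ∷ on 13 5436612672 0 5 ∷ on 22 6527393856 0 5 ∷ []))
 (leaf 1260 (on 3 0 0 24 ∷ on 4 0 0 15 ∷ on 7 0 8 0 ∷ on 9 8256 0 1 ∷ on 11 417753473088 0 4 ∷ on 22 556283207744 0 2 ∷ []))))))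
 (br
 (br
 (br
 (br
 (leaf 3038 (on 3 0 0 36 ∷ on 4 0 0 2 ∷ on 5 0 0 17 ∷ on 9 8256 0 18 ∷ on 10 794688 0 9 ∷ on 14 794688 0 5 ∷ on 15 794688 0 2 ∷ on 21 794688 0 1 ∷ on 22 794688 0 3 ∷ []))
 (leaf 68277 (on 3 0 0 448 ∷ on 4 0 0 503 ∷ on 5 0 0 544 ∷ on 7 0 8 287 ∷ on 9 8256 0 180 ∷ on 13 67903552 0 108 ∷ on 14 67903552 0 20 ∷ on 15 67903552 0 11 ∷ on 18 67903552 0 40 ∷ on 22 67903552 0 73 ∷ on 30 67903552 0 5 ∷ [])))
 (leaf 55734 (on 3 0 0 566 ∷ on 4 0 0 279 ∷ on 5 0 0 559 ∷ on 7 0 45 66 ∷ on 9 8256 0 172 ∷ on 14 67903552 0 131 ∷ on 18 67903552 0 32 ∷ on 22 67903552 0 60 ∷ [])))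
 (br
 (leaf 188378 (on 3 0 0 1332 ∷ on 4 0 0 1386 ∷ on 5 0 0 1942 ∷ on 7 0 211 289 ∷ on 9 8256 0 477 ∷ on 14 67903552 0 380 ∷ on 18 67903552 0 110 ∷ on 22 67903552 0 204 ∷ on 30 67903552 0 17 ∷ []))
 (br
 (leaf 10269 (on 3 0 0 76 ∷ on 4 0 0 81 ∷ on 5 0 0 91 ∷ on 7 0 21 14 ∷ on 9 8256 0 32 ∷ on 13 5436612672 0 12 ∷ on 14 5436612672 0 6 ∷ on 22 5436612672 0 17 ∷ []))
 (leaf 598 (on 3 0 0 9 ∷ on 4 0 0 2 ∷ on 5 0 0 5 ∷ on 7 0 4 0 ∷ on 11 417753473088 0 2 ∷ on 22 417753473088 0 1 ∷ [])))))
 (leaf 10987 (on 3 0 0 40 ∷ on 4 0 0 88 ∷ on 5 0 0 226 ∷ on 11 67903552 0 28 ∷ on 14 67903552 0 16 ∷ on 21 67903552 0 3 ∷ on 30 84680768 0 5 ∷ []))))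
 (leaf 10987 (on 3 0 0 293 ∷ on 5 0 0 100 ∷ on 7 0 0 17 ∷ on 9 794688 0 32 ∷ on 11 794688 0 3 ∷ on 13 794688 0 8 ∷ on 14 794688 0 8 ∷ on 18 794688 0 16 ∷ on 19 794688 0 1 ∷ [])))))
 (br
 (br
 (br
 (br
 (leaf 370569 (on 3 0 0 809 ∷ on 4 0 0 3679 ∷ on 5 0 0 1502 ∷ on 7 0 0 1748 ∷ on 8 64 0 334 ∷ on 9 64 0 1009 ∷ on 13 64 0 658 ∷ on 14 64 0 9 ∷ on 17 64 0 418 ∷ on 19 64 0 325 ∷ on 22 64 0 263 ∷ []))
 (br
 (br
 (br
 (leaf 10987 (on 3 0 0 31 ∷ on 4 0 0 110 ∷ on 5 0 0 56 ∷ on 7 0 0 53 ∷ on 9 64 0 27 ∷ on 11 8256 0 19 ∷ on 15 8256 0 2 ∷ on 17 8256 0 10 ∷ on 19 8256 0 10 ∷ on 22 8256 1 2 ∷ on 23 8256 0 1 ∷ on 25 8256 0 5 ∷ on 26 8256 0 1 ∷ []))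
 (leaf 55734 (on 3 0 0 16 ∷ on 4 0 0 628 ∷ on 5 0 0 357 ∷ on 7 0 0 516 ∷ on 9 64 0 73 ∷ on 17 794688 0 61 ∷ on 18 794688 0 9 ∷ on 19 794688 0 3 ∷ on 22 794688 0 42 ∷ on 23 794688 0 11 ∷ on 35 794688 0 16 ∷ [])))
 (leaf 52088 (on 3 0 0 63 ∷ on 4 0 0 552 ∷ on 5 0 0 378 ∷ on 7 0 0 341 ∷ on 9 64 0 96 ∷ on 11 8256 0 39 ∷ on 13 794688 0 55 ∷ on 17 794688 0 56 ∷ on 24 794688 0 49 ∷ [])))
 (br
 (leaf 68277 (on 3 0 0 358 ∷ on 4 0 0 806 ∷ on 5 0 0 414 ∷ on 7 0 0 606 ∷ on 9 64 0 19 ∷ on 13 794688 0 7 ∷ on 17 794688 0 73 ∷ on 22 1056832 0 52 ∷ on 25 794688 0 13 ∷ on 35 794688 19 0 ∷ []))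
 (leaf 6842 (on 3 0 0 7 ∷ on 4 0 0 115 ∷ on 7 0 0 66 ∷ on 9 64 0 9 ∷ on 11 67903552 0 12 ∷ on 13 67903552 0 1 ∷ on 17 67903552 0 6 ∷ on 22 84942912 0 3 ∷ on 23 67903552 0 2 ∷ on 24 67903552 0 3 ∷ [])))))
 (br
 (br
 (br
 (br
 (leaf 59635 (on 4 0 0 596 ∷ on 5 0 0 30 ∷ on 7 0 0 284 ∷ on 9 64 0 156 ∷ on 10 8256 0 317 ∷ on 11 8256 0 40 ∷ on 15 8256 0 44 ∷ on 17 8256 0 54 ∷ on 22 8256 0 36 ∷ on 23 8256 0 19 ∷ []))
 (br
 (leaf 9597 (on 3 0 0 67 ∷ on 4 0 0 76 ∷ on 5 0 0 80 ∷ on 7 0 0 41 ∷ on 9 64 0 14 ∷ on 11 8256 0 11 ∷ on 14 794688 0 3 ∷ on 17 794688 0 12 ∷ on 22 794688 0 5 ∷ on 25 794688 0 4 ∷ on 26 794688 0 3 ∷ []))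
 (leaf 52088 (on 3 0 0 250 ∷ on 4 0 0 530 ∷ on 5 0 0 400 ∷ on 7 0 0 478 ∷ on 17 67903552 0 57 ∷ on 22 67903552 0 38 ∷ on 26 84680768 0 12 ∷ on 33 67903552 0 1 ∷ on 35 67903552 0 14 ∷ []))))
 (leaf 3478 (on 3 0 0 29 ∷ on 4 0 0 36 ∷ on 5 0 0 27 ∷ on 7 0 0 26 ∷ on 17 794688 0 6 ∷ on 24 794688 0 1 ∷ on 25 794688 0 2 ∷ [])))
 (br
 (br
 (br
 (leaf 4559 (on 3 0 0 29 ∷ on 4 0 0 40 ∷ on 5 0 0 37 ∷ on 7 0 0 19 ∷ on 9 64 0 7 ∷ on 11 794688 0 7 ∷ on 14 794688 0 2 ∷ on 17 794688 0 5 ∷ on 22 1056832 0 2 ∷ on 25 794688 0 2 ∷ on 26 794688 0 1 ∷ []))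
 (leaf 164537 (on 3 0 0 788 ∷ on 4 0 0 1676 ∷ on 5 0 0 1263 ∷ on 7 0 0 1508 ∷ on 17 67903552 0 180 ∷ on 22 51388480 0 121 ∷ on 25 67903552 0 36 ∷ on 33 51388480 0 1 ∷ on 35 67903552 0 47 ∷ [])))
 (leaf 3982 (on 3 0 0 43 ∷ on 4 0 0 39 ∷ on 5 0 0 33 ∷ on 7 0 0 19 ∷ on 13 67903552 0 4 ∷ on 14 67903552 0 2 ∷ on 17 67903552 0 4 ∷ on 22 51388480 0 2 ∷ on 25 67903552 0 2 ∷ [])))
 (br
 (leaf 28332 (on 3 0 0 197 ∷ on 4 0 0 234 ∷ on 5 0 0 252 ∷ on 7 0 0 179 ∷ on 11 67903552 0 20 ∷ on 13 67903552 0 31 ∷ on 17 67903552 0 27 ∷ on 22 84942912 0 20 ∷ on 25 67903552 0 11 ∷ []))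
 (leaf 4261 (on 3 0 0 20 ∷ on 4 0 0 165 ∷ on 11 5436612672 0 8 ∷ on 17 5436612672 0 1 ∷ on 22 6527393856 0 2 ∷ on 23 5436612672 0 4 ∷ [])))))
 (br
 (br
 (leaf 28332 (on 3 0 0 127 ∷ on 4 0 0 303 ∷ on 5 0 0 392 ∷ on 7 0 0 74 ∷ on 11 794688 0 20 ∷ on 14 794688 0 31 ∷ on 17 794688 0 26 ∷ on 22 794688 0 21 ∷ on 25 794688 0 11 ∷ []))
 (br
 (leaf 8969 (on 3 0 0 41 ∷ on 4 0 0 96 ∷ on 5 0 0 124 ∷ on 7 0 0 24 ∷ on 11 67903552 0 7 ∷ on 14 67903552 0 10 ∷ on 17 67903552 0 9 ∷ on 22 67903552 0 6 ∷ on 25 67903552 0 3 ∷ []))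
 (leaf 21614 (on 4 0 0 398 ∷ on 5 0 0 361 ∷ on 11 5436612672 0 19 ∷ on 13 5436612672 0 20 ∷ on 22 5436612672 0 27 ∷ on 23 5436612672 0 9 ∷ []))))
 (leaf 785 (on 4 0 0 12 ∷ on 5 0 0 14 ∷ on 10 67903552 0 1 ∷ on 11 67903552 0 2 ∷ on 21 67903552 0 1 ∷ [])))))
 (br
 (br
 (br
 (br
 (br
 (leaf 2317 (on 4 0 0 32 ∷ on 7 0 0 7 ∷ on 9 8256 0 12 ∷ on 10 8256 0 7 ∷ on 14 8256 0 2 ∷ on 19 8256 0 3 ∷ on 22 8256 0 2 ∷ []))
 (br
 (leaf 21614 (on 3 0 0 33 ∷ on 4 0 0 269 ∷ on 5 0 0 93 ∷ on 7 0 0 66 ∷ on 9 8256 0 102 ∷ on 14 794688 0 36 ∷ on 19 794688 0 28 ∷ on 22 794688 0 20 ∷ []))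
 (br
 (leaf 5976 (on 3 0 0 58 ∷ on 4 0 0 47 ∷ on 5 0 0 29 ∷ on 7 0 0 25 ∷ on 9 8256 0 25 ∷ on 11 8256 0 1 ∷ on 14 67903552 0 1 ∷ on 19 67903552 0 8 ∷ on 22 67903552 0 2 ∷ on 26 84680768 0 1 ∷ on 27 67903552 0 1 ∷ on 29 67903552 0 2 ∷ []))
 (leaf 6842 (on 4 0 0 58 ∷ on 5 0 0 38 ∷ on 7 0 0 60 ∷ on 9 8256 0 30 ∷ on 13 5436612672 0 2 ∷ on 17 5436612672 0 8 ∷ on 26 6527131712 0 3 ∷ on 29 5436612672 0 3 ∷ [])))))
 (br
 (br
 (leaf 10269 (on 4 0 0 137 ∷ on 5 0 0 49 ∷ on 7 0 0 30 ∷ on 9 8256 0 52 ∷ on 14 794688 0 13 ∷ on 19 794688 0 14 ∷ on 22 794688 0 9 ∷ on 24 794688 0 1 ∷ []))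
 (br
 (leaf 1443 (on 3 0 0 18 ∷ on 4 0 0 13 ∷ on 5 0 0 7 ∷ on 7 0 0 7 ∷ on 9 8256 0 5 ∷ on 19 67903552 0 2 ∷ on 29 67903552 0 1 ∷ []))
 (leaf 8382 (on 3 0 0 114 ∷ on 4 0 0 70 ∷ on 5 0 0 63 ∷ on 7 0 0 29 ∷ on 9 8256 0 31 ∷ on 14 5436612672 0 16 ∷ on 26 6527131712 0 2 ∷ on 29 5436612672 0 2 ∷ []))))
 (leaf 3478 (on 3 0 0 27 ∷ on 4 0 0 37 ∷ on 5 0 0 18 ∷ on 7 0 0 12 ∷ on 9 8256 0 11 ∷ on 13 67903552 0 6 ∷ on 14 67903552 0 3 ∷ on 17 67903552 0 1 ∷ on 19 67903552 0 2 ∷ on 24 67903552 0 2 ∷ []))))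
 (br
 (br
 (br
 (leaf 5585 (on 3 0 0 27 ∷ on 4 0 0 59 ∷ on 5 0 0 30 ∷ on 7 0 0 20 ∷ on 9 8256 0 17 ∷ on 11 794688 0 8 ∷ on 14 794688 0 3 ∷ on 17 794688 0 3 ∷ on 19 794688 0 6 ∷ on 22 1056832 0 1 ∷ on 25 794688 0 3 ∷ []))
 (br
 (leaf 6842 (on 3 0 0 30 ∷ on 4 0 0 75 ∷ on 5 0 0 33 ∷ on 7 0 0 19 ∷ on 9 8256 0 28 ∷ on 11 794688 0 8 ∷ on 14 67903552 0 5 ∷ on 19 67903552 0 9 ∷ on 22 51388480 0 3 ∷ on 25 67903552 0 1 ∷ on 27 67903552 0 2 ∷ []))
 (br
 (leaf 34708 (on 3 0 0 255 ∷ on 4 0 0 272 ∷ on 5 0 0 232 ∷ on 7 0 0 98 ∷ on 9 8256 0 123 ∷ on 11 794688 0 19 ∷ on 14 5436612672 0 23 ∷ on 17 5436612672 0 12 ∷ on 19 5436612672 0 25 ∷ on 22 5420097600 0 22 ∷ on 26 6527131712 0 14 ∷ on 27 5436612672 0 6 ∷ on 29 5436612672 0 5 ∷ []))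
 (br
 (leaf 6395 (on 3 0 0 103 ∷ on 4 0 0 50 ∷ on 5 0 0 57 ∷ on 7 0 0 3 ∷ on 9 8256 0 17 ∷ on 14 417753473088 0 10 ∷ on 19 417753473088 0 1 ∷ on 27 555192426560 0 7 ∷ on 28 555192426560 0 1 ∷ []))
 (leaf 2480 (on 3 0 0 13 ∷ on 4 0 0 20 ∷ on 5 0 0 23 ∷ on 7 0 0 11 ∷ on 13 31204079050816 0 4 ∷ on 14 35602125561920 0 1 ∷ on 17 35602125561920 0 2 ∷ on 18 35602125561920 0 2 ∷ on 26 44536748056640 0 3 ∷ []))))))
 (br
 (br
 (leaf 3250 (on 3 0 0 40 ∷ on 4 0 0 38 ∷ on 5 0 0 18 ∷ on 7 0 0 4 ∷ on 9 8256 0 12 ∷ on 14 67903552 0 5 ∷ on 19 67903552 0 2 ∷ on 22 51388480 0 1 ∷ on 25 67903552 0 2 ∷ []))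
 (br
 (leaf 2480 (on 3 0 0 33 ∷ on 4 0 0 30 ∷ on 5 0 0 12 ∷ on 7 0 0 7 ∷ on 9 8256 0 4 ∷ on 14 5436612672 0 2 ∷ on 17 5436612672 0 2 ∷ on 19 5436612672 0 2 ∷ on 26 5436612672 0 1 ∷ on 27 5436612672 0 1 ∷ []))
 (leaf 2317 (on 3 0 0 35 ∷ on 4 0 0 21 ∷ on 5 0 0 20 ∷ on 7 0 0 6 ∷ on 14 417753473088 0 5 ∷ on 17 417753473088 0 2 ∷ on 26 417753473088 0 2 ∷ []))))
 (leaf 898 (on 3 0 0 8 ∷ on 4 0 0 24 ∷ on 9 8256 0 3 ∷ on 13 5436612672 0 2 ∷ on 24 6510354496 0 1 ∷ []))))
 (br
 (br
 (br
 (leaf 1768 (on 3 0 0 13 ∷ on 4 0 0 15 ∷ on 5 0 0 15 ∷ on 9 8256 0 8 ∷ on 11 67903552 0 1 ∷ on 14 67903552 0 3 ∷ on 22 84942912 0 2 ∷ on 25 67903552 0 1 ∷ []))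
 (br
 (leaf 9597 (on 3 0 0 57 ∷ on 4 0 0 89 ∷ on 5 0 0 71 ∷ on 7 0 0 14 ∷ on 9 8256 0 31 ∷ on 11 67903552 0 9 ∷ on 14 5436612672 0 9 ∷ on 17 5436612672 0 5 ∷ on 22 3306168384 0 11 ∷ on 25 5436612672 0 4 ∷ on 26 5436612672 0 3 ∷ []))
 (br
 (leaf 5585 (on 3 0 0 44 ∷ on 4 0 0 45 ∷ on 5 0 0 49 ∷ on 7 0 0 24 ∷ on 11 67903552 0 10 ∷ on 17 417753473088 0 4 ∷ on 18 417753473088 0 4 ∷ on 22 415623028800 0 1 ∷ on 26 417753473088 0 4 ∷ on 27 417753473088 1 1 ∷ []))
 (leaf 7834 (on 3 0 0 121 ∷ on 4 0 0 66 ∷ on 5 0 0 74 ∷ on 7 0 0 29 ∷ on 13 31204079050816 0 8 ∷ on 14 35602125561920 0 7 ∷ on 17 35602125561920 0 3 ∷ on 26 35602125561920 0 7 ∷ [])))))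
 (leaf 2839 (on 3 0 0 54 ∷ on 4 0 0 76 ∷ on 13 5436612672 0 3 ∷ on 14 5436612672 0 2 ∷ on 17 5436612672 0 2 ∷ on 25 5436612672 0 2 ∷ [])))
 (leaf 3982 (on 3 0 0 31 ∷ on 4 0 0 102 ∷ on 9 8256 0 13 ∷ on 13 5436612672 0 7 ∷ on 22 6527393856 0 7 ∷ [])))))
 (br
 (br
 (br
 (br
 (leaf 3038 (on 3 0 0 5 ∷ on 4 0 0 42 ∷ on 5 0 0 9 ∷ on 9 8256 0 14 ∷ on 10 794688 0 12 ∷ on 14 794688 0 4 ∷ on 21 794688 0 2 ∷ on 22 794688 0 3 ∷ []))
 (br
 (leaf 11757 (on 3 0 0 50 ∷ on 4 0 0 93 ∷ on 5 0 0 126 ∷ on 9 8256 0 55 ∷ on 11 794688 0 8 ∷ on 14 67903552 0 14 ∷ on 17 67903552 0 1 ∷ on 21 67903552 0 5 ∷ on 22 67903552 0 9 ∷ on 27 67903552 0 3 ∷ on 30 67903552 0 4 ∷ []))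
 (br
 (leaf 17644 (on 3 0 0 77 ∷ on 4 0 0 138 ∷ on 5 0 0 187 ∷ on 7 0 0 13 ∷ on 9 8256 0 72 ∷ on 11 794688 0 16 ∷ on 14 5436612672 0 16 ∷ on 17 5436612672 0 5 ∷ on 21 5436612672 0 6 ∷ on 22 5436612672 0 12 ∷ on 27 5436612672 0 6 ∷ on 30 5436612672 0 6 ∷ []))
 (leaf 10269 (on 3 0 0 114 ∷ on 4 0 0 86 ∷ on 5 0 0 171 ∷ on 7 0 0 25 ∷ on 14 417753473088 0 11 ∷ on 27 555192426560 0 6 ∷ on 29 417753473088 0 4 ∷ on 33 417753473088 0 1 ∷ [])))))
 (br
 (br
 (leaf 3721 (on 3 0 0 43 ∷ on 4 0 0 45 ∷ on 5 0 0 35 ∷ on 9 8256 0 13 ∷ on 21 67903552 0 4 ∷ on 25 67903552 0 3 ∷ on 27 67903552 0 1 ∷ []))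
 (br
 (leaf 2317 (on 3 0 0 38 ∷ on 4 0 0 19 ∷ on 5 0 0 24 ∷ on 7 0 0 3 ∷ on 9 8256 0 3 ∷ on 14 5436612672 0 1 ∷ on 17 5436612672 0 2 ∷ on 27 5436612672 0 2 ∷ on 28 5436612672 0 1 ∷ []))
 (leaf 1029 (on 3 0 0 15 ∷ on 4 0 0 10 ∷ on 5 0 0 16 ∷ on 14 417753473088 0 2 ∷ on 27 417753473088 0 1 ∷ []))))
 (leaf 1652 (on 3 0 0 6 ∷ on 4 0 0 24 ∷ on 5 0 0 19 ∷ on 9 8256 0 6 ∷ on 14 5436612672 0 3 ∷ on 24 6510354496 0 2 ∷ []))))
 (br
 (br
 (br
 (leaf 1544 (on 3 0 0 11 ∷ on 4 0 0 12 ∷ on 5 0 0 14 ∷ on 9 8256 0 7 ∷ on 11 67903552 0 1 ∷ on 14 67903552 0 2 ∷ on 22 67903552 0 2 ∷ on 25 67903552 0 1 ∷ []))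
 (br
 (leaf 5585 (on 3 0 0 40 ∷ on 4 0 0 44 ∷ on 5 0 0 59 ∷ on 9 8256 0 23 ∷ on 14 5436612672 0 5 ∷ on 17 5436612672 0 2 ∷ on 22 5436612672 0 7 ∷ on 27 5436612672 0 2 ∷ on 28 5436612672 0 2 ∷ []))
 (br
 (leaf 4261 (on 3 0 0 50 ∷ on 4 0 0 36 ∷ on 5 0 0 45 ∷ on 7 0 0 10 ∷ on 9 8256 0 2 ∷ on 11 67903552 0 5 ∷ on 17 417753473088 0 4 ∷ on 26 417753473088 1 0 ∷ on 27 417753473088 0 3 ∷ on 28 417753473088 0 2 ∷ []))
 (leaf 1652 (on 3 0 0 22 ∷ on 4 0 0 17 ∷ on 5 0 0 25 ∷ on 14 35602125561920 0 3 ∷ on 27 35602125561920 0 2 ∷ [])))))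
 (leaf 5976 (on 3 0 0 75 ∷ on 4 0 0 76 ∷ on 5 0 0 76 ∷ on 14 5436612672 0 11 ∷ on 17 5436612672 0 3 ∷ on 22 5436612672 0 1 ∷ on 25 5436612672 0 5 ∷ [])))
 (br
 (br
 (br
 (leaf 188378 (on 3 0 0 304 ∷ on 4 0 0 2550 ∷ on 5 0 0 2093 ∷ on 9 8256 0 876 ∷ on 14 5436612672 0 228 ∷ on 22 5436612672 0 314 ∷ []))
 (br
 (leaf 1443 (on 3 0 0 11 ∷ on 4 0 0 11 ∷ on 5 0 0 20 ∷ on 11 5436612672 0 2 ∷ on 14 417753473088 0 1 ∷ on 22 417753473088 0 2 ∷ on 26 417753473088 0 1 ∷ on 27 417753473088 1 0 ∷ []))
 (leaf 2166 (on 3 0 0 23 ∷ on 4 0 0 19 ∷ on 5 0 0 37 ∷ on 14 35602125561920 0 4 ∷ on 22 35602125561920 0 1 ∷ on 26 35602125561920 1 0 ∷ on 27 35602125561920 0 1 ∷ []))))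
 (leaf 456 (on 3 0 0 5 ∷ on 4 0 0 17 ∷ on 22 417753473088 0 1 ∷ [])))
 (leaf 399 (on 3 0 0 5 ∷ on 4 0 0 14 ∷ on 22 417753473088 0 1 ∷ [])))))
 (leaf 15411 (on 3 0 0 16 ∷ on 4 0 0 223 ∷ on 5 0 0 299 ∷ on 11 67903552 0 33 ∷ on 21 67903552 0 18 ∷ on 25 67903552 0 5 ∷ []))))
 (br
 (br
 (br
 (br
 (br
 (leaf 1892 (on 3 0 0 3 ∷ on 4 0 0 24 ∷ on 5 0 0 3 ∷ on 9 794688 0 13 ∷ on 10 794688 0 4 ∷ on 14 794688 0 2 ∷ on 19 794688 0 3 ∷ on 21 794688 0 1 ∷ on 22 794688 1 0 ∷ []))
 (leaf 8969 (on 4 0 0 90 ∷ on 5 0 0 90 ∷ on 7 0 0 39 ∷ on 9 794688 0 40 ∷ on 13 67903552 0 5 ∷ on 14 67903552 0 2 ∷ on 18 67903552 0 9 ∷ on 22 67903552 0 2 ∷ on 29 67903552 0 5 ∷ [])))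
 (leaf 733 (on 3 0 0 8 ∷ on 4 0 0 9 ∷ on 5 0 0 4 ∷ on 7 0 0 2 ∷ on 9 794688 0 3 ∷ on 14 67903552 0 1 ∷ on 19 67903552 0 1 ∷ [])))
 (br
 (br
 (br
 (leaf 2024 (on 3 0 0 3 ∷ on 4 0 0 26 ∷ on 5 0 0 11 ∷ on 9 794688 0 14 ∷ on 14 67903552 0 1 ∷ on 19 67903552 0 3 ∷ on 21 67903552 0 1 ∷ on 22 67903552 2 0 ∷ []))
 (leaf 37138 (on 3 0 0 200 ∷ on 4 0 0 444 ∷ on 5 0 0 373 ∷ on 7 0 0 64 ∷ on 9 794688 0 85 ∷ on 14 5436612672 0 66 ∷ on 18 5436612672 0 32 ∷ on 22 5436612672 0 30 ∷ on 27 5436612672 0 5 ∷ [])))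
 (leaf 2839 (on 3 0 0 32 ∷ on 4 0 0 49 ∷ on 5 0 0 18 ∷ on 9 794688 0 12 ∷ on 14 5436612672 0 4 ∷ on 19 5436612672 0 3 ∷ [])))
 (br
 (br
 (br
 (leaf 961 (on 4 0 0 14 ∷ on 5 0 0 9 ∷ on 9 794688 0 5 ∷ on 14 5436612672 0 1 ∷ on 22 5436612672 0 2 ∷ []))
 (leaf 32437 (on 3 0 0 175 ∷ on 4 0 0 501 ∷ on 5 0 0 324 ∷ on 9 794688 0 74 ∷ on 13 417753473088 0 18 ∷ on 14 417753473088 0 41 ∷ on 18 417753473088 0 28 ∷ on 22 417753473088 0 26 ∷ on 27 417753473088 0 4 ∷ [])))
 (leaf 523 (on 3 0 0 5 ∷ on 4 0 0 18 ∷ on 9 794688 0 1 ∷ on 22 417753473088 0 1 ∷ [])))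
 (leaf 373 (on 3 0 0 2 ∷ on 4 0 0 12 ∷ on 9 794688 0 1 ∷ on 22 417753473088 0 1 ∷ [])))))
 (br
 (br
 (leaf 3478 (on 3 0 0 12 ∷ on 4 0 0 46 ∷ on 5 0 0 41 ∷ on 9 794688 0 11 ∷ on 14 67903552 0 6 ∷ on 18 67903552 0 2 ∷ on 21 67903552 0 1 ∷ on 22 67903552 0 3 ∷ []))
 (leaf 28332 (on 3 0 0 268 ∷ on 4 0 0 526 ∷ on 5 0 0 368 ∷ on 9 794688 0 9 ∷ on 18 5436612672 0 41 ∷ on 22 5436612672 0 6 ∷ on 27 5436612672 0 8 ∷ on 28 5436612672 0 5 ∷ [])))
 (leaf 785 (on 4 0 0 12 ∷ on 5 0 0 14 ∷ on 9 794688 0 1 ∷ on 11 5436612672 0 2 ∷ on 21 5436612672 0 1 ∷ []))))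
 (leaf 103 (on 3 0 0 3 ∷ on 5 0 0 1 ∷ on 9 67903552 0 1 ∷ [])))))
 (br
 (br
 (br
 (br
 (leaf 10269 (on 4 0 0 117 ∷ on 5 0 0 54 ∷ on 8 8256 0 70 ∷ on 9 8256 0 25 ∷ on 14 8256 0 6 ∷ on 17 8256 0 19 ∷ on 19 8256 9 1 ∷ on 24 8256 0 4 ∷ []))
 (leaf 14402 (on 4 0 0 403 ∷ on 5 0 0 68 ∷ on 9 8256 0 16 ∷ on 17 794688 0 25 ∷ on 18 794688 0 9 ∷ on 19 794688 7 0 ∷ on 22 1056832 0 2 ∷ on 24 794688 0 7 ∷ on 25 794688 0 4 ∷ [])))
 (leaf 2653 (on 3 0 0 15 ∷ on 4 0 0 59 ∷ on 5 0 0 25 ∷ on 9 8256 0 3 ∷ on 17 794688 0 5 ∷ on 24 794688 0 1 ∷ on 25 794688 0 1 ∷ [])))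
 (br
 (br
 (br
 (leaf 24746 (on 4 0 0 492 ∷ on 5 0 0 130 ∷ on 9 794688 0 172 ∷ on 14 794688 0 23 ∷ on 19 794688 0 36 ∷ on 21 794688 6 0 ∷ []))
 (leaf 5976 (on 4 0 0 167 ∷ on 5 0 0 26 ∷ on 9 794688 0 19 ∷ on 17 67903552 0 6 ∷ on 18 67903552 0 1 ∷ on 19 67903552 5 0 ∷ on 22 67903552 0 5 ∷ [])))
 (leaf 1349 (on 3 0 0 2 ∷ on 4 0 0 30 ∷ on 5 0 0 15 ∷ on 9 794688 0 4 ∷ on 11 67903552 0 1 ∷ on 17 67903552 0 1 ∷ on 24 67903552 0 1 ∷ [])))
 (leaf 961 (on 3 0 0 10 ∷ on 4 0 0 20 ∷ on 5 0 0 7 ∷ on 9 67903552 0 3 ∷ on 18 67903552 0 1 ∷ on 19 67903552 0 1 ∷ []))))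
 (leaf 559 (on 4 0 0 15 ∷ on 5 0 3 0 ∷ on 9 794688 0 2 ∷ on 16 794688 0 1 ∷ on 17 794688 0 1 ∷ [])))))
 (br
 (br
 (br
 (br
 (leaf 1544 (on 3 0 0 14 ∷ on 4 0 0 11 ∷ on 7 64 0 15 ∷ on 9 64 0 2 ∷ on 11 64 0 3 ∷ on 15 64 0 3 ∷ on 17 64 0 1 ∷ on 21 64 0 1 ∷ []))
 (leaf 16489 (on 3 0 0 66 ∷ on 4 0 0 129 ∷ on 5 0 0 142 ∷ on 7 64 0 136 ∷ on 10 8256 0 3 ∷ on 11 8256 0 35 ∷ on 14 8256 0 16 ∷ on 15 8256 0 3 ∷ on 17 8256 0 15 ∷ on 23 8256 0 5 ∷ [])))
 (br
 (br
 (leaf 8969 (on 3 0 0 80 ∷ on 4 0 0 66 ∷ on 7 64 0 82 ∷ on 9 8256 0 10 ∷ on 11 8256 0 17 ∷ on 15 8256 0 16 ∷ on 17 8256 0 8 ∷ on 19 8256 0 4 ∷ on 21 8256 0 3 ∷ []))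
 (br
 (leaf 18879 (on 3 0 0 149 ∷ on 4 0 0 111 ∷ on 5 0 0 87 ∷ on 7 64 0 198 ∷ on 11 794688 0 36 ∷ on 14 794688 0 7 ∷ on 15 794688 0 12 ∷ on 21 794688 0 29 ∷ []))
 (leaf 3250 (on 3 0 0 19 ∷ on 4 0 0 32 ∷ on 5 0 0 21 ∷ on 7 64 0 16 ∷ on 10 67903552 0 4 ∷ on 11 67903552 0 7 ∷ on 14 67903552 0 5 ∷ on 21 84680768 0 5 ∷ []))))
 (br
 (br
 (leaf 45495 (on 3 0 0 646 ∷ on 4 0 0 506 ∷ on 7 64 0 214 ∷ on 9 794688 0 104 ∷ on 11 794688 0 13 ∷ on 14 794688 0 92 ∷ on 15 794688 0 21 ∷ on 18 794688 0 20 ∷ on 19 794688 0 27 ∷ on 21 794688 0 28 ∷ []))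
 (br
 (br
 (leaf 1349 (on 3 0 0 7 ∷ on 4 0 0 11 ∷ on 5 0 0 9 ∷ on 7 64 0 8 ∷ on 9 794688 0 5 ∷ on 14 67903552 0 1 ∷ on 15 67903552 0 1 ∷ on 21 84680768 0 1 ∷ on 22 67903552 0 1 ∷ []))
 (leaf 1260 (on 3 0 0 13 ∷ on 4 0 0 16 ∷ on 5 0 0 5 ∷ on 7 64 0 10 ∷ on 14 5436612672 0 2 ∷ on 22 6510354496 0 2 ∷ [])))
 (leaf 1443 (on 3 0 0 14 ∷ on 4 0 0 6 ∷ on 5 0 0 18 ∷ on 7 64 9 0 ∷ on 11 5436612672 0 3 ∷ on 21 6527131712 0 3 ∷ []))))
 (leaf 1768 (on 3 0 0 46 ∷ on 5 0 0 15 ∷ on 7 64 1 0 ∷ on 9 67903552 0 10 ∷ on 14 67903552 0 5 ∷ [])))))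
 (br
 (br
 (br
 (leaf 5976 (on 3 0 0 45 ∷ on 4 0 0 94 ∷ on 7 64 0 34 ∷ on 9 8256 0 9 ∷ on 11 8256 0 3 ∷ on 14 8256 0 11 ∷ on 17 8256 0 6 ∷ on 19 8256 0 4 ∷ on 22 8256 0 3 ∷ []))
 (br
 (leaf 10987 (on 3 0 0 78 ∷ on 4 0 0 173 ∷ on 7 64 0 66 ∷ on 9 8256 0 16 ∷ on 11 794688 0 6 ∷ on 14 794688 0 20 ∷ on 17 794688 0 10 ∷ on 21 794688 0 6 ∷ on 22 794688 0 7 ∷ []))
 (leaf 42519 (on 3 0 0 228 ∷ on 4 0 0 478 ∷ on 5 0 0 387 ∷ on 7 64 0 161 ∷ on 11 67903552 0 81 ∷ on 14 67903552 0 59 ∷ on 17 67903552 0 38 ∷ on 21 84680768 0 33 ∷ on 25 67903552 0 8 ∷ []))))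
 (br
 (br
 (br
 (leaf 1101 (on 4 0 0 15 ∷ on 5 0 0 3 ∷ on 7 64 0 5 ∷ on 9 794688 0 4 ∷ on 14 794688 0 2 ∷ on 17 794688 0 1 ∷ on 19 794688 0 1 ∷ on 22 794688 0 1 ∷ []))
 (leaf 1544 (on 3 0 0 15 ∷ on 4 0 0 25 ∷ on 7 64 0 9 ∷ on 9 794688 0 4 ∷ on 14 67903552 0 3 ∷ on 22 84680768 0 2 ∷ [])))
 (br
 (br
 (leaf 8382 (on 4 0 0 117 ∷ on 5 0 0 23 ∷ on 7 64 0 37 ∷ on 9 794688 0 26 ∷ on 14 67903552 0 16 ∷ on 17 67903552 0 7 ∷ on 21 84680768 6 4 ∷ on 22 67903552 0 7 ∷ []))
 (leaf 1260 (on 3 0 0 12 ∷ on 4 0 0 23 ∷ on 7 64 0 5 ∷ on 9 794688 0 4 ∷ on 14 5436612672 0 2 ∷ on 22 6510354496 0 2 ∷ [])))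
 (leaf 559 (on 4 0 0 14 ∷ on 5 0 0 4 ∷ on 10 5436612672 0 1 ∷ on 21 6527131712 1 1 ∷ []))))
 (br
 (br
 (leaf 2317 (on 3 0 0 32 ∷ on 4 0 0 33 ∷ on 7 64 0 5 ∷ on 9 67903552 0 8 ∷ on 14 67903552 0 7 ∷ on 19 67903552 0 1 ∷ on 21 67903552 0 2 ∷ []))
 (leaf 1892 (on 3 0 0 19 ∷ on 4 0 0 34 ∷ on 5 0 0 17 ∷ on 9 67903552 0 6 ∷ on 14 5436612672 0 1 ∷ on 18 5436612672 0 1 ∷ on 21 5436612672 0 2 ∷ [])))
 (leaf 103 (on 3 0 0 3 ∷ on 5 0 0 1 ∷ on 9 5436612672 0 1 ∷ [])))))
 (leaf 134311 (on 4 0 0 3757 ∷ on 5 0 930 0 ∷ on 9 794688 0 439 ∷ on 14 794688 0 30 ∷ on 17 794688 0 247 ∷ on 21 794688 54 0 ∷ []))))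
 (br
 (br
 (leaf 6842 (on 3 0 0 82 ∷ on 4 0 0 58 ∷ on 5 0 0 20 ∷ on 7 8256 0 43 ∷ on 9 8256 12 0 ∷ on 10 8256 0 12 ∷ on 14 8256 0 20 ∷ on 15 8256 0 5 ∷ []))
 (br
 (leaf 42519 (on 3 0 0 625 ∷ on 4 0 0 540 ∷ on 7 8256 0 171 ∷ on 9 794688 0 54 ∷ on 10 794688 0 129 ∷ on 14 794688 0 92 ∷ on 17 794688 0 39 ∷ []))
 (leaf 785 (on 4 0 0 29 ∷ on 9 67903552 0 3 ∷ on 17 67903552 0 1 ∷ on 21 67903552 1 0 ∷ []))))
 (leaf 304 (on 4 0 0 5 ∷ on 7 794688 1 3 ∷ on 9 794688 1 0 ∷ on 14 794688 0 1 ∷ []))))))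
 (br
 (br
 (br
 (br
 (br
 (leaf 5585 (on 2 0 0 62 ∷ on 5 0 0 14 ∷ on 6 0 0 46 ∷ on 7 0 0 26 ∷ on 8 0 0 8 ∷ on 13 0 0 16 ∷ on 15 0 0 5 ∷ on 17 0 0 1 ∷ on 18 0 0 3 ∷ on 19 0 0 4 ∷ on 20 0 0 1 ∷ []))
 (br
 (leaf 102465 (on 2 0 0 1702 ∷ on 5 0 0 531 ∷ on 6 0 0 764 ∷ on 7 0 0 388 ∷ on 13 64 0 269 ∷ on 14 64 0 34 ∷ on 15 64 0 32 ∷ on 18 64 0 91 ∷ on 19 64 0 64 ∷ on 20 64 0 16 ∷ on 25 64 0 11 ∷ []))
 (leaf 176055 (on 2 0 0 2494 ∷ on 5 0 0 1467 ∷ on 6 0 0 1355 ∷ on 7 0 0 839 ∷ on 13 8256 0 529 ∷ on 20 12352 0 113 ∷ on 25 8256 0 18 ∷ on 30 12352 0 2 ∷ on 31 8256 0 27 ∷ []))))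
 (br
 (br
 (br
 (leaf 32437 (on 2 0 0 498 ∷ on 3 0 0 329 ∷ on 5 0 0 128 ∷ on 7 0 0 134 ∷ on 9 64 0 100 ∷ on 13 64 0 60 ∷ on 15 64 0 25 ∷ on 18 64 0 11 ∷ on 19 64 0 28 ∷ on 21 64 0 6 ∷ on 22 64 0 10 ∷ []))
 (br
 (leaf 10269 (on 2 0 0 149 ∷ on 3 0 0 148 ∷ on 5 0 0 61 ∷ on 7 0 0 47 ∷ on 13 8256 0 19 ∷ on 15 8256 0 3 ∷ on 18 8256 0 11 ∷ on 19 8256 0 7 ∷ on 25 8256 0 4 ∷ on 31 8256 0 1 ∷ []))
 (leaf 55734 (on 2 0 0 928 ∷ on 3 0 0 912 ∷ on 5 0 0 265 ∷ on 7 0 0 241 ∷ on 13 794688 0 133 ∷ on 15 794688 17 0 ∷ on 18 794688 0 56 ∷ on 19 794688 0 35 ∷ on 25 794688 0 11 ∷ on 29 794688 2 0 ∷ []))))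
 (br
 (br
 (br
 (br
 (leaf 30315 (on 2 0 0 193 ∷ on 3 0 0 520 ∷ on 5 0 0 253 ∷ on 7 0 0 144 ∷ on 13 8256 0 14 ∷ on 18 8256 0 41 ∷ on 19 8256 0 7 ∷ on 22 8256 0 4 ∷ on 25 8256 0 16 ∷ on 27 8256 0 12 ∷ on 30 12352 0 1 ∷ on 31 8256 0 7 ∷ []))
 (leaf 21614 (on 2 0 0 135 ∷ on 3 0 0 373 ∷ on 5 0 0 181 ∷ on 7 0 0 103 ∷ on 13 794688 0 40 ∷ on 18 794688 0 29 ∷ on 19 794688 0 4 ∷ on 22 794688 0 3 ∷ on 27 794688 0 5 ∷ on 30 536640 0 1 ∷ on 31 794688 0 5 ∷ [])))
 (leaf 7321 (on 2 0 0 117 ∷ on 3 0 0 108 ∷ on 5 0 0 42 ∷ on 7 0 0 27 ∷ on 13 794688 0 21 ∷ on 14 794688 0 3 ∷ on 15 794688 0 2 ∷ on 18 794688 0 7 ∷ on 19 794688 0 4 ∷ on 20 536640 0 1 ∷ [])))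
 (br
 (leaf 45495 (on 2 0 0 669 ∷ on 3 0 0 492 ∷ on 5 0 0 384 ∷ on 7 0 0 215 ∷ on 13 794688 0 84 ∷ on 18 794688 0 53 ∷ on 22 794688 0 23 ∷ on 25 794688 0 14 ∷ on 30 536640 0 6 ∷ on 31 794688 0 3 ∷ []))
 (leaf 1022413 (on 2 0 0 5418 ∷ on 3 0 0 24650 ∷ on 5 0 0 8521 ∷ on 7 0 0 1937 ∷ on 13 67903552 0 2080 ∷ on 14 67903552 0 978 ∷ on 18 67903552 0 858 ∷ on 25 67903552 0 598 ∷ on 27 67903552 0 3 ∷ on 30 67645504 101 0 ∷ []))))
 (br
 (br
 (leaf 8382 (on 2 0 0 35 ∷ on 3 0 0 158 ∷ on 5 0 0 70 ∷ on 7 0 0 40 ∷ on 13 794688 0 16 ∷ on 20 1060928 0 13 ∷ on 22 794688 0 1 ∷ on 25 794688 0 2 ∷ on 31 1056832 0 2 ∷ []))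
 (leaf 102465 (on 3 0 0 2620 ∷ on 5 0 0 854 ∷ on 7 0 0 204 ∷ on 13 67903552 0 229 ∷ on 14 67903552 0 95 ∷ on 18 67903552 0 118 ∷ on 20 34615360 0 31 ∷ on 25 67903552 0 33 ∷ on 27 67903552 0 1 ∷ on 31 51388480 5 0 ∷ [])))
 (leaf 3478 (on 3 0 0 83 ∷ on 5 0 0 34 ∷ on 7 0 0 3 ∷ on 10 67903552 0 2 ∷ on 13 67903552 2 8 ∷ on 14 67903552 0 4 ∷ on 20 84947008 0 4 ∷ on 21 67903552 0 1 ∷ [])))))
 (leaf 3721 (on 3 0 0 94 ∷ on 5 0 0 23 ∷ on 7 0 0 10 ∷ on 9 8256 0 3 ∷ on 10 8256 0 4 ∷ on 13 8256 0 9 ∷ on 14 8256 0 2 ∷ on 18 8256 0 5 ∷ on 19 8256 0 1 ∷ []))))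
 (br
 (br
 (br
 (br
 (leaf 21614 (on 3 0 0 278 ∷ on 5 0 0 83 ∷ on 7 0 0 85 ∷ on 8 64 0 124 ∷ on 9 64 0 18 ∷ on 13 64 0 40 ∷ on 17 64 0 21 ∷ on 18 64 0 4 ∷ on 19 64 0 19 ∷ on 25 64 0 7 ∷ []))
 (br
 (br
 (br
 (leaf 26479 (on 2 0 0 442 ∷ on 3 0 0 374 ∷ on 5 0 0 152 ∷ on 7 0 0 122 ∷ on 9 64 0 15 ∷ on 13 8256 0 21 ∷ on 17 8256 0 26 ∷ on 18 8256 0 2 ∷ on 19 8256 0 17 ∷ on 25 8256 0 13 ∷ on 26 8256 0 6 ∷ on 29 8256 0 5 ∷ []))
 (leaf 125524 (on 2 0 0 2461 ∷ on 3 0 0 1580 ∷ on 5 0 0 697 ∷ on 7 0 0 597 ∷ on 13 794688 0 230 ∷ on 17 794688 0 89 ∷ on 18 794688 0 46 ∷ on 19 794688 0 79 ∷ on 25 794688 0 44 ∷ on 33 540736 0 20 ∷ [])))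
 (leaf 7321 (on 2 0 0 224 ∷ on 3 0 0 118 ∷ on 7 0 0 31 ∷ on 13 794688 0 21 ∷ on 14 794688 0 2 ∷ on 17 794688 0 2 ∷ on 18 794688 0 4 ∷ on 19 794688 0 5 ∷ on 24 794688 0 1 ∷ [])))
 (leaf 18879 (on 2 0 0 579 ∷ on 3 0 0 339 ∷ on 7 0 0 82 ∷ on 13 794688 0 35 ∷ on 18 794688 0 15 ∷ on 19 794688 0 12 ∷ on 22 794688 0 1 ∷ on 25 794688 0 8 ∷ on 27 794688 0 2 ∷ []))))
 (br
 (br
 (br
 (br
 (leaf 424265 (on 2 0 0 7071 ∷ on 3 0 0 5467 ∷ on 5 0 0 2924 ∷ on 7 0 0 2021 ∷ on 13 8256 0 151 ∷ on 17 8256 0 364 ∷ on 18 8256 0 90 ∷ on 19 8256 0 191 ∷ on 25 8256 66 174 ∷ on 26 8256 0 152 ∷ on 27 8256 0 24 ∷ on 30 12352 0 53 ∷ on 33 8256 0 83 ∷ []))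
 (br
 (leaf 134311 (on 2 0 0 2239 ∷ on 3 0 0 1730 ∷ on 5 0 0 926 ∷ on 7 0 0 640 ∷ on 13 794688 0 48 ∷ on 17 794688 0 123 ∷ on 18 794688 0 21 ∷ on 19 794688 0 61 ∷ on 25 794688 12 63 ∷ on 26 794688 0 48 ∷ on 27 794688 8 0 ∷ on 30 536640 0 17 ∷ on 33 794688 0 26 ∷ []))
 (leaf 95762 (on 2 0 0 1493 ∷ on 3 0 0 1413 ∷ on 5 0 0 792 ∷ on 7 0 0 336 ∷ on 13 67903552 0 176 ∷ on 14 67903552 0 34 ∷ on 18 67903552 0 80 ∷ on 21 67903552 0 13 ∷ on 26 118235200 0 56 ∷ on 30 67645504 0 15 ∷ []))))
 (leaf 6395 (on 2 0 0 112 ∷ on 3 0 0 73 ∷ on 5 0 0 49 ∷ on 7 0 0 29 ∷ on 13 794688 0 12 ∷ on 17 794688 0 4 ∷ on 18 794688 0 4 ∷ on 19 794688 0 1 ∷ on 24 794688 0 2 ∷ on 25 794688 0 3 ∷ [])))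
 (br
 (br
 (br
 (leaf 45495 (on 2 0 0 786 ∷ on 3 0 0 577 ∷ on 5 0 0 321 ∷ on 7 0 0 216 ∷ on 13 794688 0 19 ∷ on 17 794688 0 38 ∷ on 18 794688 0 9 ∷ on 19 794688 0 17 ∷ on 25 794688 0 28 ∷ on 26 794688 4 12 ∷ on 27 794688 3 0 ∷ on 30 536640 0 4 ∷ on 33 1056832 0 9 ∷ []))
 (br
 (leaf 45495 (on 2 0 0 786 ∷ on 3 0 0 577 ∷ on 5 0 0 321 ∷ on 7 0 0 216 ∷ on 13 67903552 0 19 ∷ on 18 67903552 0 46 ∷ on 19 67903552 0 17 ∷ on 25 67903552 0 27 ∷ on 26 118235200 7 9 ∷ on 27 84680768 0 3 ∷ on 30 67645504 0 4 ∷ on 33 51388480 0 10 ∷ []))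
 (leaf 5585 (on 2 0 0 94 ∷ on 3 0 0 86 ∷ on 5 0 0 47 ∷ on 7 0 0 21 ∷ on 13 5436612672 0 11 ∷ on 14 5436612672 0 1 ∷ on 18 5436612672 0 4 ∷ on 26 8708169792 0 3 ∷ on 30 5436354624 0 1 ∷ []))))
 (leaf 3721 (on 2 0 0 123 ∷ on 3 0 0 57 ∷ on 7 0 0 16 ∷ on 13 67903552 1 10 ∷ on 18 67903552 0 3 ∷ on 19 67903552 0 1 ∷ on 24 67903552 0 2 ∷ [])))
 (leaf 8382 (on 2 0 0 293 ∷ on 3 0 0 156 ∷ on 7 0 0 34 ∷ on 13 67903552 0 15 ∷ on 18 67903552 0 4 ∷ on 19 67903552 0 1 ∷ on 22 67903552 0 1 ∷ on 25 67903552 0 6 ∷ on 27 67903552 0 1 ∷ []))))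
 (br
 (br
 (br
 (br
 (leaf 30315 (on 2 0 0 382 ∷ on 3 0 0 470 ∷ on 5 0 0 213 ∷ on 7 0 0 132 ∷ on 13 794688 0 14 ∷ on 14 794688 0 5 ∷ on 20 1060928 0 51 ∷ on 25 794688 0 16 ∷ on 26 794688 0 10 ∷ on 30 1323072 0 7 ∷ on 31 1056832 1 2 ∷ []))
 (br
 (leaf 15411 (on 2 0 0 195 ∷ on 3 0 0 240 ∷ on 5 0 0 109 ∷ on 7 0 0 66 ∷ on 13 67903552 0 7 ∷ on 14 67903552 0 3 ∷ on 20 34615360 0 26 ∷ on 25 67903552 0 8 ∷ on 26 118235200 0 5 ∷ on 30 34877504 0 3 ∷ on 31 51388480 1 1 ∷ []))
 (leaf 16489 (on 2 0 0 243 ∷ on 3 0 0 252 ∷ on 5 0 0 137 ∷ on 7 0 0 70 ∷ on 13 5436612672 0 31 ∷ on 14 5436612672 0 3 ∷ on 18 5436612672 0 8 ∷ on 20 5403324480 0 4 ∷ on 21 5436612672 0 1 ∷ on 26 8708169792 0 12 ∷ on 30 4329844800 0 1 ∷ []))))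
 (leaf 7321 (on 2 0 0 130 ∷ on 3 0 0 86 ∷ on 5 0 0 50 ∷ on 7 0 0 35 ∷ on 13 67903552 0 21 ∷ on 17 67903552 0 2 ∷ on 18 67903552 0 3 ∷ on 20 34615360 0 4 ∷ on 24 67903552 0 3 ∷ [])))
 (br
 (leaf 264211 (on 2 0 0 4404 ∷ on 3 0 0 3924 ∷ on 5 0 0 2065 ∷ on 7 0 0 1197 ∷ on 13 67903552 0 484 ∷ on 18 67903552 0 97 ∷ on 20 34615360 0 99 ∷ on 25 67903552 0 182 ∷ on 27 67903552 0 15 ∷ on 30 34877504 0 8 ∷ on 33 84680768 0 12 ∷ []))
 (leaf 7834 (on 2 0 0 400 ∷ on 3 0 0 144 ∷ on 13 5436612672 0 15 ∷ on 18 5436612672 0 4 ∷ on 22 5436612672 0 2 ∷ on 25 5436612672 0 5 ∷ on 27 5436612672 1 0 ∷ []))))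
 (leaf 10269 (on 2 0 0 276 ∷ on 3 0 0 150 ∷ on 5 0 0 93 ∷ on 13 67903552 6 14 ∷ on 20 84947008 0 13 ∷ on 21 67903552 0 4 ∷ on 25 67903552 0 3 ∷ on 30 84676736 0 2 ∷ [])))))
 (br
 (br
 (br
 (leaf 23127 (on 2 0 0 459 ∷ on 3 0 0 279 ∷ on 5 0 0 125 ∷ on 7 0 0 96 ∷ on 13 8256 0 42 ∷ on 18 8256 0 31 ∷ on 19 8256 0 19 ∷ on 21 8256 0 1 ∷ on 25 8256 0 9 ∷ on 27 8256 0 2 ∷ []))
 (leaf 10269 (on 2 0 0 249 ∷ on 3 0 0 164 ∷ on 5 0 0 34 ∷ on 7 0 0 43 ∷ on 13 794688 0 19 ∷ on 18 794688 0 11 ∷ on 19 794688 0 6 ∷ on 25 794688 0 4 ∷ on 27 794688 0 1 ∷ [])))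
 (br
 (br
 (leaf 39737 (on 2 0 0 647 ∷ on 3 0 0 570 ∷ on 5 0 0 251 ∷ on 7 0 0 181 ∷ on 13 794688 0 73 ∷ on 18 794688 0 46 ∷ on 19 794688 0 19 ∷ on 21 794688 0 2 ∷ on 25 794688 0 14 ∷ on 30 794688 0 6 ∷ []))
 (leaf 42519 (on 2 0 0 933 ∷ on 3 0 0 722 ∷ on 5 0 0 304 ∷ on 7 0 0 114 ∷ on 13 67903552 0 78 ∷ on 18 67903552 0 40 ∷ on 25 67903552 5 21 ∷ on 27 67903552 6 0 ∷ [])))
 (leaf 14402 (on 2 0 0 224 ∷ on 3 0 0 291 ∷ on 5 0 0 136 ∷ on 7 0 0 14 ∷ on 13 67903552 26 0 ∷ on 18 67903552 0 13 ∷ on 20 67903552 0 9 ∷ on 25 67903552 2 0 ∷ on 27 67903552 0 4 ∷ on 30 84680768 0 2 ∷ []))))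
 (leaf 1443 (on 3 0 0 48 ∷ on 5 0 0 10 ∷ on 9 794688 0 5 ∷ on 13 794688 0 3 ∷ on 18 1056832 0 2 ∷ []))))
 (br
 (br
 (br
 (leaf 18879 (on 2 0 0 424 ∷ on 3 0 0 315 ∷ on 7 0 0 74 ∷ on 8 8256 0 40 ∷ on 9 8256 0 14 ∷ on 13 8256 0 34 ∷ on 17 8256 0 12 ∷ on 18 8256 0 3 ∷ on 19 8256 0 17 ∷ on 25 8256 0 7 ∷ []))
 (br
 (br
 (br
 (br
 (leaf 3982 (on 2 0 0 111 ∷ on 3 0 0 66 ∷ on 5 0 0 28 ∷ on 14 794688 0 1 ∷ on 17 794688 0 4 ∷ on 18 794688 0 2 ∷ on 19 794688 0 2 ∷ on 25 794688 1 1 ∷ on 26 794688 0 2 ∷ on 27 794688 0 1 ∷ []))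
 (br
 (leaf 6842 (on 2 0 0 190 ∷ on 3 0 0 115 ∷ on 5 0 0 50 ∷ on 14 67903552 0 1 ∷ on 18 67903552 0 9 ∷ on 19 67903552 0 4 ∷ on 25 67903552 0 3 ∷ on 26 118235200 3 1 ∷ on 27 118235200 0 2 ∷ []))
 (leaf 4261 (on 2 0 0 146 ∷ on 3 0 0 64 ∷ on 5 0 0 33 ∷ on 13 5436612672 0 8 ∷ on 18 5436612672 0 4 ∷ on 26 8708169792 0 2 ∷ on 27 8708169792 0 1 ∷ []))))
 (leaf 1349 (on 2 0 0 69 ∷ on 3 0 0 18 ∷ on 9 8256 0 1 ∷ on 13 67903552 1 3 ∷ on 18 67903552 0 1 ∷ on 24 67645504 0 1 ∷ [])))
 (leaf 1178 (on 2 0 0 64 ∷ on 3 0 0 20 ∷ on 13 67903552 0 2 ∷ on 18 67903552 0 1 ∷ on 25 67903552 0 1 ∷ [])))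
 (leaf 2024 (on 2 0 0 77 ∷ on 3 0 0 23 ∷ on 5 0 0 17 ∷ on 13 67903552 0 3 ∷ on 17 67903552 0 1 ∷ on 18 67903552 0 1 ∷ on 24 67645504 0 1 ∷ on 25 67903552 0 1 ∷ []))))
 (leaf 21614 (on 2 0 0 852 ∷ on 3 0 0 295 ∷ on 5 0 0 41 ∷ on 9 794688 0 32 ∷ on 10 794688 0 31 ∷ on 13 794688 0 41 ∷ on 18 1056832 0 22 ∷ on 19 794688 0 14 ∷ [])))
 (leaf 2166 (on 2 0 0 93 ∷ on 3 0 0 30 ∷ on 9 794688 0 3 ∷ on 10 794688 0 4 ∷ on 13 794688 0 4 ∷ on 16 794688 0 1 ∷ on 17 794688 0 2 ∷ on 19 794688 0 1 ∷ [])))))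
 (br
 (br
 (br
 (br
 (br
 (leaf 4878 (on 2 0 0 5 ∷ on 3 0 0 17 ∷ on 7 64 0 53 ∷ on 8 64 0 20 ∷ on 12 64 0 4 ∷ on 15 64 0 9 ∷ on 17 64 4 0 ∷ on 18 64 0 5 ∷ on 19 64 0 3 ∷ on 22 64 0 2 ∷ []))
 (leaf 8382 (on 2 0 0 140 ∷ on 3 0 0 112 ∷ on 7 64 0 84 ∷ on 11 8256 0 1 ∷ on 15 8256 0 19 ∷ on 17 8256 0 8 ∷ on 19 8256 0 1 ∷ on 22 8256 0 5 ∷ [])))
 (br
 (br
 (leaf 45495 (on 2 0 0 595 ∷ on 3 0 0 458 ∷ on 5 0 0 5 ∷ on 7 64 0 467 ∷ on 15 8256 0 63 ∷ on 17 8256 26 26 ∷ on 18 8256 11 0 ∷ on 21 8256 0 31 ∷ on 22 8256 0 20 ∷ on 25 8256 0 6 ∷ on 30 12352 0 12 ∷ on 31 8256 0 4 ∷ []))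
 (br
 (leaf 11757 (on 2 0 0 155 ∷ on 3 0 0 175 ∷ on 7 64 0 121 ∷ on 15 794688 0 16 ∷ on 17 794688 0 8 ∷ on 22 794688 0 12 ∷ on 25 794688 0 1 ∷ on 30 536640 4 0 ∷ on 31 794688 1 0 ∷ []))
 (leaf 1349 (on 2 0 0 21 ∷ on 3 0 0 18 ∷ on 7 64 0 15 ∷ on 15 67903552 0 3 ∷ on 22 84680768 0 2 ∷ []))))
 (br
 (br
 (leaf 32437 (on 2 0 0 277 ∷ on 3 0 0 371 ∷ on 5 0 0 224 ∷ on 7 64 0 333 ∷ on 15 794688 0 8 ∷ on 17 794688 0 16 ∷ on 20 1060928 0 8 ∷ on 21 794688 0 14 ∷ on 22 794688 0 17 ∷ on 25 794688 2 2 ∷ on 30 1847360 0 3 ∷ on 31 1056832 0 9 ∷ []))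
 (br
 (leaf 20200 (on 2 0 0 159 ∷ on 3 0 0 222 ∷ on 5 0 0 159 ∷ on 7 64 0 208 ∷ on 15 67903552 0 2 ∷ on 22 84680768 0 34 ∷ on 25 67903552 3 0 ∷ on 30 35401792 1 0 ∷ on 31 51388480 6 0 ∷ []))
 (leaf 961 (on 2 0 0 32 ∷ on 3 0 0 3 ∷ on 7 64 0 10 ∷ on 12 5436612672 0 2 ∷ on 22 7600873536 0 2 ∷ []))))
 (br
 (br
 (leaf 5976 (on 2 0 0 94 ∷ on 3 0 0 37 ∷ on 5 0 0 23 ∷ on 7 64 0 66 ∷ on 10 67903552 0 14 ∷ on 15 67903552 0 1 ∷ on 20 84947008 0 4 ∷ on 21 84680768 0 1 ∷ on 22 67903552 0 6 ∷ []))
 (leaf 55734 (on 2 0 0 1365 ∷ on 3 0 0 136 ∷ on 5 0 0 248 ∷ on 7 64 0 615 ∷ on 12 5436612672 0 100 ∷ on 20 2232430656 0 40 ∷ on 22 7584096320 0 53 ∷ [])))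
 (leaf 1892 (on 2 0 0 16 ∷ on 3 0 0 18 ∷ on 5 0 0 21 ∷ on 7 64 12 0 ∷ on 11 5436612672 0 4 ∷ on 12 5436612672 0 1 ∷ on 20 7601139776 0 1 ∷ on 21 7600873536 0 3 ∷ []))))))
 (br
 (br
 (br
 (leaf 23127 (on 2 0 0 344 ∷ on 3 0 0 149 ∷ on 7 64 0 170 ∷ on 9 8256 0 67 ∷ on 10 8256 0 5 ∷ on 13 8256 0 10 ∷ on 15 8256 0 45 ∷ on 18 8256 0 14 ∷ on 19 8256 13 8 ∷ on 21 8256 0 5 ∷ on 22 8256 0 14 ∷ []))
 (leaf 10987 (on 2 0 0 184 ∷ on 3 0 0 216 ∷ on 7 64 0 83 ∷ on 13 794688 0 2 ∷ on 15 794688 7 8 ∷ on 18 794688 0 12 ∷ on 19 794688 0 7 ∷ on 25 794688 0 5 ∷ [])))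
 (br
 (br
 (leaf 28332 (on 2 0 0 335 ∷ on 3 0 0 285 ∷ on 5 0 0 96 ∷ on 7 64 0 271 ∷ on 13 794688 0 7 ∷ on 15 794688 0 23 ∷ on 18 794688 15 27 ∷ on 21 794688 0 7 ∷ on 22 794688 0 14 ∷ on 30 794688 0 10 ∷ on 31 794688 0 4 ∷ []))
 (br
 (leaf 17644 (on 2 0 0 242 ∷ on 3 0 0 263 ∷ on 7 64 0 173 ∷ on 13 67903552 0 3 ∷ on 15 67903552 0 24 ∷ on 18 67903552 0 16 ∷ on 22 84680768 0 14 ∷ on 30 67903552 2 6 ∷ on 31 67903552 1 0 ∷ []))
 (leaf 3038 (on 2 0 0 45 ∷ on 3 0 0 54 ∷ on 7 64 0 20 ∷ on 13 5436612672 0 7 ∷ on 15 5436612672 4 0 ∷ on 18 5436612672 0 1 ∷ on 22 7600873536 0 4 ∷ []))))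
 (br
 (br
 (leaf 6395 (on 2 0 0 49 ∷ on 3 0 0 69 ∷ on 5 0 0 50 ∷ on 7 64 0 66 ∷ on 15 67903552 0 1 ∷ on 18 67903552 0 5 ∷ on 21 67903552 0 2 ∷ on 22 67903552 0 4 ∷ on 30 118235200 0 1 ∷ on 31 67903552 0 2 ∷ []))
 (leaf 7321 (on 2 0 0 123 ∷ on 3 0 0 144 ∷ on 5 0 0 17 ∷ on 7 64 0 76 ∷ on 22 5436612672 0 5 ∷ on 25 5436612672 1 0 ∷ on 30 4413202496 5 0 ∷ [])))
 (leaf 2317 (on 3 0 0 56 ∷ on 5 0 0 20 ∷ on 7 64 10 0 ∷ on 10 5436612672 0 3 ∷ on 13 5436612672 0 4 ∷ on 20 5436612672 0 1 ∷ on 21 5436612672 0 3 ∷ [])))))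
 (leaf 370569 (on 3 0 0 10072 ∷ on 5 0 0 1600 ∷ on 7 64 0 1546 ∷ on 9 794688 0 30 ∷ on 10 794688 0 590 ∷ on 13 794688 0 728 ∷ on 14 794688 0 73 ∷ on 18 1056832 0 618 ∷ on 29 794688 62 0 ∷ []))))
 (br
 (br
 (br
 (br
 (leaf 7834 (on 2 0 0 7 ∷ on 3 0 0 97 ∷ on 7 64 0 60 ∷ on 8 8256 0 59 ∷ on 13 8256 0 1 ∷ on 17 8256 0 15 ∷ on 18 8256 1 0 ∷ on 19 8256 0 5 ∷ on 25 8256 0 3 ∷ []))
 (leaf 18879 (on 2 0 0 580 ∷ on 3 0 0 245 ∷ on 7 64 0 127 ∷ on 13 794688 0 12 ∷ on 17 794688 6 25 ∷ on 19 794688 0 12 ∷ on 22 794688 0 2 ∷ on 25 794688 0 9 ∷ [])))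
 (br
 (br
 (br
 (br
 (leaf 15411 (on 2 0 0 230 ∷ on 3 0 0 239 ∷ on 5 0 0 66 ∷ on 7 64 0 88 ∷ on 10 794688 0 14 ∷ on 16 794688 0 2 ∷ on 17 794688 0 21 ∷ on 19 794688 0 3 ∷ on 21 794688 0 2 ∷ on 25 794688 0 8 ∷ on 26 794688 0 6 ∷ on 30 794688 2 1 ∷ []))
 (br
 (leaf 15411 (on 2 0 0 230 ∷ on 3 0 0 239 ∷ on 5 0 0 67 ∷ on 7 64 0 88 ∷ on 16 67903552 0 2 ∷ on 18 67903552 0 21 ∷ on 19 67903552 4 4 ∷ on 21 67903552 0 2 ∷ on 25 67903552 0 8 ∷ on 26 67903552 0 6 ∷ on 30 67903552 4 1 ∷ []))
 (leaf 20200 (on 2 0 0 332 ∷ on 3 0 0 170 ∷ on 5 0 0 80 ∷ on 7 64 0 208 ∷ on 17 5436612672 0 29 ∷ on 18 5436612672 11 0 ∷ on 26 7584096320 0 5 ∷ on 30 5436612672 0 14 ∷ []))))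
 (leaf 2839 (on 2 0 0 95 ∷ on 3 0 0 43 ∷ on 7 64 0 14 ∷ on 13 67903552 0 4 ∷ on 14 67903552 0 1 ∷ on 17 67903552 0 3 ∷ on 24 67645504 0 2 ∷ on 25 67903552 0 1 ∷ [])))
 (leaf 48680 (on 2 0 0 1739 ∷ on 3 0 0 491 ∷ on 7 64 0 418 ∷ on 13 67903552 0 10 ∷ on 17 67903552 0 44 ∷ on 18 67903552 0 4 ∷ on 22 84680768 0 20 ∷ on 24 67645504 0 15 ∷ on 25 67903552 0 12 ∷ on 33 151789632 0 12 ∷ [])))
 (br
 (br
 (br
 (br
 (leaf 2166 (on 2 0 0 34 ∷ on 3 0 0 39 ∷ on 5 0 0 8 ∷ on 7 64 0 11 ∷ on 21 67903552 0 4 ∷ on 25 67903552 0 1 ∷ on 26 67903552 0 1 ∷ on 30 118235200 1 0 ∷ []))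
 (br
 (leaf 1443 (on 2 0 0 22 ∷ on 3 0 0 26 ∷ on 5 0 0 5 ∷ on 7 64 0 7 ∷ on 21 5436612672 0 3 ∷ on 26 7584096320 0 1 ∷ on 30 4413202496 1 0 ∷ []))
 (leaf 1260 (on 2 0 0 20 ∷ on 3 0 0 23 ∷ on 5 0 0 4 ∷ on 7 64 0 13 ∷ on 21 486472949824 0 1 ∷ on 30 348010586176 0 1 ∷ []))))
 (leaf 1178 (on 2 0 0 39 ∷ on 3 0 0 14 ∷ on 7 64 0 9 ∷ on 13 5436612672 0 2 ∷ on 24 5436354624 0 2 ∷ [])))
 (leaf 11757 (on 2 0 0 369 ∷ on 3 0 0 232 ∷ on 7 64 0 57 ∷ on 13 5436612672 0 19 ∷ on 14 5436612672 0 3 ∷ on 20 5436612672 0 4 ∷ on 22 5436612672 0 2 ∷ on 25 5436612672 0 9 ∷ on 30 4413202496 1 0 ∷ [])))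
 (leaf 5585 (on 2 0 0 167 ∷ on 3 0 0 73 ∷ on 5 0 0 50 ∷ on 13 5436612672 0 8 ∷ on 14 5436612672 0 2 ∷ on 20 5436612672 0 6 ∷ on 21 5436612672 0 3 ∷ on 25 5436612672 0 3 ∷ [])))))
 (br
 (br
 (leaf 5976 (on 2 0 0 184 ∷ on 3 0 0 74 ∷ on 7 64 0 45 ∷ on 13 794688 0 1 ∷ on 18 1056832 0 11 ∷ on 19 794688 0 4 ∷ on 25 794688 0 3 ∷ []))
 (br
 (br
 (br
 (br
 (leaf 5976 (on 2 0 0 93 ∷ on 3 0 0 89 ∷ on 5 0 0 26 ∷ on 7 64 0 29 ∷ on 18 51388480 0 9 ∷ on 19 67903552 4 1 ∷ on 21 67903552 0 1 ∷ on 25 67903552 3 1 ∷ on 30 118235200 0 4 ∷ []))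
 (leaf 3478 (on 2 0 0 53 ∷ on 3 0 0 45 ∷ on 5 0 0 14 ∷ on 7 64 0 30 ∷ on 13 5436612672 0 2 ∷ on 18 5420097600 2 4 ∷ on 21 5436612672 0 1 ∷ on 30 4413202496 0 2 ∷ [])))
 (leaf 17644 (on 2 0 0 630 ∷ on 3 0 0 213 ∷ on 7 64 0 96 ∷ on 9 794688 0 11 ∷ on 13 5436612672 0 37 ∷ on 18 5420097600 0 15 ∷ on 24 5436354624 0 14 ∷ [])))
 (leaf 6395 (on 2 0 0 228 ∷ on 3 0 0 99 ∷ on 7 64 0 39 ∷ on 13 5436612672 0 5 ∷ on 18 5420097600 0 7 ∷ on 22 5436612672 0 3 ∷ on 25 5436612672 0 3 ∷ [])))
 (br
 (leaf 37138 (on 2 0 0 452 ∷ on 3 0 0 813 ∷ on 5 0 0 228 ∷ on 7 64 185 0 ∷ on 13 5436612672 0 35 ∷ on 18 5420097600 0 26 ∷ on 20 5436612672 0 15 ∷ on 21 5436612672 0 21 ∷ on 25 5436612672 0 10 ∷ on 30 7568891968 0 9 ∷ []))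
 (leaf 456 (on 3 0 0 11 ∷ on 5 0 0 5 ∷ on 10 417753473088 0 1 ∷ on 20 486472949824 0 1 ∷ on 21 486472949824 1 0 ∷ [])))))
 (leaf 2024 (on 3 0 0 93 ∷ on 7 64 0 2 ∷ on 9 67903552 0 7 ∷ on 18 84942912 0 5 ∷ on 19 67903552 1 0 ∷ []))))
 (br
 (br
 (br
 (leaf 2317 (on 2 0 0 72 ∷ on 3 0 0 28 ∷ on 7 64 0 16 ∷ on 8 794688 0 3 ∷ on 17 794688 0 4 ∷ on 18 794688 0 1 ∷ on 19 794688 1 0 ∷ on 25 794688 0 1 ∷ []))
 (leaf 1892 (on 2 0 0 116 ∷ on 3 0 0 29 ∷ on 13 67903552 0 1 ∷ on 17 67903552 0 2 ∷ on 24 34877504 0 1 ∷ on 25 67903552 0 1 ∷ [])))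
 (leaf 3478 (on 2 0 0 201 ∷ on 3 0 0 36 ∷ on 9 67903552 0 7 ∷ on 10 67903552 0 4 ∷ on 18 67903552 0 4 ∷ on 19 67903552 2 2 ∷ [])))
 (leaf 304 (on 2 0 0 18 ∷ on 3 0 0 3 ∷ on 9 67903552 0 1 ∷ on 16 67903552 0 1 ∷ [])))))
 (br
 (br
 (br
 (br
 (leaf 785 (on 2 0 0 7 ∷ on 3 0 0 14 ∷ on 7 8256 0 9 ∷ on 15 8256 0 2 ∷ on 21 8256 0 1 ∷ []))
 (leaf 11757 (on 2 0 0 132 ∷ on 3 0 0 186 ∷ on 5 0 0 58 ∷ on 7 8256 0 87 ∷ on 10 794688 0 14 ∷ on 14 794688 0 26 ∷ on 15 794688 0 7 ∷ on 21 794688 0 8 ∷ [])))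
 (br
 (br
 (leaf 785 (on 2 0 0 7 ∷ on 3 0 0 14 ∷ on 7 8256 0 9 ∷ on 15 794688 0 2 ∷ on 21 794688 0 1 ∷ []))
 (leaf 8382 (on 2 0 0 68 ∷ on 3 0 0 156 ∷ on 5 0 0 56 ∷ on 7 8256 24 36 ∷ on 10 67903552 0 5 ∷ on 14 67903552 0 15 ∷ on 15 67903552 0 2 ∷ on 21 67903552 0 10 ∷ [])))
 (leaf 840 (on 3 0 0 23 ∷ on 7 8256 0 5 ∷ on 10 67903552 0 3 ∷ on 14 67903552 0 1 ∷ on 18 84942912 0 2 ∷ []))))
 (br
 (br
 (br
 (leaf 961 (on 2 0 0 26 ∷ on 3 0 0 8 ∷ on 7 8256 0 7 ∷ on 14 794688 0 2 ∷ on 17 794688 0 1 ∷ on 18 794688 1 0 ∷ on 21 794688 0 1 ∷ []))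
 (br
 (leaf 284 (on 2 0 0 8 ∷ on 3 0 0 2 ∷ on 7 8256 0 1 ∷ on 14 67903552 0 1 ∷ on 21 67903552 0 1 ∷ []))
 (leaf 559 (on 2 0 0 18 ∷ on 3 0 0 6 ∷ on 10 5436612672 0 2 ∷ on 14 5436612672 0 2 ∷ on 21 7584096320 0 1 ∷ []))))
 (br
 (leaf 11757 (on 2 0 0 277 ∷ on 3 0 0 182 ∷ on 7 8256 7 62 ∷ on 10 67903552 0 36 ∷ on 14 67903552 0 16 ∷ on 18 67903552 0 18 ∷ []))
 (leaf 325 (on 3 0 0 14 ∷ on 7 8256 0 1 ∷ on 9 5436612672 0 1 ∷ on 18 5436612672 0 1 ∷ []))))
 (leaf 1652 (on 2 0 0 101 ∷ on 3 0 0 18 ∷ on 9 67903552 0 3 ∷ on 14 67903552 0 3 ∷ on 17 67903552 0 1 ∷ on 24 84680768 0 1 ∷ []))))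
 (leaf 265 (on 2 0 0 8 ∷ on 3 0 0 5 ∷ on 7 794688 0 2 ∷ on 14 794688 0 1 ∷ [])))))
 (br
 (br
 (leaf 7321 (on 2 0 0 204 ∷ on 3 0 0 163 ∷ on 6 64 0 1 ∷ on 7 64 0 29 ∷ on 10 64 0 3 ∷ on 13 64 0 23 ∷ on 18 64 0 6 ∷ on 19 64 0 1 ∷ []))
 (leaf 898 (on 2 0 0 27 ∷ on 3 0 0 20 ∷ on 7 8256 0 5 ∷ on 13 8256 0 2 ∷ on 18 8256 0 1 ∷ [])))
 (leaf 96 (on 2 0 0 4 ∷ on 3 0 0 2 ∷ on 7 8256 0 1 ∷ [])))))
 (br
 (br
 (br
 (br
 (br
 (leaf 2166 (on 2 0 0 5 ∷ on 5 0 0 20 ∷ on 6 0 0 13 ∷ on 7 0 0 11 ∷ on 11 0 0 5 ∷ on 13 0 0 5 ∷ on 16 0 1 1 ∷ on 17 0 0 2 ∷ []))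
 (leaf 32437 (on 3 0 0 416 ∷ on 5 0 0 448 ∷ on 7 0 0 55 ∷ on 11 64 0 82 ∷ on 13 64 49 11 ∷ on 15 64 0 4 ∷ on 16 64 0 15 ∷ on 17 64 0 21 ∷ on 18 128 0 12 ∷ on 21 64 0 13 ∷ on 27 192 0 5 ∷ [])))
 (br
 (br
 (leaf 13460 (on 2 0 0 131 ∷ on 3 0 0 108 ∷ on 5 0 0 125 ∷ on 7 0 0 54 ∷ on 11 64 0 34 ∷ on 13 64 0 24 ∷ on 16 64 0 8 ∷ on 17 64 0 15 ∷ on 18 64 0 4 ∷ on 25 64 0 2 ∷ []))
 (leaf 10269 (on 3 0 0 132 ∷ on 5 0 0 147 ∷ on 7 0 0 10 ∷ on 11 8256 0 26 ∷ on 13 8256 18 0 ∷ on 16 8256 0 14 ∷ on 18 8256 0 5 ∷ on 21 8256 0 2 ∷ on 25 8256 2 0 ∷ on 27 12352 0 2 ∷ [])))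
 (br
 (leaf 17644 (on 2 0 0 352 ∷ on 3 0 0 50 ∷ on 5 0 0 287 ∷ on 8 8256 0 5 ∷ on 11 8256 0 60 ∷ on 16 12352 0 20 ∷ on 17 8256 0 22 ∷ on 21 8256 0 4 ∷ []))
 (leaf 1443 (on 2 0 0 37 ∷ on 3 0 0 18 ∷ on 5 0 0 3 ∷ on 8 794688 0 1 ∷ on 10 794688 0 6 ∷ on 11 794688 0 1 ∷ on 16 1060928 0 5 ∷ on 17 794688 0 1 ∷ [])))))
 (br
 (br
 (br
 (leaf 83642 (on 2 0 0 755 ∷ on 3 0 0 695 ∷ on 5 0 0 761 ∷ on 7 64 0 507 ∷ on 11 64 0 211 ∷ on 15 64 0 107 ∷ on 16 64 0 12 ∷ on 17 64 0 116 ∷ on 25 64 0 15 ∷ []))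
 (br
 (br
 (br
 (leaf 5976 (on 3 0 0 77 ∷ on 5 0 0 66 ∷ on 7 64 0 25 ∷ on 11 8256 0 2 ∷ on 14 8256 0 2 ∷ on 15 8256 0 8 ∷ on 16 8256 8 0 ∷ on 17 8256 0 5 ∷ on 22 8256 0 3 ∷ on 25 8256 0 3 ∷ []))
 (br
 (leaf 5976 (on 3 0 0 77 ∷ on 5 0 0 66 ∷ on 7 64 0 25 ∷ on 11 794688 0 2 ∷ on 14 794688 0 2 ∷ on 15 794688 0 8 ∷ on 16 794688 8 0 ∷ on 17 794688 0 5 ∷ on 22 794688 0 3 ∷ on 25 794688 0 3 ∷ []))
 (br
 (leaf 3250 (on 3 0 0 42 ∷ on 5 0 0 51 ∷ on 7 64 0 2 ∷ on 14 67903552 0 5 ∷ on 15 67903552 0 2 ∷ on 16 67903552 4 0 ∷ on 22 101457984 0 4 ∷ on 25 67903552 1 1 ∷ []))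
 (leaf 559 (on 3 0 0 8 ∷ on 5 0 0 7 ∷ on 7 64 3 0 ∷ on 11 6510354496 0 2 ∷ on 22 7617650752 0 1 ∷ [])))))
 (leaf 1260 (on 3 0 0 15 ∷ on 5 0 0 29 ∷ on 11 794688 0 3 ∷ on 15 794688 0 2 ∷ on 21 790656 0 1 ∷ [])))
 (leaf 1892 (on 3 0 0 27 ∷ on 5 0 0 29 ∷ on 7 64 0 7 ∷ on 11 794688 0 4 ∷ on 14 794688 0 1 ∷ on 15 794688 0 1 ∷ on 18 794688 0 3 ∷ []))))
 (br
 (br
 (br
 (br
 (leaf 2839 (on 2 0 0 15 ∷ on 3 0 0 29 ∷ on 5 0 0 26 ∷ on 7 64 0 17 ∷ on 8 8256 0 2 ∷ on 13 8256 0 2 ∷ on 16 12352 0 4 ∷ on 17 8256 0 3 ∷ on 22 8256 0 2 ∷ on 25 8256 0 1 ∷ []))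
 (br
 (leaf 5976 (on 3 0 0 77 ∷ on 5 0 0 60 ∷ on 7 64 0 25 ∷ on 15 794688 0 9 ∷ on 16 536640 7 3 ∷ on 17 794688 1 5 ∷ on 22 794688 0 4 ∷ on 25 794688 1 2 ∷ []))
 (br
 (leaf 5976 (on 3 0 0 77 ∷ on 5 0 0 60 ∷ on 7 64 0 25 ∷ on 15 67903552 0 9 ∷ on 16 67645504 7 3 ∷ on 17 67903552 1 5 ∷ on 22 101457984 0 4 ∷ on 25 67903552 1 2 ∷ []))
 (leaf 4878 (on 2 0 0 178 ∷ on 3 0 0 24 ∷ on 5 0 0 58 ∷ on 11 6510354496 0 4 ∷ on 13 6510354496 0 5 ∷ on 17 6510354496 0 3 ∷ on 22 7617650752 0 5 ∷ on 25 6510354496 0 2 ∷ [])))))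
 (leaf 68277 (on 2 0 0 1592 ∷ on 5 0 0 1155 ∷ on 11 794688 0 173 ∷ on 14 794688 0 65 ∷ on 15 794688 0 35 ∷ on 17 794688 0 63 ∷ on 21 790656 0 37 ∷ on 23 794688 0 12 ∷ [])))
 (br
 (br
 (br
 (leaf 2317 (on 3 0 0 29 ∷ on 5 0 0 35 ∷ on 7 64 0 11 ∷ on 16 536640 0 5 ∷ on 22 794688 0 1 ∷ on 25 794688 0 2 ∷ []))
 (br
 (leaf 2317 (on 3 0 0 29 ∷ on 5 0 0 35 ∷ on 7 64 0 11 ∷ on 16 67645504 0 5 ∷ on 22 101457984 0 1 ∷ on 25 67903552 0 2 ∷ []))
 (leaf 21614 (on 3 0 0 278 ∷ on 5 0 0 331 ∷ on 11 6510354496 0 55 ∷ on 14 6510354496 0 31 ∷ on 16 6510096448 31 13 ∷ on 22 7617650752 0 6 ∷ on 25 6510354496 12 0 ∷ []))))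
 (leaf 840 (on 3 0 0 9 ∷ on 5 0 0 20 ∷ on 11 67903552 0 2 ∷ on 15 67903552 0 1 ∷ on 21 67899520 0 1 ∷ [])))
 (leaf 1029 (on 3 0 0 14 ∷ on 5 0 0 23 ∷ on 9 67903552 0 1 ∷ on 11 67903552 0 2 ∷ on 18 67903552 0 1 ∷ on 21 67899520 0 1 ∷ []))))
 (leaf 20200 (on 2 0 0 557 ∷ on 3 0 0 286 ∷ on 5 0 0 78 ∷ on 8 794688 0 1 ∷ on 10 794688 0 63 ∷ on 16 1060928 12 39 ∷ on 17 794688 0 29 ∷ on 21 790656 0 4 ∷ []))))
 (br
 (br
 (br
 (leaf 6395 (on 2 0 0 76 ∷ on 3 0 0 39 ∷ on 5 0 0 59 ∷ on 7 8256 0 47 ∷ on 11 8256 0 13 ∷ on 15 8256 0 10 ∷ on 16 8256 0 2 ∷ on 17 8256 0 6 ∷ on 21 16512 0 1 ∷ []))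
 (br
 (leaf 11757 (on 3 0 0 111 ∷ on 5 0 0 106 ∷ on 7 8256 0 117 ∷ on 11 794688 0 24 ∷ on 15 794688 0 13 ∷ on 16 794688 7 7 ∷ on 21 278656 0 6 ∷ []))
 (leaf 1178 (on 3 0 0 19 ∷ on 5 0 0 19 ∷ on 7 8256 6 0 ∷ on 11 67903552 0 2 ∷ on 21 50610304 0 2 ∷ []))))
 (br
 (br
 (br
 (leaf 4878 (on 2 0 0 9 ∷ on 3 0 0 62 ∷ on 7 8256 0 49 ∷ on 11 794688 0 10 ∷ on 15 794688 4 5 ∷ on 16 794688 0 6 ∷ on 17 794688 0 5 ∷ on 21 278656 0 3 ∷ []))
 (leaf 3721 (on 2 0 0 89 ∷ on 3 0 0 8 ∷ on 5 0 0 59 ∷ on 11 67903552 0 7 ∷ on 14 67903552 0 5 ∷ on 15 67903552 0 2 ∷ on 17 67903552 0 3 ∷ on 21 50610304 0 3 ∷ [])))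
 (br
 (br
 (leaf 55734 (on 3 0 0 1380 ∷ on 5 0 0 101 ∷ on 7 8256 126 0 ∷ on 11 67903552 0 30 ∷ on 14 67903552 0 127 ∷ on 16 67903552 129 0 ∷ on 21 50610304 0 93 ∷ on 25 67903552 0 24 ∷ []))
 (leaf 399 (on 3 0 0 6 ∷ on 5 0 0 8 ∷ on 11 6510354496 0 1 ∷ on 21 6493061248 0 1 ∷ [])))
 (leaf 373 (on 3 0 0 8 ∷ on 5 0 0 5 ∷ on 18 6510354496 0 1 ∷ on 21 6493061248 1 0 ∷ []))))
 (leaf 685 (on 2 0 0 20 ∷ on 3 0 0 9 ∷ on 5 0 0 1 ∷ on 10 67903552 0 3 ∷ on 16 67903552 0 2 ∷ on 17 67903552 0 1 ∷ []))))
 (br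
 (br
 (leaf 1544 (on 3 0 0 34 ∷ on 7 794688 0 9 ∷ on 10 794688 0 5 ∷ on 14 794688 0 3 ∷ on 15 794688 0 3 ∷ on 16 794688 2 0 ∷ []))
 (br
 (leaf 4261 (on 3 0 0 95 ∷ on 5 0 0 22 ∷ on 7 794688 10 0 ∷ on 10 67903552 0 6 ∷ on 14 67903552 0 14 ∷ on 15 67903552 0 2 ∷ on 16 67903552 6 0 ∷ on 21 18366592 0 4 ∷ []))
 (leaf 96 (on 16 6510354496 1 1 ∷ []))))
 (leaf 456 (on 2 0 6 0 ∷ on 7 67903552 8 4 ∷ on 14 67903552 0 1 ∷ on 15 67903552 1 0 ∷ []))))))
 (br
 (br
 (br
 (br
 (leaf 3478 (on 5 0 0 32 ∷ on 6 64 0 38 ∷ on 7 64 0 11 ∷ on 13 64 0 10 ∷ on 14 64 0 1 ∷ on 15 64 0 1 ∷ on 16 64 0 1 ∷ on 18 64 0 4 ∷ on 21 64 0 1 ∷ []))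
 (leaf 5220 (on 3 0 0 115 ∷ on 5 0 0 49 ∷ on 7 64 0 14 ∷ on 13 8256 0 15 ∷ on 14 8256 0 2 ∷ on 15 8256 0 2 ∷ on 18 8256 0 8 ∷ on 21 8256 0 1 ∷ [])))
 (br
 (br
 (leaf 68277 (on 2 0 0 1584 ∷ on 3 0 0 1119 ∷ on 5 0 0 621 ∷ on 7 64 0 18 ∷ on 13 8256 34 70 ∷ on 14 8256 0 68 ∷ on 18 8256 0 48 ∷ on 25 16448 0 49 ∷ on 27 8256 0 7 ∷ []))
 (leaf 1443 (on 3 0 0 38 ∷ on 5 0 0 9 ∷ on 7 64 0 4 ∷ on 10 794688 0 3 ∷ on 13 794688 2 1 ∷ on 18 794688 0 3 ∷ [])))
 (leaf 6395 (on 2 0 0 177 ∷ on 3 0 0 91 ∷ on 5 0 0 25 ∷ on 10 794688 0 20 ∷ on 13 794688 5 4 ∷ on 16 1060928 2 6 ∷ on 17 794688 0 9 ∷ on 24 1589312 0 1 ∷ []))))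
 (br
 (br
 (br
 (br
 (leaf 1652 (on 2 0 0 15 ∷ on 3 0 0 26 ∷ on 7 8256 0 17 ∷ on 11 8256 0 1 ∷ on 15 8256 0 4 ∷ on 16 8256 0 1 ∷ on 17 8256 0 1 ∷ on 21 8256 0 1 ∷ []))
 (br
 (leaf 1768 (on 2 0 0 16 ∷ on 3 0 0 31 ∷ on 7 8256 0 19 ∷ on 15 794688 0 4 ∷ on 21 794688 0 3 ∷ []))
 (leaf 488 (on 2 0 0 3 ∷ on 3 0 0 6 ∷ on 5 0 0 6 ∷ on 7 8256 3 0 ∷ on 11 67903552 0 1 ∷ on 21 101457984 0 1 ∷ []))))
 (leaf 55734 (on 3 0 0 1326 ∷ on 5 0 0 341 ∷ on 7 8256 0 174 ∷ on 10 794688 0 55 ∷ on 13 794688 0 140 ∷ on 14 794688 0 31 ∷ on 15 794688 0 21 ∷ on 18 794688 0 73 ∷ on 21 794688 0 20 ∷ [])))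
 (br
 (br
 (leaf 78170 (on 2 0 0 2348 ∷ on 3 0 0 1013 ∷ on 5 0 0 710 ∷ on 7 8256 0 171 ∷ on 13 794688 0 28 ∷ on 14 794688 0 20 ∷ on 17 794688 0 111 ∷ on 18 794688 0 19 ∷ on 25 1056832 0 40 ∷ []))
 (leaf 1260 (on 2 0 0 15 ∷ on 3 0 0 28 ∷ on 5 0 0 11 ∷ on 7 8256 3 3 ∷ on 18 101457984 0 2 ∷ on 25 51388480 0 1 ∷ [])))
 (leaf 1101 (on 2 0 0 31 ∷ on 3 0 0 21 ∷ on 10 67903552 0 3 ∷ on 16 67903552 2 3 ∷ on 17 67903552 0 1 ∷ []))))
 (br
 (br
 (leaf 1349 (on 3 0 0 31 ∷ on 7 794688 0 8 ∷ on 10 794688 0 4 ∷ on 14 794688 0 3 ∷ on 15 794688 0 2 ∷ on 16 794688 2 0 ∷ []))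
 (leaf 1768 (on 2 0 0 50 ∷ on 3 0 0 39 ∷ on 7 794688 7 0 ∷ on 10 67903552 0 2 ∷ on 14 67903552 0 3 ∷ on 21 51388480 0 3 ∷ [])))
 (leaf 135 (on 2 0 0 4 ∷ on 3 0 0 1 ∷ on 7 67903552 0 1 ∷ on 15 67903552 0 1 ∷ [])))))
 (leaf 2024 (on 2 0 0 73 ∷ on 3 0 0 40 ∷ on 7 8256 0 10 ∷ on 13 8256 0 6 ∷ on 18 8256 0 1 ∷ []))))
 (br
 (br
 (br
 (leaf 598 (on 2 0 0 9 ∷ on 3 0 0 2 ∷ on 5 64 0 10 ∷ on 10 64 0 2 ∷ on 11 64 0 2 ∷ on 15 64 0 1 ∷ []))
 (leaf 21614 (on 2 0 0 390 ∷ on 3 0 0 112 ∷ on 5 64 0 236 ∷ on 7 8256 26 103 ∷ on 10 8256 0 83 ∷ on 11 8256 4 41 ∷ on 15 8256 0 5 ∷ [])))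
 (br
 (br
 (leaf 399 (on 2 0 0 6 ∷ on 3 0 0 7 ∷ on 5 64 0 3 ∷ on 10 8256 0 1 ∷ on 13 8256 0 1 ∷ on 15 8256 0 1 ∷ []))
 (leaf 1892 (on 2 0 0 31 ∷ on 3 0 0 35 ∷ on 7 794688 4 8 ∷ on 10 794688 0 10 ∷ on 15 1056832 0 4 ∷ [])))
 (leaf 785 (on 2 0 0 22 ∷ on 3 0 0 17 ∷ on 7 794688 5 0 ∷ on 12 794688 0 1 ∷ on 13 794688 0 1 ∷ on 20 794688 0 1 ∷ []))))
 (leaf 144 (on 3 0 2 0 ∷ on 5 8256 1 3 ∷ on 10 8256 0 1 ∷ [])))))
 (br
 (br
 (br
 (br
 (leaf 10987 (on 4 0 0 178 ∷ on 5 0 0 81 ∷ on 9 0 0 41 ∷ on 11 0 11 18 ∷ on 13 0 0 21 ∷ on 14 0 0 3 ∷ on 17 0 0 9 ∷ on 21 0 2 0 ∷ []))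
 (br
 (leaf 13460 (on 4 0 0 210 ∷ on 5 0 0 146 ∷ on 9 64 0 42 ∷ on 11 64 0 26 ∷ on 12 64 0 3 ∷ on 14 128 0 22 ∷ on 17 64 0 12 ∷ on 21 192 2 0 ∷ []))
 (leaf 1652 (on 4 0 0 52 ∷ on 5 0 5 0 ∷ on 9 8256 3 3 ∷ on 14 12416 0 3 ∷ on 17 8256 0 1 ∷ on 22 12416 0 1 ∷ []))))
 (br
 (br
 (leaf 17644 (on 2 0 0 490 ∷ on 5 0 0 128 ∷ on 9 64 0 66 ∷ on 12 64 25 28 ∷ on 13 64 7 25 ∷ on 14 64 0 12 ∷ on 17 64 0 15 ∷ on 19 64 0 4 ∷ []))
 (br
 (br
 (br
 (leaf 5220 (on 2 0 0 286 ∷ on 12 8256 0 17 ∷ on 13 8256 1 7 ∷ on 17 8256 2 0 ∷ on 18 8256 0 9 ∷ on 19 8256 4 0 ∷ []))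
 (leaf 32437 (on 2 0 0 1464 ∷ on 5 0 165 0 ∷ on 9 794688 0 121 ∷ on 12 794688 0 46 ∷ on 13 794688 0 33 ∷ on 14 794688 0 42 ∷ on 18 1318976 5 22 ∷ on 19 1318976 7 0 ∷ [])))
 (leaf 685 (on 2 0 0 48 ∷ on 9 794688 0 3 ∷ on 12 794688 0 1 ∷ on 24 1581120 0 1 ∷ [])))
 (leaf 733 (on 2 0 0 47 ∷ on 9 794688 3 0 ∷ on 14 794688 0 2 ∷ on 21 1585280 1 0 ∷ []))))
 (leaf 126 (on 2 0 0 9 ∷ on 12 12352 0 1 ∷ []))))
 (br
 (br
 (br
 (leaf 10987 (on 2 0 0 305 ∷ on 5 64 0 160 ∷ on 11 64 0 27 ∷ on 12 64 0 20 ∷ on 13 64 14 0 ∷ on 17 64 0 9 ∷ on 21 64 0 3 ∷ []))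
 (br
 (br
 (leaf 7321 (on 2 0 0 37 ∷ on 5 64 0 149 ∷ on 11 8256 0 15 ∷ on 12 8256 0 17 ∷ on 14 8256 0 7 ∷ on 16 8256 2 8 ∷ on 17 8256 0 2 ∷ on 21 12416 0 5 ∷ []))
 (leaf 1178 (on 2 0 0 42 ∷ on 5 64 0 9 ∷ on 9 794688 0 4 ∷ on 10 794688 0 2 ∷ on 16 1318976 0 4 ∷ on 17 1318976 1 0 ∷ [])))
 (br
 (br
 (br
 (leaf 1544 (on 2 0 0 46 ∷ on 5 64 0 14 ∷ on 14 794688 2 3 ∷ on 15 794688 0 3 ∷ on 17 794688 2 0 ∷ on 21 274560 1 0 ∷ on 22 1323072 0 1 ∷ []))
 (leaf 898 (on 2 0 0 28 ∷ on 5 64 0 18 ∷ on 14 84680768 0 2 ∷ on 22 34877504 0 1 ∷ [])))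
 (leaf 96 (on 16 84680768 1 1 ∷ [])))
 (leaf 840 (on 2 0 0 49 ∷ on 5 64 6 0 ∷ on 7 67903552 0 1 ∷ on 14 84680768 1 2 ∷ on 22 118763584 0 1 ∷ [])))))
 (br
 (br
 (leaf 1101 (on 2 0 0 31 ∷ on 5 64 0 15 ∷ on 12 12352 0 5 ∷ on 13 8256 2 0 ∷ on 18 12352 0 1 ∷ []))
 (leaf 840 (on 2 0 0 61 ∷ on 5 64 1 0 ∷ on 12 536640 0 4 ∷ on 17 794688 0 1 ∷ [])))
 (leaf 68 (on 2 0 0 3 ∷ on 12 1323072 0 1 ∷ []))))
 (leaf 840 (on 2 0 0 38 ∷ on 5 8256 1 9 ∷ on 6 8256 0 1 ∷ on 10 8256 0 3 ∷ on 11 8256 0 1 ∷ on 12 8256 0 1 ∷ []))))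
 (leaf 1029 (on 2 0 0 46 ∷ on 4 64 0 2 ∷ on 5 64 1 10 ∷ on 9 64 0 5 ∷ on 12 64 0 2 ∷ []))))
 (br
 (br
 (br
 (leaf 840 (on 3 0 0 23 ∷ on 7 0 0 6 ∷ on 9 0 0 3 ∷ on 10 0 0 3 ∷ on 13 0 0 1 ∷ []))
 (br
 (leaf 785 (on 3 0 0 22 ∷ on 7 64 0 5 ∷ on 9 64 0 1 ∷ on 10 128 1 4 ∷ on 13 64 1 0 ∷ []))
 (leaf 126 (on 3 0 0 3 ∷ on 5 8256 0 1 ∷ on 6 8256 0 1 ∷ on 10 16512 0 1 ∷ []))))
 (br
 (br
 (leaf 1101 (on 2 0 0 20 ∷ on 3 0 5 0 ∷ on 4 64 0 10 ∷ on 6 64 0 3 ∷ on 9 64 0 10 ∷ on 10 64 3 0 ∷ on 13 64 0 1 ∷ []))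
 (br
 (leaf 1768 (on 2 0 11 0 ∷ on 3 0 0 50 ∷ on 7 8256 0 4 ∷ on 9 8256 0 7 ∷ on 10 8256 4 5 ∷ on 13 8256 3 0 ∷ []))
 (leaf 45 (on 10 1056832 2 0 ∷ []))))
 (leaf 118 (on 2 0 4 0 ∷ on 8 8256 0 2 ∷ on 9 8256 1 0 ∷ []))))
 (leaf 42 (on 3 64 2 0 ∷ on 6 64 0 1 ∷ []))))

-- Densities as numerators over a common denominator

_over_ : ℕ → (Q : ℕ) {{_ : NonZero Q}} → ℚᵘ
n over (suc Q) = mkℚᵘ (ℤ.+ n) Q

over-+ : ∀ m n Q {{_ : NonZero Q}} → (m over Q) +ᵘ (n over Q) ≃ᵘ (m + n) over Q
over-+ m n (suc Q) = *≡* (identity (ℤ.+ m) (ℤ.+ n) (ℤ.+ suc Q))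
  where identity : ∀ m n q → (m ℤ.* q ℤ.+ n ℤ.* q) ℤ.* q ≡ (m ℤ.+ n) ℤ.* (q ℤ.* q)
        identity = ℤ.solve-∀

over-zero : ∀ Q {{_ : NonZero Q}} → toℚᵘ ℚ.0ℚ ≃ᵘ 0 over Q
over-zero (suc Q) = *≡* refl

reciprocal-over : ∀ a {{_ : NonZero a}} x Q {{_ : NonZero Q}} → x * a ≡ Q → toℚᵘ (ℤ.+ 1 ℚ./ a) ≃ᵘ x over Q
reciprocal-over (suc a) x (suc Q) eq = ℚᵘ.≃-trans (ℚ.toℚᵘ-fromℚᵘ (mkℚᵘ (ℤ.+ 1) a))
  (*≡* (trans (ℤ.*-identityˡ (ℤ.+ suc Q)) (trans (cong ℤ.+_ (sym eq)) (ℤ.pos-* x (suc a)))))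

sum-over : ∀ {p q} m n Q {{_ : NonZero Q}} → toℚᵘ p ≃ᵘ m over Q → toℚᵘ q ≃ᵘ n over Q → toℚᵘ (p ℚ.+ q) ≃ᵘ (m + n) over Q
sum-over {p} {q} m n Q h h′ = ℚᵘ.≃-trans (ℚ.toℚᵘ-homo-+ p q) (ℚᵘ.≃-trans (ℚᵘ.+-cong h h′) (over-+ m n Q))

over-cancel-≤ : ∀ m n Q {{_ : NonZero Q}} → (m over Q) ≤ᵘ (n over Q) → m ≤ n
over-cancel-≤ m n (suc Q) (*≤* h) = ℤ.drop‿+≤+ (ℤ.*-cancelʳ-≤-pos (ℤ.+ m) (ℤ.+ n) (ℤ.+ suc Q) h)

density-over : ∀ {n} (a : Fin n → ℕ) pos (x : Fin n → ℕ) Q {{_ : NonZero Q}} → (∀ i → x i * a i ≡ Q) →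
  toℚᵘ (density a pos) ≃ᵘ ∑ proj₂ (tabulate (λ i → a i , x i)) over Q
density-over {zero}  a pos x Q eq = over-zero Q
density-over {suc n} a pos x Q eq = sum-over _ _ Q (reciprocal-over (a zero) {{pos zero}} (x zero) Q (eq zero))
  (density-over (a ∘ suc) (pos ∘ suc) (x ∘ suc) Q (eq ∘ suc))

sumFrom : (ℕ → ℕ) → ℕ → ℕ → ℕ
sumFrom z K zero    = 0
sumFrom z K (suc n) = z K + sumFrom z (suc K) n

-- `partialSum` grows at its last term, whereas the greedy chain uses up terms from the front, as
-- `sumFrom` does. This identity links the two orders.
sumFrom-snoc : ∀ z K n → sumFrom z K (suc n) ≡ sumFrom z K n + z (K + n)
sumFrom-snoc z K zero    = trans (+-identityʳ (z K)) (cong z (sym (+-identityʳ K)))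
sumFrom-snoc z K (suc n) = trans (cong (z K +_) (trans (sumFrom-snoc z (suc K) n) (cong (λ t → sumFrom z (suc K) n + z t) (sym (+-suc K n)))))
  (sym (+-assoc (z K) _ _))

partialSum-over : ∀ N (z : ℕ → ℕ) Q {{_ : NonZero Q}} → (∀ i → i < N → z i * suc (2 ^ i) ≡ Q) →
  toℚᵘ (partialSum N) ≃ᵘ sumFrom z 0 N over Q
partialSum-over zero    z Q eq = over-zero Q
partialSum-over (suc N) z Q eq = subst (λ s → toℚᵘ (partialSum (suc N)) ≃ᵘ s over Q) (sym (sumFrom-snoc z 0 N))
  (sum-over {partialSum N} _ _ Q (partialSum-over N z Q (λ i i<N → eq i (m≤n⇒m≤1+n i<N))) (reciprocal-over (suc (2 ^ N)) (z N) Q (eq N ≤-refl)))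

-- Here the rational hypothesis becomes an inequality of natural numbers over the common denominator
-- `Q`; no rationals occur afterwards.
numerators-≤ : ∀ {n} (a : Fin n → ℕ) pos x N z Q {{_ : NonZero Q}} → (∀ i → x i * a i ≡ Q) → (∀ i → i < N → z i * suc (2 ^ i) ≡ Q) →
  partialSum N ℚ.≤ density a pos → sumFrom z 0 N ≤ ∑ proj₂ (tabulate (λ i → a i , x i))
numerators-≤ a pos x N z Q ax zc h = over-cancel-≤ _ _ Q
  (ℚᵘ.≤-trans (ℚᵘ.≤-reflexive (ℚᵘ.≃-sym (partialSum-over N z Q zc))) (ℚᵘ.≤-trans (ℚ.toℚᵘ-mono-≤ h) (ℚᵘ.≤-reflexive (density-over a pos x Q ax))))

-- Reduction to periods at least 3

-- The certified search, with density 158 / 125 = 1.264. Only `a * x ≤ Q` is asked of the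
-- numerators, since rounding periods leaves lower bounds for the reciprocals rather than exact
-- values.
core : ∀ R Q {{_ : NonZero Q}} → All (λ ax → 3 ≤ proj₁ ax) R → Weighted Q R → 158 * Q ≤ 125 * ∑ proj₂ R → Covers (map proj₁ R) everyDay
-- Reciprocals of known periods are rounded to multiples of 1 / 10^9. Values are counted in units of
-- 1 / 64, periods up to 48 are compared one by one, and the range 48 to 95 of a - 1 starts the
-- halving argument. The `refl` is the evaluation of the whole tree.
core R Q 3≤ wt dense = instantiate 125 158 1000000000 48 6 (s≤s z≤n) refl dense
  where
  instantiate : ∀ A B N T κ {{_ : NonZero A}} {{_ : NonZero N}} → 0 < T → Checker.check A B N T κ certificate [] 3 ≡ true →
    B * Q ≤ A * ∑ proj₂ R → Covers (map proj₁ R) everyDay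
  instantiate A B N T κ 0<T ok′ dense′ = CheckerSound.tree-sound A B N T κ 0<T certificate [] 3 R Q (s≤s z≤n) ok′ 3≤ wt
    (subst₂ _≤_ (left N B Q) (right N A Q (∑ proj₂ R)) (*-monoʳ-≤ N dense′))
    where
    left : ∀ N B Q → N * (B * Q) ≡ B * (N * Q)
    left = solve-∀
    right : ∀ N A Q S → N * (A * S) ≡ A * (N * S + Q * 0)
    right = solve-∀

⊵-map : ∀ (f : ℕ → ℕ) as → (∀ a → a ≤ f a) → as ⊵ map f as
⊵-map f []       h = ⊵-refl
⊵-map f (a ∷ as) h = ⊵-++ (⊵-head (h a)) (⊵-map f as h)

-- ⌈ a / q ⌉ for a ≥ 1
ceil : (q a : ℕ) {{_ : NonZero q}} → ℕ
ceil q a = suc (pred a / q)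

≤*ceil : ∀ q {{_ : NonZero q}} a → a ≤ q * ceil q a
≤*ceil q zero    = z≤n
≤*ceil q (suc a) = subst (suc a ≤_) (*-comm (ceil q (suc a)) q) (m<[1+m/n]*n a q)

2<ceil : ∀ q {{_ : NonZero q}} {a} → q * 2 < a → 2 < ceil q a
2<ceil q {suc a} (s≤s h) = s≤s (subst (_≤ a / q) (trans (cong (_/ q) (*-comm q 2)) (m*n/n≡m 2 q)) (/-monoˡ-≤ q h))

-- The worst case is a = 2 q + 1, which rounds up to 3. If the quotient is 3 + u, then a ≥ (2 + u) q
-- + 1, and three times this exceeds (3 + u) (2 q + 1) by u (q - 1).
ceil-ratio : ∀ q {{_ : NonZero q}} {a} → q * 2 < a → ceil q a * suc (2 * q) ≤ 3 * a
ceil-ratio q {a} h with m≤n⇒∃[o]m+o≡n (2<ceil q h)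
ceil-ratio (suc p) {suc a} h | u , eq = begin
  ceil q (suc a) * suc (2 * q)                        ≡⟨ cong (_* suc (2 * q)) (sym eq) ⟩
  (3 + u) * suc (2 * q)                               ≤⟨ m≤m+n _ (p * u) ⟩
  (3 + u) * suc (2 * q) + p * u                       ≡⟨ regroup p u ⟩
  3 * suc ((2 + u) * q)                               ≡⟨ cong (λ t → 3 * suc (t * q)) (suc-injective eq) ⟩
  3 * suc (a / q * q)                                 ≤⟨ *-monoʳ-≤ 3 (s≤s (m/n*n≤m a q)) ⟩
  3 * suc a                                           ∎
  where
  open ≤-Reasoning
  q : ℕ
  q = suc p
  regroup : ∀ p u → (3 + u) * suc (2 * suc p) + p * u ≡ 3 * suc ((2 + u) * suc p)
  regroup = solve-∀

-- The entries of the list are integer lower bounds for `C / (2 ^ K + 1)`, `C / (2 ^ (K + 1) + 1)`,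
-- and so on, so a numerical estimate of the series becomes a comparison of integers.
Below : ℕ → ℕ → List ℕ → Set
Below C K []       = ⊤
Below C K (k ∷ ks) = k * suc (2 ^ K) ≤ C × Below C (suc K) ks

below-sum : ∀ C K ks z Q → (∀ i → i < length ks → z (K + i) * suc (2 ^ (K + i)) ≡ Q) → Below C K ks →
  ∑ id ks * Q ≤ C * sumFrom z K (length ks)
below-sum C K []       z Q eq below = z≤n
below-sum C K (k ∷ ks) z Q eq (h , below) = begin
  (k + ∑ id ks) * Q                              ≡⟨ *-distribʳ-+ Q k _ ⟩
  k * Q + ∑ id ks * Q                            ≤⟨ +-mono-≤ first (below-sum C (suc K) ks z Q eq′ below) ⟩
  C * z K + C * sumFrom z (suc K) (length ks)           ≡⟨ sym (*-distribˡ-+ C (z K) _) ⟩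
  C * sumFrom z K (suc (length ks))                     ∎
  where
  open ≤-Reasoning
  eq′ : ∀ i → i < length ks → z (suc K + i) * suc (2 ^ (suc K + i)) ≡ Q
  eq′ i i< = subst (λ j → z j * suc (2 ^ j) ≡ Q) (+-suc K i) (eq (suc i) (s≤s i<))
  regroup : ∀ k z c → k * (z * c) ≡ k * c * z
  regroup = solve-∀
  first : k * Q ≤ C * z K
  first = begin
    k * Q                       ≡⟨ cong (k *_) (sym (subst (λ j → z j * suc (2 ^ j) ≡ Q) (+-identityʳ K) (eq 0 (s≤s z≤n)))) ⟩
    k * (z K * suc (2 ^ K))     ≡⟨ regroup k (z K) (suc (2 ^ K)) ⟩
    k * suc (2 ^ K) * z K       ≤⟨ *-monoˡ-≤ (z K) h ⟩
    C * z K                     ∎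

quotients : ℕ → ℕ → ℕ → List ℕ
quotients C K zero    = []
quotients C K (suc n) = C / suc (2 ^ K) ∷ quotients C (suc K) n

quotients-below : ∀ C K n → Below C K (quotients C K n)
quotients-below C K zero    = tt
quotients-below C K (suc n) = m/n*n≤m C (suc (2 ^ K)) , quotients-below C (suc K) n

halves : ℕ → ℕ → List ℕ
halves c zero    = c ∷ []
halves c (suc n) = c * 2 ^ suc n ∷ halves c n

-- Multiplying the entry at position i by its denominator gives c 2^(n+K) + c 2^(n-i). The first
-- summand is constant and the second largest at i = 0, so the condition for the head implies all
-- others.
halves-below : ∀ c n C K → c * (2 ^ (n + K) + 2 ^ n) ≤ C → Below C K (halves c n)
halves-below c zero    C K h = ≤-trans (≤-reflexive (cong (c *_) (+-comm 1 (2 ^ K)))) h , tt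
halves-below c (suc n) C K h =
  ≤-trans (≤-reflexive (trans (expand c (2 ^ suc n) (2 ^ K)) (cong (λ t → c * (t + 2 ^ suc n)) (sym (^-distribˡ-+-* 2 (suc n) K))))) h ,
  halves-below c n C (suc K) (≤-trans (*-monoʳ-≤ c (+-mono-≤ (≤-reflexive (cong (2 ^_) (+-suc n K))) (m≤m+n (2 ^ n) _))) h)
  where expand : ∀ c m k → c * m * suc k ≡ c * (m * k + m)
        expand = solve-∀

-- Here `ks` certifies, scaled by `N`, that the terms from `K` on, multiplied by 2 ^ (K + 1) + 1,
-- add up to at least `B * t / A`.
combine : ∀ N A B t K ks z Q S {{_ : NonZero N}} → (∀ i → i < length ks → z (K + i) * suc (2 ^ (K + i)) ≡ Q) →
  Below (N * suc (2 * 2 ^ K)) K ks → B * t * N ≤ A * ∑ id ks → sumFrom z K (length ks) ≤ S → B * (t * Q) ≤ A * (suc (2 * 2 ^ K) * S)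
combine N A B t K ks z Q S zc below h₁ h₂ = *-cancelˡ-≤ N (begin
  N * (B * (t * Q))                  ≡⟨ e₁ N B t Q ⟩
  B * t * N * Q                      ≤⟨ *-monoˡ-≤ Q h₁ ⟩
  A * ∑ id ks * Q             ≡⟨ *-assoc A _ Q ⟩
  A * (∑ id ks * Q)           ≤⟨ *-monoʳ-≤ A (≤-trans (below-sum _ K ks z Q zc below) (*-monoʳ-≤ (N * q) h₂)) ⟩
  A * (N * q * S)                    ≡⟨ e₂ A N q S ⟩
  N * (A * (q * S))                  ∎)
  where
  open ≤-Reasoning
  q : ℕ
  q = suc (2 * 2 ^ K)
  e₁ : ∀ N B t Q → N * (B * (t * Q)) ≡ B * t * N * Q
  e₁ = solve-∀
  e₂ : ∀ A N q S → A * (N * q * S) ≡ N * (A * (q * S))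
  e₂ = solve-∀

-- For q = 2 ^ K with K ≥ 2 the terms of Σ (2 q + 1) / (q 2 ^ i + 1) are at least 9/5, 1, 1/2, 1/4, ….
halves-dense-below : ∀ c h n K → 5 * c ≡ h * 2 ^ n → Below (5 * c * suc (2 * 2 ^ (2 + K))) (2 + K) (9 * c ∷ halves h n)
halves-dense-below c h n K eq = leading (2 ^ K) (m^n>0 2 K) , halves-below h n _ (3 + K) (≤-reflexive geometric)
  where
  leading : ∀ p → 0 < p → 9 * c * suc (2 * (2 * p)) ≤ 5 * c * suc (2 * (2 * (2 * p)))
  leading (suc p) _ = ≤-trans (m≤m+n _ (4 * (c * p))) (≤-reflexive (regroup c p))
    where regroup : ∀ c p → 9 * c * suc (2 * (2 * suc p)) + 4 * (c * p) ≡ 5 * c * suc (2 * (2 * (2 * suc p)))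
          regroup = solve-∀
  geometric : h * (2 ^ (n + (3 + K)) + 2 ^ n) ≡ 5 * c * suc (2 * 2 ^ (2 + K))
  geometric = trans (cong (λ t → h * (t + 2 ^ n)) (^-distribˡ-+-* 2 n (3 + K)))
    (trans (regroup h (2 ^ n) (2 ^ (3 + K))) (cong (_* suc (2 ^ (3 + K))) (sym eq)))
    where regroup : ∀ c m k → c * (m * k + m) ≡ c * m * suc k
          regroup = solve-∀

-- After the factor (2 q + 1) / 3 with q = 2 ^ K, twelve terms give 1.26401 for K = 0 and about
-- 1.2737 for K = 1. For K ≥ 2 the uniform bound (9/5 + 2 - 1/1024) / 3 exceeds 1.266. At K = 0
-- eleven terms would give only 1.2635, which is where 12 comes from; the scale 10240000 keeps the
-- rounding of the terms well below the margin.
reduced-dense : ∀ K z Q S → (∀ i → i < 12 → z (K + i) * suc (2 ^ (K + i)) ≡ Q) → sumFrom z K 12 ≤ S →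
  158 * (3 * Q) ≤ 125 * (suc (2 * 2 ^ K) * S)
reduced-dense zero          z Q S zc h = combine 10240000 125 158 3 0 (quotients (10240000 * 3) 0 12) z Q S zc
  (quotients-below (10240000 * 3) 0 12) (≤ᵇ⇒≤ (158 * 3 * 10240000) _ tt) h
reduced-dense (suc zero)    z Q S zc h = combine 10240000 125 158 3 1 (quotients (10240000 * 5) 1 12) z Q S zc
  (quotients-below (10240000 * 5) 1 12) (≤ᵇ⇒≤ (158 * 3 * 10240000) _ tt) h
reduced-dense (suc (suc K)) z Q S zc h = instantiate 2048000 10000 refl (≤ᵇ⇒≤ (158 * 3 * (5 * 2048000)) _ tt)
  where
  instantiate : ∀ c g {{_ : NonZero c}} → 5 * c ≡ g * 2 ^ 10 → 158 * 3 * (5 * c) ≤ 125 * ∑ id (9 * c ∷ halves g 10) →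
    158 * (3 * Q) ≤ 125 * (suc (2 * 2 ^ (2 + K)) * S)
  instantiate c g eq numeric = combine (5 * c) 125 158 3 (2 + K) (9 * c ∷ halves g 10) z Q S {{m*n≢0 5 c}} zc
    (halves-dense-below c g 10 K eq) numeric h

sumFrom-≤ : ∀ z K m n → sumFrom z K n ≤ sumFrom z K (m + n)
sumFrom-≤ z K m zero    = z≤n
sumFrom-≤ z K m (suc n) = subst (λ t → sumFrom z K (suc n) ≤ sumFrom z K t) (sym (+-suc m n)) (+-monoʳ-≤ (z K) (sumFrom-≤ z (suc K) m n))

-- Periods are rounded up to multiples of q = 2 ^ K. Inside a slot of period q the quotients act as
-- periods, and they are at least 3. By `ceil-ratio` the numerators `(2 q + 1) x` over `3 Q` bound
-- the reciprocals of the quotients from below, so `core` applies.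
scale-down : ∀ K R z Q {{_ : NonZero Q}} → All (λ ax → 2 ^ K * 2 < proj₁ ax) R → Weighted Q R →
  (∀ i → i < 12 → z (K + i) * suc (2 ^ (K + i)) ≡ Q) → sumFrom z K 12 ≤ ∑ proj₂ R → map proj₁ R ⊵ (2 ^ K ∷ [])
scale-down K R z Q large wt zc dense = go (2 ^ K) {{m^n≢0 2 K}} large refl
  where
  open ≤-Reasoning
  go : ∀ q {{_ : NonZero q}} → All (λ ax → q * 2 < proj₁ ax) R → q ≡ 2 ^ K → map proj₁ R ⊵ (q ∷ [])
  go q large q≡ = ⊵-trans (⊵-map (λ a → q * ceil q a) (map proj₁ R) (≤*ceil q))
    (subst (_⊵ (q ∷ [])) (trans (sym (map-∘ R′)) (trans (sym (map-∘ R)) (map-∘ R))) (⊵-compose q (core R′ (3 * Q) {{m*n≢0 3 Q}}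
      (All.map⁺ (All.map (2<ceil q) large))
      (All.map⁺ (All.zipWith (λ { (h , le) → weighted h le }) (large , wt))) dense′)))
    where
    R′ : List (ℕ × ℕ)
    R′ = map (λ (a , x) → ceil q a , suc (2 * q) * x) R
    weighted : ∀ {a x} → q * 2 < a → a * x ≤ Q → ceil q a * (suc (2 * q) * x) ≤ 3 * Q
    weighted {a} {x} h le = begin
      ceil q a * (suc (2 * q) * x)   ≡⟨ sym (*-assoc (ceil q a) (suc (2 * q)) x) ⟩
      ceil q a * suc (2 * q) * x     ≤⟨ *-monoˡ-≤ x (ceil-ratio q h) ⟩
      3 * a * x                      ≡⟨ *-assoc 3 a x ⟩
      3 * (a * x)                    ≤⟨ *-monoʳ-≤ 3 le ⟩
      3 * Q                          ∎
    ∑-R′ : ∑ proj₂ R′ ≡ suc (2 * q) * ∑ proj₂ R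
    ∑-R′ = trans (cong (sum) (sym (map-∘ R))) (∑-* (suc (2 * q)) proj₂ R)
    dense′ : 158 * (3 * Q) ≤ 125 * ∑ proj₂ R′
    dense′ = subst (λ s → 158 * (3 * Q) ≤ 125 * s)
      (trans (cong (λ t → suc (2 * t) * ∑ proj₂ R) (sym q≡)) (sym ∑-R′)) (reduced-dense K z Q (∑ proj₂ R) zc dense)

-- A job of period at most `2 ^ K` fills the slot alone. One of period at most `2 ^ (K + 1)` takes
-- half of it and uses up no more density than the term 1 / (2 ^ K + 1), so the rest of the sum is
-- still available for the other half. With `n` jobs this happens at most `n` times, and 12 terms
-- remain for `scale-down`.
chain : ∀ n K R z Q {{_ : NonZero Q}} → length R ≡ n → Weighted Q R →
  (∀ i → i < n + 12 → z (K + i) * suc (2 ^ (K + i)) ≡ Q) → sumFrom z K (n + 12) ≤ ∑ proj₂ R → map proj₁ R ⊵ (2 ^ K ∷ [])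
chain n K R z Q len wt zc dense with extract {P = λ ax → proj₁ ax ≤ 2 ^ K} {Q = λ ax → 2 ^ K < proj₁ ax} (All.universal (λ ax → ≤-<-connex (proj₁ ax) (2 ^ K)) R)
... | inj₁ ((a , x) , R′ , a≤ , π) = ⊵-trans (⊵-↭ (map⁺ proj₁ π)) (⊵-weaken (a ∷ []) (⊵-head a≤))
... | inj₂ large with extract {P = λ ax → 2 ^ K < proj₁ ax × proj₁ ax ≤ 2 ^ K * 2} {Q = λ ax → 2 ^ K * 2 < proj₁ ax}
                        (All.map (λ {ax} h → Sum.map₁ (h ,_) (≤-<-connex (proj₁ ax) (2 ^ K * 2))) large)
...   | inj₂ larger = scale-down K R z Q larger wt (λ i i< → zc i (≤-trans i< (m≤n+m 12 n))) (≤-trans (sumFrom-≤ z K n 12) dense)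
chain zero    K []      z Q len wt zc dense | inj₂ large | inj₁ (ax , R′ , _ , π) with ↭-length π
... | ()
chain (suc n) K R z Q len wt zc dense | inj₂ large | inj₁ ((a , x) , R′ , (<a , a≤) , π) =
  -- The extracted job provides one slot of period `2 ^ K * 2`, the remaining jobs provide the
  -- other, and together they make up the slot of period `2 ^ K`.
  ⊵-trans (⊵-↭ (map⁺ proj₁ π)) (⊵-trans (⊵-++ (⊵-head a≤) rest) (⊵-split 2 1 (2 ^ K)))
  where
  open ≤-Reasoning
  wt′ : Weighted Q ((a , x) ∷ R′)
  wt′ = All-resp-↭ π wt
  z-first : z K * suc (2 ^ K) ≡ Q
  z-first = subst (λ j → z j * suc (2 ^ j) ≡ Q) (+-identityʳ K) (zc 0 (s≤s z≤n))
  x≤z : x ≤ z K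
  x≤z = *-cancelʳ-≤ x (z K) (suc (2 ^ K)) (begin
    x * suc (2 ^ K)    ≤⟨ *-monoʳ-≤ x <a ⟩
    x * a              ≡⟨ *-comm x a ⟩
    a * x              ≤⟨ All.head wt′ ⟩
    Q                  ≡⟨ sym z-first ⟩
    z K * suc (2 ^ K)  ∎)
  dense′ : sumFrom z (suc K) (n + 12) ≤ ∑ proj₂ R′
  dense′ = +-cancelˡ-≤ (z K) _ _ (begin
    z K + sumFrom z (suc K) (n + 12)   ≤⟨ dense ⟩
    ∑ proj₂ R                          ≡⟨ ∑-↭ proj₂ π ⟩
    x + ∑ proj₂ R′                     ≤⟨ +-monoˡ-≤ (∑ proj₂ R′) x≤z ⟩
    z K + ∑ proj₂ R′                   ∎)
  rest : map proj₁ R′ ⊵ (2 ^ K * 2 ∷ [])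
  rest = subst (λ t → map proj₁ R′ ⊵ (t ∷ [])) (*-comm 2 (2 ^ K))
    (chain n (suc K) R′ z Q (suc-injective (trans (sym (↭-length π)) len)) (All.tail wt′)
      (λ i i< → subst (λ j → z j * suc (2 ^ j) ≡ Q) (+-suc K i) (zc (suc i) (s≤s i<))) dense′)

-- The common denominator and the conclusion

∏ : ∀ {n} → (Fin n → ℕ) → ℕ
∏ {zero}  a = 1
∏ {suc n} a = a zero * ∏ (a ∘ suc)

∣∏ : ∀ {n} (a : Fin n → ℕ) i → a i ∣ ∏ a
∣∏ a zero    = m∣m*n (∏ (a ∘ suc))
∣∏ a (suc i) = ∣-trans (∣∏ (a ∘ suc) i) (n∣m*n (a zero))

∏-nonZero : ∀ {n} (a : Fin n → ℕ) → (∀ i → NonZero (a i)) → NonZero (∏ a)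
∏-nonZero {zero}  a nz = _
∏-nonZero {suc n} a nz = m*n≢0 (a zero) (∏ (a ∘ suc)) {{nz zero}} {{∏-nonZero (a ∘ suc) (nz ∘ suc)}}

theorem4p7 : (n : ℕ) (a : Fin n → ℕ) (pos : (i : Fin n) → 0 < a i) →
    ((N : ℕ) → partialSum N ℚ.≤ density a (λ i → >-nonZero (pos i))) →
    Schedulable a
-- The chain starts at K = 0 with a single slot of period 1, that is with every day. The partial sum
-- has `n + 12` terms: up to `n` for halvings of the slot and 12 for the final step.
theorem4p7 n a pos dense = covers⇒schedulable a
  (subst (λ l → Covers l everyDay) (map-tabulate (λ i → a i , x i) proj₁)
    (⊵-covers (chain n 0 R z Q (length-tabulate (λ i → a i , x i)) (All.tabulate⁺ (λ i → ≤-reflexive (trans (*-comm (a i) (x i)) (x*a i))))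
        z*c (numerators-≤ a nz x (n + 12) z Q x*a z*c (dense (n + 12))))
      covers-one))
  where
  nz : ∀ i → NonZero (a i)
  nz i = >-nonZero (pos i)
  c : Fin (n + 12) → ℕ
  c i = suc (2 ^ toℕ i)
  Q : ℕ
  -- Divisible by every period and by every denominator `2 ^ i + 1` with `i < n + 12`, so all the
  -- numerators below are exact quotients.
  Q = ∏ a * ∏ c
  instance
    Q≢0 : NonZero Q
    Q≢0 = m*n≢0 (∏ a) (∏ c) {{∏-nonZero a nz}} {{∏-nonZero c (λ _ → _)}}
  x : Fin n → ℕ
  x i = _/_ Q (a i) {{nz i}}
  x*a : ∀ i → x i * a i ≡ Q
  x*a i = m/n*n≡m {{nz i}} (∣-trans (∣∏ a i) (m∣m*n (∏ c)))
  z : ℕ → ℕ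
  z i = Q / suc (2 ^ i)
  z*c : ∀ i → i < n + 12 → z i * suc (2 ^ i) ≡ Q
  z*c i i< = m/n*n≡m (∣-trans (subst (λ j → suc (2 ^ j) ∣ ∏ c) (toℕ-fromℕ< i<) (∣∏ c (fromℕ< i<))) (n∣m*n (∏ a)))
  R : List (ℕ × ℕ)
  R = tabulate (λ i → a i , x i)
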